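{- Let $k\geq2$ be an integer, let $N\geq1$ and $C_0\geq1$. There are constants $c=c(k,C_0)>0$ and $C=C(k)\geq1$ such that the following holds. Let $0<\delta<c$, let $H$ be a positive integer, set $B=N/H$, and suppose that $$\delta^{ -C}\leq B\leq N\delta^{C}.$$ Let $\lambda\colon\mathbb Z^k\to\mathbb C$ be $1$-bounded and supported on $([-C_0B,C_0B]\cap\mathbb Z)^k$, and let $f_1,\ldots,f_k\colon\mathbb Z\to\mathbb C$ be $1$-bounded and supported on $[N]$. If $$|R_H(\lambda;f_1,\ldots,f_k)|\geq\delta B^k\frac{N^2}{B},$$ then $$\min_{1\leq i\leq k}\|f_i\|_{U^{1+}[N]}\geq c\,\delta^C.$$
   Context: For a real number $X\geq1$, $[X]=\{1,\ldots,\lfloor X\rfloor\}$. A function is $1$-bounded if its values have modulus at most $1$. The constant $c$ depends only on $k,C_0$ and $C$ only on $k$ (not on $N$). Counting operator: for $\lambda\colon\mathbb Z^k\to\mathbb C$ and finitely supported $f_1,\ldots,f_k\colon\mathbb Z\to\mathbb C$, $$R_H(\lambda;f_1,\ldots,f_k)=\sum_{\mathbf b=(b_1,\ldots,b_k)\in\mathbb Z^k}\lambda(\mathbf b)\sum_{x\in\mathbb Z}\sum_{m\in[H]}\prod_{i=1}^kf_i(x+b_im).$$ Norm: $\displaystyle\|f\|_{U^{1+}[N]}=\frac1{|[N]|}\max_{P}\Bigl|\sum_{n\in P}f(n)\Bigr|$, the maximum being over all arithmetic progressions $P\subseteq[N]$. -}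

module Defs where

open import Data.Bool.Base using (if_then_else_)
open import Data.Fin.Base using (Fin)
open import Data.Integer.Base as ℤ using (ℤ; +_; -[1+_])
import Data.Integer.Properties as ℤ
open import Data.List.Base
  using (List; []; _∷_; map; concatMap; upTo; filter; foldr; deduplicate; cartesianProductWith)
open import Data.List.Membership.Propositional using (_∈_)
open import Data.List.Membership.Propositional.Properties
  using (∈-map⁺; ∈-concatMap⁺; ∈-upTo⁺; ∈-cartesianProductWith⁺)
open import Data.List.Membership.DecPropositional ℤ._≟_ using (_∈?_)
open import Data.List.Relation.Unary.All as ListAll using ()
open import Data.List.Relation.Unary.Any as Any using (here; there)
open import Data.Nat.Base as ℕ using (ℕ; zero; suc; NonZero)
open import Data.Nat.Coprimality as Coprimality using (1-coprimeTo)
import Data.Nat.Properties as ℕ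
open import Data.Product.Base using (Σ; Σ-syntax; _×_; _,_; proj₁; proj₂)
open import Data.Rational.Base as ℚ using (ℚ; mkℚ; 0ℚ; 1ℚ; ½; *≤*)
import Data.Rational.Properties as ℚ
open import Data.Rational.Solver using (module +-*-Solver)
open import Data.Sum.Base using (_⊎_; inj₁; inj₂; [_,_]′)
open import Data.Vec.Base using (Vec; []; _∷_; lookup)
import Data.Vec.Functional as Tuple
open import Data.Vec.Properties using (≡-dec)
open import Data.Vec.Relation.Unary.All as VecAll using ([]; _∷_)
open import Function.Base using (const)
open import Relation.Binary.Definitions using (DecidableEquality)
open import Relation.Binary.PropositionalEquality
  using (_≡_; refl; sym; trans; cong; cong₂; subst; subst₂; module ≡-Reasoning)
open import Relation.Nullary using (¬_; Dec; does; yes; no; contradiction)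

module Rational where

  open import Data.Rational.Base hiding (ℚ; mkℚ; 0ℚ; 1ℚ; ½; *≤*)
  open +-*-Solver

  fromℤ : ℤ → ℚ
  fromℤ i = mkℚ i 0 (Coprimality.sym (1-coprimeTo _))

  fromℕ : ℕ → ℚ
  fromℕ n = fromℤ (+ n)

  fromℤ-* : ∀ i j → fromℤ (i ℤ.* j) ≡ fromℤ i * fromℤ j
  fromℤ-* i j = sym (ℚ.↥p/↧p≡p (fromℤ (i ℤ.* j)))

  fromℤ-mono : ∀ {i j} → i ℤ.≤ j → fromℤ i ≤ fromℤ j
  fromℤ-mono i≤j = *≤* (ℤ.*-monoʳ-≤-nonNeg (+ 1) i≤j)

  fromℤ-cancel : ∀ {i j} → fromℤ i ≤ fromℤ j → i ℤ.≤ j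
  fromℤ-cancel {i} {j} p =
    subst₂ ℤ._≤_ (ℤ.*-identityʳ i) (ℤ.*-identityʳ j) (ℚ.drop-*≤* p)

  fromℤ-neg : ∀ i → fromℤ (ℤ.- i) ≡ - fromℤ i
  fromℤ-neg (+ zero)  = refl
  fromℤ-neg (+ suc n) = refl
  fromℤ-neg -[1+ n ]  = refl

  ceil : ℚ → ℕ
  ceil q = ℤ.∣ ↥ q ∣

  ≤-ceil : ∀ q → q ≤ fromℕ (ceil q)
  ≤-ceil (mkℚ (+ n) d _) = *≤* (subst₂ ℤ._≤_ (ℤ.pos-* n 1) (ℤ.pos-* n (suc d))
    (ℤ.+≤+ (ℕ.*-monoʳ-≤ n (ℕ.s≤s ℕ.z≤n))))
  ≤-ceil (mkℚ -[1+ n ] d _) = *≤* ℤ.-≤+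

  1/suc : ℕ → ℚ
  1/suc n = mkℚ (+ 1) n (1-coprimeTo (suc n))

  fromℕ*1/suc : ∀ n → fromℕ (suc n) * 1/suc n ≡ 1ℚ
  fromℕ*1/suc n = ℚ.*-inverseˡ (1/suc n)

  archimedean : ∀ ε → 0ℚ < ε → Σ[ M ∈ ℕ ] ∀ n → M ℕ.≤ n → 1/suc n ≤ ε
  archimedean (mkℚ (+ suc p) d _) _ = d , λ n d≤n →
    *≤* (ℤ.+≤+ (ℕ.*-mono-≤ (ℕ.s≤s (ℕ.z≤n {p})) (ℕ.s≤s d≤n)))
  archimedean (mkℚ (+ 0) d c) (*<* (ℤ.+<+ ()))
  archimedean (mkℚ -[1+ _ ] _ _) (*<* ())

  abs-≤ : ∀ {a e} → a ≤ e → - a ≤ e → ∣ a ∣ ≤ e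
  abs-≤ {a} a≤e -a≤e with ℚ.∣p∣≡p∨∣p∣≡-p a
  ... | inj₁ eq = subst (_≤ _) (sym eq) a≤e
  ... | inj₂ eq = subst (_≤ _) (sym eq) -a≤e

  ≤-abs : ∀ a → a ≤ ∣ a ∣
  ≤-abs a with ℚ.≤-total 0ℚ a
  ... | inj₁ 0≤a = ℚ.≤-reflexive (sym (ℚ.0≤p⇒∣p∣≡p 0≤a))
  ... | inj₂ a≤0 = ℚ.≤-trans a≤0 (ℚ.0≤∣p∣ a)

  close⁺ : ∀ {a b e} → a ≤ b + e → b ≤ a + e → ∣ a - b ∣ ≤ e
  close⁺ {a} {b} {e} p q = abs-≤
    (subst (a - b ≤_) (solve 2 (λ b e → b :+ e :- b := e) refl b e) (ℚ.+-monoˡ-≤ (- b) p))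
    (subst₂ _≤_ (solve 2 (λ a b → b :- a := :- (a :- b)) refl a b)
      (solve 2 (λ a e → a :+ e :- a := e) refl a e) (ℚ.+-monoˡ-≤ (- a) q))

  close⁻ : ∀ {a b e} → ∣ a - b ∣ ≤ e → a ≤ b + e
  close⁻ {a} {b} {e} p = subst (_≤ b + e) (solve 2 (λ a b → b :+ (a :- b) := a) refl a b)
    (ℚ.+-monoʳ-≤ b (ℚ.≤-trans (≤-abs (a - b)) p))

  abs-sym : ∀ a b → ∣ a - b ∣ ≡ ∣ b - a ∣
  abs-sym a b = trans (sym (ℚ.∣-p∣≡∣p∣ (a - b)))
    (cong ∣_∣ (solve 2 (λ a b → :- (a :- b) := b :- a) refl a b))

  *-mono-≤ : ∀ {a b c d} → 0ℚ ≤ a → 0ℚ ≤ d → a ≤ b → c ≤ d → a * c ≤ b * d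
  *-mono-≤ {a} {b} {c} {d} 0≤a 0≤d a≤b c≤d = ℚ.≤-trans
    (ℚ.*-monoˡ-≤-nonNeg a {{nonNegative 0≤a}} c≤d)
    (ℚ.*-monoʳ-≤-nonNeg d {{nonNegative 0≤d}} a≤b)

  *-pos : ∀ {a b} → 0ℚ < a → 0ℚ < b → 0ℚ < a * b
  *-pos {a} {b} p q = ℚ.positive⁻¹ (a * b)
    {{ℚ.pos*pos⇒pos a {{positive p}} b {{positive q}}}}

  +-pos : ∀ {a b} → 0ℚ < a → 0ℚ ≤ b → 0ℚ < a + b
  +-pos {a} {b} p q = subst (_< a + b) (ℚ.+-identityˡ 0ℚ) (ℚ.+-mono-<-≤ p q)

  0<½ : 0ℚ < ½
  0<½ = ℚ.positive⁻¹ ½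

  0<1 : 0ℚ < 1ℚ
  0<1 = ℚ.positive⁻¹ 1ℚ

  halves : ∀ e → ½ * e + ½ * e ≡ e
  halves e = trans (sym (ℚ.*-distribʳ-+ e ½ ½)) (ℚ.*-identityˡ e)

  inv : (a : ℚ) → 0ℚ < a → ℚ
  inv a 0<a = (1/ a) {{>-nonZero 0<a}}

  *-inv : ∀ a 0<a → a * inv a 0<a ≡ 1ℚ
  *-inv a 0<a = ℚ.*-inverseʳ a {{>-nonZero 0<a}}

  inv-pos : ∀ a 0<a → 0ℚ < inv a 0<a
  inv-pos a 0<a = ℚ.positive⁻¹ (inv a 0<a) {{ℚ.1/pos⇒pos a {{positive 0<a}}}}

  inv-antimono : ∀ {a b} 0<a 0<b → a ≤ b → inv b 0<b ≤ inv a 0<a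
  inv-antimono {a} {b} 0<a 0<b a≤b = subst₂ _≤_
    (trans (solve 3 (λ a u v → a :* (u :* v) := (a :* u) :* v) refl a (inv a 0<a) (inv b 0<b))
      (trans (cong (_* inv b 0<b) (*-inv a 0<a)) (ℚ.*-identityˡ _)))
    (trans (solve 3 (λ b u v → b :* (u :* v) := u :* (b :* v)) refl b (inv a 0<a) (inv b 0<b))
      (trans (cong (inv a 0<a *_) (*-inv b 0<b)) (ℚ.*-identityʳ _)))
    (ℚ.*-monoʳ-≤-nonNeg (inv a 0<a * inv b 0<b)
      {{nonNegative (ℚ.<⇒≤ (*-pos (inv-pos a 0<a) (inv-pos b 0<b)))}} a≤b)

  +-close : ∀ {a a′ b b′ η} → ∣ a - a′ ∣ ≤ η → ∣ b - b′ ∣ ≤ η →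
            ∣ (a + b) - (a′ + b′) ∣ ≤ η + η
  +-close {a} {a′} {b} {b′} p q = ℚ.≤-trans
    (subst (λ z → ∣ z ∣ ≤ ∣ a - a′ ∣ + ∣ b - b′ ∣)
      (solve 4 (λ a a′ b b′ → (a :- a′) :+ (b :- b′) := (a :+ b) :- (a′ :+ b′)) refl a a′ b b′)
      (ℚ.∣p+q∣≤∣p∣+∣q∣ (a - a′) (b - b′)))
    (ℚ.+-mono-≤ p q)

  neg-close : ∀ {a a′ η} → ∣ a - a′ ∣ ≤ η → ∣ (- a) - (- a′) ∣ ≤ η
  neg-close {a} {a′} {η} = subst (_≤ η) (trans (sym (ℚ.∣-p∣≡∣p∣ (a - a′)))
    (cong ∣_∣ (solve 2 (λ a b → :- (a :- b) := :- a :- :- b) refl a a′)))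

  *-close : ∀ {a a′ b b′ K L η} → ∣ a ∣ ≤ K → ∣ b′ ∣ ≤ L →
            ∣ a - a′ ∣ ≤ η → ∣ b - b′ ∣ ≤ η →
            ∣ a * b - a′ * b′ ∣ ≤ (K + L) * η
  *-close {a} {a′} {b} {b′} {K} {L} {η} a≤K b′≤L p q = begin
    ∣ a * b - a′ * b′ ∣
      ≡⟨ cong ∣_∣ (solve 4 (λ a a′ b b′ →
           a :* b :- a′ :* b′ := a :* (b :- b′) :+ b′ :* (a :- a′)) refl a a′ b b′) ⟩
    ∣ a * (b - b′) + b′ * (a - a′) ∣
      ≤⟨ ℚ.∣p+q∣≤∣p∣+∣q∣ (a * (b - b′)) (b′ * (a - a′)) ⟩
    ∣ a * (b - b′) ∣ + ∣ b′ * (a - a′) ∣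
      ≡⟨ cong₂ _+_ (ℚ.∣p*q∣≡∣p∣*∣q∣ a (b - b′)) (ℚ.∣p*q∣≡∣p∣*∣q∣ b′ (a - a′)) ⟩
    ∣ a ∣ * ∣ b - b′ ∣ + ∣ b′ ∣ * ∣ a - a′ ∣
      ≤⟨ ℚ.+-mono-≤ (*-mono-≤ (ℚ.0≤∣p∣ a) (ℚ.≤-trans (ℚ.0≤∣p∣ _) q) a≤K q)
                    (*-mono-≤ (ℚ.0≤∣p∣ b′) (ℚ.≤-trans (ℚ.0≤∣p∣ _) p) b′≤L p) ⟩
    K * η + L * η
      ≡⟨ sym (ℚ.*-distribʳ-+ η K L) ⟩
    (K + L) * η ∎
    where open ℚ.≤-Reasoning

  ⊔-close : ∀ {a a′ b b′ η} → ∣ a - a′ ∣ ≤ η → ∣ b - b′ ∣ ≤ η →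
            ∣ (a ⊔ b) - (a′ ⊔ b′) ∣ ≤ η
  ⊔-close {a} {a′} {b} {b′} {η} p q = close⁺
    (half a a′ b b′ p q)
    (half a′ a b′ b (subst (_≤ η) (abs-sym a a′) p) (subst (_≤ η) (abs-sym b b′) q))
    where
    half : ∀ a a′ b b′ → ∣ a - a′ ∣ ≤ η → ∣ b - b′ ∣ ≤ η → a ⊔ b ≤ (a′ ⊔ b′) + η
    half a a′ b b′ p q = ℚ.⊔-lub
      (ℚ.≤-trans (close⁻ {a} {a′} p) (ℚ.+-monoˡ-≤ η (ℚ.p≤p⊔q a′ b′)))
      (ℚ.≤-trans (close⁻ {b} {b′} q) (ℚ.+-monoˡ-≤ η (ℚ.p≤q⊔p a′ b′)))

  ⊓-close : ∀ {a a′ b b′ η} → ∣ a - a′ ∣ ≤ η → ∣ b - b′ ∣ ≤ η →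
            ∣ (a ⊓ b) - (a′ ⊓ b′) ∣ ≤ η
  ⊓-close {a} {a′} {b} {b′} {η} p q = close⁺
    (half a a′ b b′ p q)
    (half a′ a b′ b (subst (_≤ η) (abs-sym a a′) p) (subst (_≤ η) (abs-sym b b′) q))
    where
    half : ∀ a a′ b b′ → ∣ a - a′ ∣ ≤ η → ∣ b - b′ ∣ ≤ η → a ⊓ b ≤ (a′ ⊓ b′) + η
    half a a′ b b′ p q with ℚ.⊓-sel a′ b′
    ... | inj₁ eq = subst (λ z → a ⊓ b ≤ z + η) (sym eq)
                      (ℚ.≤-trans (ℚ.p⊓q≤p a b) (close⁻ {a} {a′} p))
    ... | inj₂ eq = subst (λ z → a ⊓ b ≤ z + η) (sym eq)
                      (ℚ.≤-trans (ℚ.p⊓q≤q a b) (close⁻ {b} {b′} q))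

  inv-close : ∀ {a b κ η} 0<a 0<b 0<κ → κ ≤ a → κ ≤ b → ∣ a - b ∣ ≤ η →
              ∣ inv a 0<a - inv b 0<b ∣ ≤ η * (inv κ 0<κ * inv κ 0<κ)
  inv-close {a} {b} {κ} {η} 0<a 0<b 0<κ κ≤a κ≤b p = begin
    ∣ u - v ∣
      ≡⟨ cong ∣_∣ (sym expand) ⟩
    ∣ (b - a) * (u * v) ∣
      ≡⟨ ℚ.∣p*q∣≡∣p∣*∣q∣ (b - a) (u * v) ⟩
    ∣ b - a ∣ * ∣ u * v ∣
      ≡⟨ cong (∣ b - a ∣ *_) (ℚ.0≤p⇒∣p∣≡p (ℚ.<⇒≤ 0<uv)) ⟩
    ∣ b - a ∣ * (u * v)
      ≤⟨ *-mono-≤ (ℚ.0≤∣p∣ (b - a)) (ℚ.<⇒≤ (*-pos 0<w 0<w))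
           (subst (_≤ η) (abs-sym a b) p)
           (*-mono-≤ (ℚ.<⇒≤ 0<u) (ℚ.<⇒≤ 0<w)
             (inv-antimono 0<κ 0<a κ≤a) (inv-antimono 0<κ 0<b κ≤b)) ⟩
    η * (w * w) ∎
    where
    open ℚ.≤-Reasoning
    u = inv a 0<a
    v = inv b 0<b
    w = inv κ 0<κ
    0<u = inv-pos a 0<a
    0<w = inv-pos κ 0<κ
    0<uv = *-pos 0<u (inv-pos b 0<b)
    expand : (b - a) * (u * v) ≡ u - v
    expand = trans
      (solve 4 (λ a b u v → (b :- a) :* (u :* v) := u :* (b :* v) :- (a :* u) :* v) refl a b u v)
      (cong₂ _-_ (trans (cong (u *_) (*-inv b 0<b)) (ℚ.*-identityʳ u))
                 (trans (cong (_* v) (*-inv a 0<a)) (ℚ.*-identityˡ v)))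

  fromℕ-suc : ∀ j → fromℕ (suc j) ≡ fromℕ j + 1ℚ
  fromℕ-suc j = sym (trans
    (cong (λ i → (i ℤ.+ + 1) ℚ./ 1) (ℤ.*-identityʳ (+ j)))
    (trans (cong (λ i → + i ℚ./ 1) (ℕ.+-comm j 1)) (ℚ.↥p/↧p≡p (fromℕ (suc j)))))

  grid : ℕ → ℕ → ℚ
  grid n j = fromℕ j * 1/suc n

  -- The largest point of 0, 1/(n+1), …, j/(n+1) whose square is at most q
  -- (0 if there is none).
  rootFrom : ℚ → ℕ → ℕ → ℚ
  rootFrom q n zero    = 0ℚ
  rootFrom q n (suc j) =
    if does (grid n (suc j) * grid n (suc j) ℚ.≤? q) then grid n (suc j) else rootFrom q n j

  -- √(q ⊔ 0), rounded down to a multiple of 1/(n+1).  The search may start at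
  -- ⌈q⌉ + 1, since q < (⌈q⌉ + 1)² for q ≥ 0.
  sqrtBelow : ℕ → ℚ → ℚ
  sqrtBelow n q = rootFrom q n (suc (ceil q) ℕ.* suc n)

  0≤1/suc : ∀ n → 0ℚ ≤ 1/suc n
  0≤1/suc n = ℚ.nonNegative⁻¹ (1/suc n)

  0≤fromℕ : ∀ n → 0ℚ ≤ fromℕ n
  0≤fromℕ n = fromℤ-mono (ℤ.+≤+ ℕ.z≤n)

  *-nonNeg : ∀ {a b} → 0ℚ ≤ a → 0ℚ ≤ b → 0ℚ ≤ a * b
  *-nonNeg {a} {b} p q = ℚ.nonNegative⁻¹ (a * b)
    {{ℚ.nonNeg*nonNeg⇒nonNeg a {{nonNegative p}} b {{nonNegative q}}}}

  grid-suc : ∀ n j → grid n (suc j) ≡ grid n j + 1/suc n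
  grid-suc n j = begin
    fromℕ (suc j) * 1/suc n           ≡⟨ cong (_* 1/suc n) (fromℕ-suc j) ⟩
    (fromℕ j + 1ℚ) * 1/suc n          ≡⟨ ℚ.*-distribʳ-+ (1/suc n) (fromℕ j) 1ℚ ⟩
    grid n j + 1ℚ * 1/suc n           ≡⟨ cong (λ z → grid n j + z) (ℚ.*-identityˡ (1/suc n)) ⟩
    grid n j + 1/suc n                ∎
    where open ≡-Reasoning

  if-elim : ∀ {P : Set} {a b} (C : ℚ → Set) (d : Dec P) →
            (P → C a) → (¬ P → C b) → C (if does d then a else b)
  if-elim C (yes p) f g = f p
  if-elim C (no ¬p) f g = g ¬p

  rootFrom-nonNeg : ∀ q n j → 0ℚ ≤ rootFrom q n j
  rootFrom-nonNeg q n zero    = ℚ.≤-refl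
  rootFrom-nonNeg q n (suc j) = if-elim (0ℚ ≤_) (grid n (suc j) * grid n (suc j) ℚ.≤? q)
    (λ _ → *-nonNeg (0≤fromℕ (suc j)) (0≤1/suc n))
    (λ _ → rootFrom-nonNeg q n j)

  rootFrom-lower : ∀ q n j → rootFrom q n j ≡ 0ℚ ⊎ rootFrom q n j * rootFrom q n j ≤ q
  rootFrom-lower q n zero    = inj₁ refl
  rootFrom-lower q n (suc j) = if-elim (λ r → r ≡ 0ℚ ⊎ r * r ≤ q)
    (grid n (suc j) * grid n (suc j) ℚ.≤? q) inj₂ (λ _ → rootFrom-lower q n j)

  rootFrom-upper : ∀ q n j → q < grid n (suc j) * grid n (suc j) →
                   q < (rootFrom q n j + 1/suc n) * (rootFrom q n j + 1/suc n)
  rootFrom-upper q n zero lt = subst (λ z → q < z * z)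
    (trans (grid-suc n 0) (cong (_+ 1/suc n) (ℚ.*-zeroˡ (1/suc n)))) lt
  rootFrom-upper q n (suc j) lt = if-elim (λ r → q < (r + 1/suc n) * (r + 1/suc n))
    (grid n (suc j) * grid n (suc j) ℚ.≤? q)
    (λ _ → subst (λ z → q < z * z) (grid-suc n (suc j)) lt)
    (λ ≰q → rootFrom-upper q n j (ℚ.≰⇒> ≰q))

  sqrtBelow-upper : ∀ q n → q < (sqrtBelow n q + 1/suc n) * (sqrtBelow n q + 1/suc n)
  sqrtBelow-upper q n = rootFrom-upper q n J (begin-strict
    q           ≤⟨ ≤-ceil q ⟩
    fromℕ (ceil q) ≡⟨ sym (ℚ.+-identityʳ _) ⟩
    fromℕ (ceil q) + 0ℚ <⟨ ℚ.+-monoʳ-< (fromℕ (ceil q)) 0<1 ⟩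
    fromℕ (ceil q) + 1ℚ ≡⟨ sym (fromℕ-suc (ceil q)) ⟩
    a           ≡⟨ sym (ℚ.*-identityʳ a) ⟩
    a * 1ℚ      ≤⟨ *-mono-≤ 0≤a 0≤g a≤g (ℚ.≤-trans 1≤a a≤g) ⟩
    g * g       ∎)
    where
    open ℚ.≤-Reasoning
    J = suc (ceil q) ℕ.* suc n
    a = fromℕ (suc (ceil q))
    g = grid n (suc J)
    0≤a = 0≤fromℕ (suc (ceil q))
    0≤g : 0ℚ ≤ g
    0≤g = *-nonNeg (0≤fromℕ (suc J)) (0≤1/suc n)
    1≤a : 1ℚ ≤ a
    1≤a = fromℤ-mono (ℤ.+≤+ (ℕ.s≤s (ℕ.z≤n {ceil q})))
    a≤g : a ≤ g
    a≤g = begin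
      a                              ≡⟨ sym (ℚ.*-identityʳ a) ⟩
      a * 1ℚ                         ≡⟨ cong (a *_) (sym (fromℕ*1/suc n)) ⟩
      a * (fromℕ (suc n) * 1/suc n)  ≡⟨ sym (ℚ.*-assoc a (fromℕ (suc n)) (1/suc n)) ⟩
      a * fromℕ (suc n) * 1/suc n    ≡⟨ cong (_* 1/suc n) (sym (fromℤ-* (+ suc (ceil q)) (+ suc n))) ⟩
      fromℤ (+ suc (ceil q) ℤ.* + suc n) * 1/suc n ≡⟨⟩
      grid n J                       ≡⟨ sym (ℚ.+-identityʳ _) ⟩
      grid n J + 0ℚ                  ≤⟨ ℚ.+-monoʳ-≤ (grid n J) (0≤1/suc n) ⟩
      grid n J + 1/suc n             ≡⟨ sym (grid-suc n J) ⟩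
      g                              ∎

  -- If x, y differ by at most h², their approximate roots differ by at most 2h.
  sqrtBelow-close : ∀ {h x y} m n → 0ℚ < h → 1/suc n ≤ h → x ≤ y + h * h →
                    sqrtBelow m x ≤ sqrtBelow n y + (h + h)
  sqrtBelow-close {h} {x} {y} m n 0<h n≤h x≤y =
    [ case₁ , case₂ ]′ (rootFrom-lower x m (suc (ceil x) ℕ.* suc m))
    where
    open ℚ.≤-Reasoning
    r = sqrtBelow m x
    s = sqrtBelow n y
    0≤r : 0ℚ ≤ r
    0≤r = rootFrom-nonNeg x m (suc (ceil x) ℕ.* suc m)
    0≤s : 0ℚ ≤ s
    0≤s = rootFrom-nonNeg y n (suc (ceil y) ℕ.* suc n)
    0≤h = ℚ.<⇒≤ 0<h
    0≤+ : ∀ {a b} → 0ℚ ≤ a → 0ℚ ≤ b → 0ℚ ≤ a + b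
    0≤+ {a} {b} p q = subst (_≤ a + b) (ℚ.+-identityˡ 0ℚ) (ℚ.+-mono-≤ p q)

    case₁ : r ≡ 0ℚ → r ≤ s + (h + h)
    case₁ eq = subst (_≤ s + (h + h)) (sym eq) (0≤+ 0≤s (0≤+ 0≤h 0≤h))

    case₂ : r * r ≤ x → r ≤ s + (h + h)
    case₂ r²≤x = ℚ.≮⇒≥ λ lt → ℚ.<-irrefl {r * r} refl (begin-strict
      r * r                       ≤⟨ r²≤x ⟩
      x                           ≤⟨ x≤y ⟩
      y + h * h                   <⟨ ℚ.+-monoˡ-< (h * h) (sqrtBelow-upper y n) ⟩
      (s + 1/suc n) * (s + 1/suc n) + h * h
        ≤⟨ ℚ.+-monoˡ-≤ (h * h) (*-mono-≤ (0≤+ 0≤s (0≤1/suc n)) (0≤+ 0≤s 0≤h)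
             (ℚ.+-monoʳ-≤ s n≤h) (ℚ.+-monoʳ-≤ s n≤h)) ⟩
      (s + h) * (s + h) + h * h   ≡⟨ sym (ℚ.+-identityʳ _) ⟩
      (s + h) * (s + h) + h * h + 0ℚ
        ≤⟨ ℚ.+-monoʳ-≤ ((s + h) * (s + h) + h * h)
             (*-nonNeg 0≤h (0≤+ (0≤+ 0≤s 0≤s) (0≤+ 0≤h 0≤h))) ⟩
      (s + h) * (s + h) + h * h + h * ((s + s) + (h + h))
        ≡⟨ solve 2 (λ s h → (s :+ h) :* (s :+ h) :+ h :* h :+ h :* ((s :+ s) :+ (h :+ h))
                         := (s :+ (h :+ h)) :* (s :+ (h :+ h))) refl s h ⟩
      (s + (h + h)) * (s + (h + h))
        ≤⟨ *-mono-≤ (0≤+ 0≤s (0≤+ 0≤h 0≤h)) 0≤r (ℚ.<⇒≤ lt) (ℚ.<⇒≤ lt) ⟩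
      r * r                       ∎)

open Rational using (inv; ceil; ≤-ceil; sqrtBelow; 0<½; 0<1)

Eventually : (ℕ → Set) → Set
Eventually P = Σ[ M ∈ ℕ ] ∀ n → M ℕ.≤ n → P n

Cauchy : (ℕ → ℚ) → Set
Cauchy s = ∀ ε → 0ℚ ℚ.< ε →
  Σ[ M ∈ ℕ ] ∀ m n → M ℕ.≤ m → M ℕ.≤ n → ℚ.∣ s m ℚ.- s n ∣ ℚ.≤ ε

record ℝ : Set where
  constructor mkℝ
  field
    seq    : ℕ → ℚ
    cauchy : Cauchy seq

open ℝ public

infix  4 _≈_ _≤_ _<_
infixl 6 _+_ _⊔_
infixl 7 _*_ _⊓_ _/_[_]
infix  8 -_
infixr 9 _^_

record _≈_ (x y : ℝ) : Set where
  constructor mk≈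
  field ≈-within : ∀ ε → 0ℚ ℚ.< ε → Eventually λ n → ℚ.∣ seq x n ℚ.- seq y n ∣ ℚ.≤ ε

-- Equivalent to ¬ (y < x).
record _≤_ (x y : ℝ) : Set where
  constructor mk≤
  field ≤-within : ∀ ε → 0ℚ ℚ.< ε → Eventually λ n → seq x n ℚ.≤ seq y n ℚ.+ ε

record _<_ (x y : ℝ) : Set where
  constructor mk<
  field
    gap     : ℚ
    0<gap   : 0ℚ ℚ.< gap
    gap-bound : Eventually λ n → seq x n ℚ.+ gap ℚ.≤ seq y n

open _≈_ public
open _≤_ public
open _<_ public

both : ∀ {P Q : ℕ → Set} → Eventually P → Eventually Q → Eventually λ n → P n × Q n
both (M , p) (M′ , q) = M ℕ.⊔ M′ , λ n le →
  p n (ℕ.≤-trans (ℕ.m≤m⊔n M M′) le) , q n (ℕ.≤-trans (ℕ.m≤n⊔m M M′) le)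

weaken : ∀ {P Q : ℕ → Set} → (∀ n → P n → Q n) → Eventually P → Eventually Q
weaken f (M , p) = M , λ n M≤n → f n (p n M≤n)

bounded : ∀ x → Σ[ K ∈ ℚ ] 0ℚ ℚ.< K × Eventually λ n → ℚ.∣ seq x n ∣ ℚ.≤ K
bounded x with cauchy x 1ℚ 0<1
... | M , close = K , 0<K , M , λ n M≤n → bound n (close n M M≤n ℕ.≤-refl)
  where
  K = 1ℚ ℚ.+ ℚ.∣ seq x M ∣
  0<K = Rational.+-pos 0<1 (ℚ.0≤∣p∣ (seq x M))
  bound : ∀ n → ℚ.∣ seq x n ℚ.- seq x M ∣ ℚ.≤ 1ℚ → ℚ.∣ seq x n ∣ ℚ.≤ K
  bound n p = subst (λ z → ℚ.∣ z ∣ ℚ.≤ K)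
    (solve 2 (λ a b → (a :- b) :+ b := a) refl (seq x n) (seq x M))
    (ℚ.≤-trans (ℚ.∣p+q∣≤∣p∣+∣q∣ (seq x n ℚ.- seq x M) (seq x M))
      (ℚ.+-monoˡ-≤ ℚ.∣ seq x M ∣ p))
    where open +-*-Solver

<-⊔ : ∀ q {κ} → 0ℚ ℚ.< κ → 0ℚ ℚ.< q ℚ.⊔ κ
<-⊔ q {κ} 0<κ = ℚ.<-≤-trans 0<κ (ℚ.p≤q⊔p q κ)

-- The proofs of convergence are abstract: only the sequences matter, and
-- unfolding the proofs makes conversion checking prohibitively slow.
abstract

  const-cauchy : ∀ q → Cauchy (const q)
  const-cauchy q ε 0<ε = 0 , λ _ _ _ _ →
    subst (ℚ._≤ ε) (cong ℚ.∣_∣ (sym (ℚ.+-inverseʳ q))) (ℚ.<⇒≤ 0<ε)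

  +-cauchy : ∀ x y → Cauchy (λ n → seq x n ℚ.+ seq y n)
  +-cauchy x y ε 0<ε =
    let 0<η      = Rational.*-pos 0<½ 0<ε
        (M , p)  = cauchy x (½ ℚ.* ε) 0<η
        (M′ , q) = cauchy y (½ ℚ.* ε) 0<η
        l        = ℕ.m≤m⊔n M M′
        r        = ℕ.m≤n⊔m M M′
    in M ℕ.⊔ M′ , λ m n M≤m M≤n → subst (_ ℚ.≤_) (Rational.halves ε)
         (Rational.+-close {seq x m} {seq x n} {seq y m} {seq y n}
           (p m n (ℕ.≤-trans l M≤m) (ℕ.≤-trans l M≤n))
           (q m n (ℕ.≤-trans r M≤m) (ℕ.≤-trans r M≤n)))

  neg-cauchy : ∀ x → Cauchy (λ n → ℚ.- seq x n)
  neg-cauchy x ε 0<ε =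
    let (M , p) = cauchy x ε 0<ε
    in M , λ m n M≤m M≤n → Rational.neg-close {seq x m} {seq x n} (p m n M≤m M≤n)

  ⊔-cauchy : ∀ x y → Cauchy (λ n → seq x n ℚ.⊔ seq y n)
  ⊔-cauchy x y ε 0<ε =
    let (M , p)  = cauchy x ε 0<ε
        (M′ , q) = cauchy y ε 0<ε
        l        = ℕ.m≤m⊔n M M′
        r        = ℕ.m≤n⊔m M M′
    in M ℕ.⊔ M′ , λ m n M≤m M≤n → Rational.⊔-close {seq x m} {seq x n} {seq y m} {seq y n}
         (p m n (ℕ.≤-trans l M≤m) (ℕ.≤-trans l M≤n))
         (q m n (ℕ.≤-trans r M≤m) (ℕ.≤-trans r M≤n))

  ⊓-cauchy : ∀ x y → Cauchy (λ n → seq x n ℚ.⊓ seq y n)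
  ⊓-cauchy x y ε 0<ε =
    let (M , p)  = cauchy x ε 0<ε
        (M′ , q) = cauchy y ε 0<ε
        l        = ℕ.m≤m⊔n M M′
        r        = ℕ.m≤n⊔m M M′
    in M ℕ.⊔ M′ , λ m n M≤m M≤n → Rational.⊓-close {seq x m} {seq x n} {seq y m} {seq y n}
         (p m n (ℕ.≤-trans l M≤m) (ℕ.≤-trans l M≤n))
         (q m n (ℕ.≤-trans r M≤m) (ℕ.≤-trans r M≤n))

  *-cauchy : ∀ x y → Cauchy (λ n → seq x n ℚ.* seq y n)
  *-cauchy x y ε 0<ε =
    let (K , 0<K , bx) = bounded x
        (L , 0<L , by) = bounded y
        0<K+L      = Rational.+-pos 0<K (ℚ.<⇒≤ 0<L)
        w          = inv (K ℚ.+ L) 0<K+L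
        0<η        = Rational.*-pos (Rational.inv-pos (K ℚ.+ L) 0<K+L) 0<ε
        (M₁ , b)   = both bx by
        (M₂ , p)   = cauchy x (w ℚ.* ε) 0<η
        (M₃ , q)   = cauchy y (w ℚ.* ε) 0<η
        M          = M₁ ℕ.⊔ (M₂ ℕ.⊔ M₃)
        l₁         = ℕ.m≤m⊔n M₁ (M₂ ℕ.⊔ M₃)
        l₂         = ℕ.≤-trans (ℕ.m≤m⊔n M₂ M₃) (ℕ.m≤n⊔m M₁ (M₂ ℕ.⊔ M₃))
        l₃         = ℕ.≤-trans (ℕ.m≤n⊔m M₂ M₃) (ℕ.m≤n⊔m M₁ (M₂ ℕ.⊔ M₃))
    in M , λ m n M≤m M≤n → subst (_ ℚ.≤_)
         (trans (sym (ℚ.*-assoc (K ℚ.+ L) w ε))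
           (trans (cong (ℚ._* ε) (Rational.*-inv (K ℚ.+ L) 0<K+L)) (ℚ.*-identityˡ ε)))
         (Rational.*-close {seq x m} {seq x n} {seq y m} {seq y n}
           (proj₁ (b m (ℕ.≤-trans l₁ M≤m))) (proj₂ (b n (ℕ.≤-trans l₁ M≤n)))
           (p m n (ℕ.≤-trans l₂ M≤m) (ℕ.≤-trans l₂ M≤n))
           (q m n (ℕ.≤-trans l₃ M≤m) (ℕ.≤-trans l₃ M≤n)))

  √-cauchy : ∀ x → Cauchy (λ n → sqrtBelow n (seq x n))
  √-cauchy x ε 0<ε =
    let h        = ½ ℚ.* ε
        0<h      = Rational.*-pos 0<½ 0<ε
        (M , p)  = cauchy x (h ℚ.* h) (Rational.*-pos 0<h 0<h)
        (M′ , q) = Rational.archimedean h 0<h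
        l        = ℕ.m≤m⊔n M M′
        r        = ℕ.m≤n⊔m M M′
        half : ∀ m n → M ℕ.⊔ M′ ℕ.≤ m → M ℕ.⊔ M′ ℕ.≤ n →
               sqrtBelow m (seq x m) ℚ.≤ sqrtBelow n (seq x n) ℚ.+ ε
        half m n M≤m M≤n = subst (λ e → _ ℚ.≤ sqrtBelow n (seq x n) ℚ.+ e) (Rational.halves ε)
          (Rational.sqrtBelow-close m n 0<h (q n (ℕ.≤-trans r M≤n))
            (Rational.close⁻ {seq x m} {seq x n} (p m n (ℕ.≤-trans l M≤m) (ℕ.≤-trans l M≤n))))
    in M ℕ.⊔ M′ , λ m n M≤m M≤n → Rational.close⁺ (half m n M≤m M≤n) (half n m M≤n M≤m)

  simplify : ∀ ε κ 0<κ → ε ℚ.* (κ ℚ.* κ) ℚ.* (inv κ 0<κ ℚ.* inv κ 0<κ) ≡ ε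
  simplify ε κ 0<κ = trans
    (solve 3 (λ e k w → e :* (k :* k) :* (w :* w) := e :* ((k :* w) :* (k :* w)))
      refl ε κ (inv κ 0<κ))
    (trans (cong (λ z → ε ℚ.* (z ℚ.* z)) (Rational.*-inv κ 0<κ)) (ℚ.*-identityʳ ε))
    where open +-*-Solver

  recip-cauchy : ∀ x κ (0<κ : 0ℚ ℚ.< κ) → Cauchy (λ n → inv (seq x n ℚ.⊔ κ) (<-⊔ (seq x n) 0<κ))
  recip-cauchy x κ 0<κ ε 0<ε =
    let (M , p) = cauchy x (ε ℚ.* (κ ℚ.* κ)) (Rational.*-pos 0<ε (Rational.*-pos 0<κ 0<κ))
    in M , λ m n M≤m M≤n → subst (_ ℚ.≤_) (simplify ε κ 0<κ)
         (Rational.inv-close {seq x m ℚ.⊔ κ} {seq x n ℚ.⊔ κ} (<-⊔ (seq x m) 0<κ) (<-⊔ (seq x n) 0<κ) 0<κ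
           (ℚ.p≤q⊔p (seq x m) κ) (ℚ.p≤q⊔p (seq x n) κ)
           (Rational.⊔-close {seq x m} {seq x n} {κ} {κ} (p m n M≤m M≤n)
             (subst (ℚ._≤ ε ℚ.* (κ ℚ.* κ)) (cong ℚ.∣_∣ (sym (ℚ.+-inverseʳ κ)))
               (ℚ.<⇒≤ (Rational.*-pos 0<ε (Rational.*-pos 0<κ 0<κ))))))

fromℚ : ℚ → ℝ
fromℚ q = mkℝ (const q) (const-cauchy q)

fromℤ : ℤ → ℝ
fromℤ i = fromℚ (Rational.fromℤ i)

fromℕ : ℕ → ℝ
fromℕ n = fromℤ (+ n)

0ℝ 1ℝ : ℝ
0ℝ = fromℕ 0
1ℝ = fromℕ 1

_+_ : ℝ → ℝ → ℝ
x + y = mkℝ (λ n → seq x n ℚ.+ seq y n) (+-cauchy x y)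

-_ : ℝ → ℝ
- x = mkℝ (λ n → ℚ.- seq x n) (neg-cauchy x)

_⊔_ : ℝ → ℝ → ℝ
x ⊔ y = mkℝ (λ n → seq x n ℚ.⊔ seq y n) (⊔-cauchy x y)

_⊓_ : ℝ → ℝ → ℝ
x ⊓ y = mkℝ (λ n → seq x n ℚ.⊓ seq y n) (⊓-cauchy x y)

_*_ : ℝ → ℝ → ℝ
x * y = mkℝ (λ n → seq x n ℚ.* seq y n) (*-cauchy x y)

-- √ (x ⊔ 0)
√_ : ℝ → ℝ
√ x = mkℝ (λ n → sqrtBelow n (seq x n)) (√-cauchy x)

_^_ : ℝ → ℕ → ℝ
x ^ zero  = 1ℝ
x ^ suc n = x * x ^ n

-- The witness of 0 < x provides κ > 0 with κ ≤ xₙ for large n, so that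
-- xₙ ⊔ κ = xₙ for large n; the truncation makes every term invertible.
recip : (x : ℝ) → 0ℝ < x → ℝ
recip x (mk< κ 0<κ _) =
  mkℝ (λ n → inv (seq x n ℚ.⊔ κ) (<-⊔ (seq x n) 0<κ)) (recip-cauchy x κ 0<κ)

_/_[_] : (x y : ℝ) → 0ℝ < y → ℝ
x / y [ 0<y ] = x * recip y 0<y

fromℕ-pos : ∀ n .{{_ : NonZero n}} → 0ℝ < fromℕ n
fromℕ-pos (suc n) = mk< 1ℚ 0<1 (0 , λ _ _ →
  Rational.fromℤ-mono {+ 1} {+ suc n} (ℤ.+≤+ (ℕ.s≤s ℕ.z≤n)))

1≤⇒pos : ∀ {x} → 1ℝ ≤ x → 0ℝ < x
1≤⇒pos {x} 1≤x = mk< ½ 0<½ (weaken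
  (λ n p → subst (½ ℚ.≤_) (solve 1 (λ a → a :+ con ½ :- con ½ := a) refl (seq x n))
    (ℚ.+-monoˡ-≤ (ℚ.- ½) p))
  (≤-within 1≤x ½ 0<½))
  where open +-*-Solver

*-pos : ∀ {x y} → 0ℝ < x → 0ℝ < y → 0ℝ < x * y
*-pos {x} {y} (mk< κ 0<κ p) (mk< μ 0<μ q) = mk< (κ ℚ.* μ) (Rational.*-pos 0<κ 0<μ) (weaken
  (λ n (κ≤x , μ≤y) →
    let κ≤x′ = subst (ℚ._≤ seq x n) (ℚ.+-identityˡ κ) κ≤x
        μ≤y′ = subst (ℚ._≤ seq y n) (ℚ.+-identityˡ μ) μ≤y
    in subst (ℚ._≤ seq x n ℚ.* seq y n) (sym (ℚ.+-identityˡ (κ ℚ.* μ)))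
         (Rational.*-mono-≤ (ℚ.<⇒≤ 0<κ) (ℚ.≤-trans (ℚ.<⇒≤ 0<μ) μ≤y′) κ≤x′ μ≤y′))
  (both p q))

recip-pos : ∀ x 0<x → 0ℝ < recip x 0<x
recip-pos x 0<x@(mk< κ 0<κ _) = mk< w (Rational.inv-pos (K ℚ.⊔ κ) 0<K⊔κ) (weaken
  (λ n le → subst (ℚ._≤ seq (recip x 0<x) n) (sym (ℚ.+-identityˡ w)) (w≤ n le))
  (proj₂ (proj₂ bound)))
  where
  bound = bounded x
  K = proj₁ bound
  0<K⊔κ : 0ℚ ℚ.< K ℚ.⊔ κ
  0<K⊔κ = <-⊔ K 0<κ
  w = inv (K ℚ.⊔ κ) 0<K⊔κ
  w≤ : ∀ n → ℚ.∣ seq x n ∣ ℚ.≤ K → w ℚ.≤ seq (recip x 0<x) n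
  w≤ n le = Rational.inv-antimono {seq x n ℚ.⊔ κ} {K ℚ.⊔ κ}
    (<-⊔ (seq x n) 0<κ) 0<K⊔κ
    (ℚ.⊔-monoˡ-≤ κ (ℚ.≤-trans (Rational.≤-abs (seq x n)) le))

/-pos : ∀ {x y} → 0ℝ < x → (0<y : 0ℝ < y) → 0ℝ < x / y [ 0<y ]
/-pos {x} {y} 0<x 0<y = *-pos {x} {recip y 0<y} 0<x (recip-pos y 0<y)

<⇒≱ : ∀ {x y} → x < y → ¬ (y ≤ x)
<⇒≱ {x} {y} (mk< ε 0<ε x<y) y≤x = absurd (proj₁ e) (proj₂ e (proj₁ e) ℕ.≤-refl)
  where
  open ℚ.≤-Reasoning
  h = ½ ℚ.* ε
  0<h : 0ℚ ℚ.< h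
  0<h = Rational.*-pos 0<½ 0<ε
  e = both x<y (≤-within y≤x h 0<h)
  absurd : ∀ n → ¬ (seq x n ℚ.+ ε ℚ.≤ seq y n × seq y n ℚ.≤ seq x n ℚ.+ h)
  absurd n (p , q) = ℚ.<-irrefl {seq x n ℚ.+ h} refl (begin-strict
    seq x n ℚ.+ h               ≡⟨ sym (ℚ.+-identityʳ (seq x n ℚ.+ h)) ⟩
    seq x n ℚ.+ h ℚ.+ 0ℚ        <⟨ ℚ.+-monoʳ-< (seq x n ℚ.+ h) 0<h ⟩
    seq x n ℚ.+ h ℚ.+ h         ≡⟨ ℚ.+-assoc (seq x n) h h ⟩
    seq x n ℚ.+ (h ℚ.+ h)       ≡⟨ cong (λ z → seq x n ℚ.+ z) (Rational.halves ε) ⟩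
    seq x n ℚ.+ ε               ≤⟨ p ⟩
    seq y n                     ≤⟨ q ⟩
    seq x n ℚ.+ h               ∎)

+-null : ∀ {x y} → x ≈ 0ℝ → y ≈ 0ℝ → x + y ≈ 0ℝ
+-null {x} {y} x≈0 y≈0 = mk≈ λ ε 0<ε → weaken
  (λ n (p , q) → subst (ℚ.∣ seq x n ℚ.+ seq y n ℚ.- 0ℚ ∣ ℚ.≤_) (Rational.halves ε)
    (Rational.+-close {seq x n} {0ℚ} {seq y n} {0ℚ} p q))
  (both (≈-within x≈0 (½ ℚ.* ε) (Rational.*-pos 0<½ 0<ε))
        (≈-within y≈0 (½ ℚ.* ε) (Rational.*-pos 0<½ 0<ε)))

neg-null : ∀ {x} → x ≈ 0ℝ → - x ≈ 0ℝ
neg-null {x} x≈0 = mk≈ λ ε 0<ε →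
  weaken (λ n → Rational.neg-close {seq x n} {0ℚ}) (≈-within x≈0 ε 0<ε)

*-nullʳ : ∀ x {y} → y ≈ 0ℝ → x * y ≈ 0ℝ
*-nullʳ x {y} y≈0 = mk≈ λ ε 0<ε → weaken (λ n (p , q) → term ε 0<ε n p q)
    (both (proj₂ (proj₂ (bounded x))) (≈-within y≈0 (w ℚ.* ε) (0<η ε 0<ε)))
  where
  K = proj₁ (bounded x)
  0<K = proj₁ (proj₂ (bounded x))
  w = inv K 0<K
  0<η : ∀ ε → 0ℚ ℚ.< ε → 0ℚ ℚ.< w ℚ.* ε
  0<η ε 0<ε = Rational.*-pos (Rational.inv-pos K 0<K) 0<ε
  term : ∀ ε → 0ℚ ℚ.< ε → ∀ n → ℚ.∣ seq x n ∣ ℚ.≤ K → ℚ.∣ seq y n ℚ.- 0ℚ ∣ ℚ.≤ w ℚ.* ε →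
         ℚ.∣ seq x n ℚ.* seq y n ℚ.- 0ℚ ∣ ℚ.≤ ε
  term ε 0<ε n x≤K y≤η = begin
    ℚ.∣ seq x n ℚ.* seq y n ℚ.- 0ℚ ∣     ≡⟨ cong ℚ.∣_∣ (ℚ.+-identityʳ (seq x n ℚ.* seq y n)) ⟩
    ℚ.∣ seq x n ℚ.* seq y n ∣            ≡⟨ ℚ.∣p*q∣≡∣p∣*∣q∣ (seq x n) (seq y n) ⟩
    ℚ.∣ seq x n ∣ ℚ.* ℚ.∣ seq y n ∣
      ≤⟨ Rational.*-mono-≤ (ℚ.0≤∣p∣ (seq x n)) (ℚ.<⇒≤ (0<η ε 0<ε)) x≤K
           (subst (λ z → ℚ.∣ z ∣ ℚ.≤ w ℚ.* ε) (ℚ.+-identityʳ (seq y n)) y≤η) ⟩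
    K ℚ.* (w ℚ.* ε)                      ≡⟨ sym (ℚ.*-assoc K w ε) ⟩
    K ℚ.* w ℚ.* ε                        ≡⟨ cong (ℚ._* ε) (Rational.*-inv K 0<K) ⟩
    1ℚ ℚ.* ε                             ≡⟨ ℚ.*-identityˡ ε ⟩
    ε                                    ∎
    where open ℚ.≤-Reasoning

*-nullˡ : ∀ {x} y → x ≈ 0ℝ → x * y ≈ 0ℝ
*-nullˡ {x} y x≈0 = mk≈ λ ε 0<ε → weaken
  (λ n → subst (λ z → ℚ.∣ z ℚ.- 0ℚ ∣ ℚ.≤ ε) (ℚ.*-comm (seq y n) (seq x n)))
  (≈-within (*-nullʳ y x≈0) ε 0<ε)

≈-refl : ∀ {x} → x ≈ x
≈-refl {x} = mk≈ λ ε 0<ε → 0 , λ n _ →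
  subst (ℚ._≤ ε) (cong ℚ.∣_∣ (sym (ℚ.+-inverseʳ (seq x n)))) (ℚ.<⇒≤ 0<ε)

record ℂ : Set where
  constructor _+i_
  field
    re im : ℝ

open ℂ public

infix  4 _≈ᶜ_
infixl 6 _+ᶜ_
infixl 7 _*ᶜ_

record _≈ᶜ_ (z w : ℂ) : Set where
  constructor _,_
  field
    re≈ : re z ≈ re w
    im≈ : im z ≈ im w

open _≈ᶜ_ public

0ᶜ 1ᶜ : ℂ
0ᶜ = 0ℝ +i 0ℝ
1ᶜ = 1ℝ +i 0ℝ

_+ᶜ_ _*ᶜ_ : ℂ → ℂ → ℂ
z +ᶜ w = (re z + re w) +i (im z + im w)
z *ᶜ w = (re z * re w + - (im z * im w)) +i (re z * im w + im z * re w)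

∣_∣ : ℂ → ℝ
∣ z ∣ = √ (re z * re z + im z * im z)

∑ : ∀ {A : Set} → List A → (A → ℂ) → ℂ
∑ xs g = foldr (λ a s → g a +ᶜ s) 0ᶜ xs

∏ : ∀ {k} → (Fin k → ℂ) → ℂ
∏ = Tuple.foldr _*ᶜ_ 1ᶜ

*ᶜ-nullˡ : ∀ {z} w → z ≈ᶜ 0ᶜ → z *ᶜ w ≈ᶜ 0ᶜ
*ᶜ-nullˡ {z} w (p , q) =
  +-null {re z * re w} { - (im z * im w) }
    (*-nullˡ {re z} (re w) p) (neg-null {im z * im w} (*-nullˡ {im z} (im w) q)) ,
  +-null {re z * im w} {im z * re w} (*-nullˡ {re z} (im w) p) (*-nullˡ {im z} (re w) q)

*ᶜ-nullʳ : ∀ z {w} → w ≈ᶜ 0ᶜ → z *ᶜ w ≈ᶜ 0ᶜ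
*ᶜ-nullʳ z {w} (p , q) =
  +-null {re z * re w} { - (im z * im w) }
    (*-nullʳ (re z) {re w} p) (neg-null {im z * im w} (*-nullʳ (im z) {im w} q)) ,
  +-null {re z * im w} {im z * re w} (*-nullʳ (re z) {im w} q) (*-nullʳ (im z) {re w} p)

∑-null : ∀ {A : Set} (xs : List A) (g : A → ℂ) →
         (∀ {a} → a ∈ xs → g a ≈ᶜ 0ᶜ) → ∑ xs g ≈ᶜ 0ᶜ
∑-null []       g null = ≈-refl , ≈-refl
∑-null (x ∷ xs) g null =
  +-null {re (g x)} {re (∑ xs g)} (re≈ (null (here refl))) (re≈ rest) ,
  +-null {im (g x)} {im (∑ xs g)} (im≈ (null (here refl))) (im≈ rest)
  where rest = ∑-null xs g (λ a∈ → null (there a∈))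

∏-null : ∀ {k} (v : Fin k → ℂ) i → v i ≈ᶜ 0ᶜ → ∏ v ≈ᶜ 0ᶜ
∏-null v Fin.zero    null = *ᶜ-nullˡ {v Fin.zero} (∏ (Tuple.tail v)) null
∏-null v (Fin.suc i) null = *ᶜ-nullʳ (v Fin.zero) {∏ (Tuple.tail v)} (∏-null (Tuple.tail v) i null)

OneBounded : ∀ {A : Set} → (A → ℂ) → Set
OneBounded g = ∀ a → ∣ g a ∣ ≤ 1ℝ

SupportedOn : ∀ {A : Set} → (A → Set) → (A → ℂ) → Set
SupportedOn P g = ∀ a → ¬ P a → g a ≈ᶜ 0ᶜ

record FinitelySupported {A : Set} (g : A → ℂ) : Set where
  field
    points    : List A
    supported : SupportedOn (_∈ points) g

open FinitelySupported public

-- The sum of g over the whole of A; up to _≈ᶜ_ it does not depend on the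
-- list of points witnessing finite support.
∑′ : ∀ {A : Set} → DecidableEquality A → (g : A → ℂ) → FinitelySupported g → ℂ
∑′ _≟_ g fs = ∑ (deduplicate _≟_ (points fs)) g

[1…_] : ℕ → List ℤ
[1… n ] = map (λ j → + suc j) (upTo n)

-- Floors of real numbers are not computable, so n = ⌊x⌋ (for x ≥ 0) is a relation.
IsFloor : ℝ → ℕ → Set
IsFloor x n = fromℕ n ≤ x × x < fromℕ (suc n)

floor-pos : ∀ {x n} → 1ℝ ≤ x → IsFloor x n → 0ℝ < fromℕ n
floor-pos {x} {zero}  1≤x (_ , x<1) = contradiction 1≤x (<⇒≱ x<1)
floor-pos {x} {suc n} _   _         = fromℕ-pos (suc n)

SupportedOn[1…_] : ℕ → (ℤ → ℂ) → Set
SupportedOn[1… n ] f = SupportedOn (_∈ [1… n ]) f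

interval-support : ∀ {n f} → SupportedOn[1… n ] f → FinitelySupported f
interval-support {n} s = record { points = [1… n ] ; supported = s }

Cube : ∀ {k} → ℝ → Vec ℤ k → Set
Cube T = VecAll.All λ b → - T ≤ fromℤ b × fromℤ b ≤ T

tuples : ∀ {A : Set} → List A → (k : ℕ) → List (Vec A k)
tuples xs zero    = [] ∷ []
tuples xs (suc k) = cartesianProductWith _∷_ xs (tuples xs k)

∈-tuples : ∀ {A : Set} {xs : List A} {k} {v : Vec A k} → VecAll.All (_∈ xs) v → v ∈ tuples xs k
∈-tuples []       = here refl
∈-tuples (p ∷ ps) = ∈-cartesianProductWith⁺ _∷_ p (∈-tuples ps)

integersUpTo : ℕ → List ℤ
integersUpTo t = concatMap (λ j → + j ∷ ℤ.- (+ j) ∷ []) (upTo (suc t))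

∈-integersUpTo : ∀ {t} b → ℤ.∣ b ∣ ℕ.≤ t → b ∈ integersUpTo t
∈-integersUpTo b le = ∈-concatMap⁺ (λ j → + j ∷ ℤ.- (+ j) ∷ [])
  (Any.map (λ { refl → sign b }) (∈-upTo⁺ (ℕ.s≤s le)))
  where
  sign : ∀ b → b ∈ + ℤ.∣ b ∣ ∷ ℤ.- (+ ℤ.∣ b ∣) ∷ []
  sign (+ n)    = here refl
  sign -[1+ n ] = there (here refl)

-- An integer t with [-T, T] ∩ ℤ ⊆ {-t, …, t}
radius : ℝ → ℕ
radius T = ceil (proj₁ (bounded T) ℚ.+ 1ℚ)

below-radius : ∀ {T} b → fromℤ b ≤ T → b ℤ.≤ + radius T
below-radius {T} b b≤T = Rational.fromℤ-cancel {b} {+ radius T} (begin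
    Rational.fromℤ b       ≤⟨ proj₂ at-n ⟩
    seq T n ℚ.+ 1ℚ         ≤⟨ ℚ.+-monoˡ-≤ 1ℚ (ℚ.≤-trans (Rational.≤-abs (seq T n)) (proj₁ at-n)) ⟩
    K ℚ.+ 1ℚ               ≤⟨ ≤-ceil (K ℚ.+ 1ℚ) ⟩
    Rational.fromℕ (radius T) ∎)
  where
  open ℚ.≤-Reasoning
  K = proj₁ (bounded T)
  e = both (proj₂ (proj₂ (bounded T))) (≤-within b≤T 1ℚ 0<1)
  n = proj₁ e
  at-n = proj₂ e n ℕ.≤-refl

neg-swap : ∀ {T} b → - T ≤ fromℤ b → fromℤ (ℤ.- b) ≤ T
neg-swap {T} b p = mk≤ λ ε 0<ε → weaken
  (λ n q → subst₂ ℚ._≤_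
    (trans (solve 2 (λ t c → :- t :+ (t :- c) := :- c) refl (seq T n) (Rational.fromℤ b))
      (sym (Rational.fromℤ-neg b)))
    (solve 3 (λ t c e → c :+ e :+ (t :- c) := t :+ e) refl (seq T n) (Rational.fromℤ b) ε)
    (ℚ.+-monoˡ-≤ (seq T n ℚ.- Rational.fromℤ b) q))
  (≤-within p ε 0<ε)
  where open +-*-Solver

abs-below : ∀ {t} b → b ℤ.≤ + t → ℤ.- b ℤ.≤ + t → ℤ.∣ b ∣ ℕ.≤ t
abs-below (+ n)    p _ = ℤ.drop‿+≤+ p
abs-below -[1+ n ] _ q = ℤ.drop‿+≤+ q

cube-support : ∀ {k} T {g : Vec ℤ k → ℂ} → SupportedOn (Cube T) g → FinitelySupported g
cube-support {k} T s = record
  { points    = tuples (integersUpTo (radius T)) k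
  ; supported = λ b b∉ → s b λ inCube → b∉ (∈-tuples (VecAll.map
      (λ {c} (l , u) → ∈-integersUpTo c
        (abs-below c (below-radius c u) (below-radius (ℤ.- c) (neg-swap c l))))
      inCube))
  }

2≤⇒nonZero : ∀ {k} → 2 ℕ.≤ k → NonZero k
2≤⇒nonZero (ℕ.s≤s _) = _

someIndex : ∀ {k} .{{_ : NonZero k}} → Fin k
someIndex {suc k} = Fin.zero

module _ {k : ℕ} .{{_ : NonZero k}} (H : ℕ) (f : Fin k → ℤ → ℂ) where

  configurations : Vec ℤ k → ℤ → ℂ
  configurations b x = ∑ [1… H ] λ m → ∏ λ i → f i (x ℤ.+ lookup b i ℤ.* m)

  configurations-support : (∀ i → FinitelySupported (f i)) →
                           ∀ b → FinitelySupported (configurations b)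
  configurations-support fs b = record
    { points    = concatMap shifts [1… H ]
    ; supported = λ x x∉ → ∑-null [1… H ] (λ m → ∏ (factors x m)) λ {m} m∈ →
        ∏-null (factors x m) i (supported (fs i) (x ℤ.+ lookup b i ℤ.* m) λ y∈ →
          x∉ (∈-concatMap⁺ shifts (Any.map (λ { refl → shifted x m y∈ }) m∈)))
    }
    where
    i : Fin k
    i = someIndex
    factors : ℤ → ℤ → Fin k → ℂ
    factors x m i = f i (x ℤ.+ lookup b i ℤ.* m)
    shifts : ℤ → List ℤ
    shifts m = map (λ y → y ℤ.- lookup b i ℤ.* m) (points (fs i))
    cancel : ∀ x c → (x ℤ.+ c) ℤ.- c ≡ x
    cancel x c = trans (ℤ.+-assoc x c (ℤ.- c))
      (trans (cong (λ z → x ℤ.+ z) (ℤ.+-inverseʳ c)) (ℤ.+-identityʳ x))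
    shifted : ∀ x m → x ℤ.+ lookup b i ℤ.* m ∈ points (fs i) → x ∈ shifts m
    shifted x m y∈ = subst (_∈ shifts m) (cancel x (lookup b i ℤ.* m))
      (∈-map⁺ (λ y → y ℤ.- lookup b i ℤ.* m) y∈)

R : ∀ {k} .{{_ : NonZero k}} (H : ℕ) (λ′ : Vec ℤ k → ℂ) → FinitelySupported λ′ →
    (f : Fin k → ℤ → ℂ) → (∀ i → FinitelySupported (f i)) → ℂ
R H λ′ λ-fs f fs = ∑′ (≡-dec ℤ._≟_)
  (λ b → λ′ b *ᶜ inner b)
  (record { points    = points λ-fs
          ; supported = λ b b∉ → *ᶜ-nullˡ (inner b) (supported λ-fs b b∉) })
  where
  inner : Vec ℤ _ → ℂ
  inner b = ∑′ ℤ._≟_ (configurations H f b) (configurations-support H f fs b)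

progression : ℤ → ℤ → ℕ → List ℤ
progression a d l = map (λ j → a ℤ.+ + j ℤ.* d) (upTo l)

-- All nonempty arithmetic progressions contained in [n].  The least element
-- and the length of such a progression lie in [n], and so does its common
-- difference, which for a singleton may be taken to be 1.
progressions : ℕ → List (List ℤ)
progressions n = filter (ListAll.all? (_∈? [1… n ]))
  (concatMap (λ a → concatMap (λ d → map (λ j → progression a d (suc j)) (upTo n)) [1… n ]) [1… n ])

-- The base value 0 does not change the maximum of a nonempty list of moduli.
max : List ℝ → ℝ
max = foldr _⊔_ 0ℝ

-- ‖f‖ in U¹⁺[N], with n = ⌊N⌋ = |[N]|
‖_‖U¹⁺[_,_] : (ℤ → ℂ) → (n : ℕ) → 0ℝ < fromℕ n → ℝ
‖ f ‖U¹⁺[ n , 0<n ] = max (map (λ P → ∣ ∑ P f ∣) (progressions n)) / fromℕ n [ 0<n ]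

min : ∀ {k} .{{_ : NonZero k}} → (Fin k → ℝ) → ℝ
min {suc k} v = Tuple.foldr _⊓_ (Tuple.head v) (Tuple.tail v)

-- Bounding all factors but f = f_i trivially and applying Cauchy–Schwarz once, a large count
-- forces Σ_{x,m} |Σ_b w(b) f(x + b m)|² to be large for some bounded w.  Expanding the square,
-- so is W(L, H) = Σ_{d≤L} |Σ_{m≤H} A(d m)|, where A is the autocorrelation of (the real or
-- imaginary part of) f.  A further application of Cauchy–Schwarz exchanges the roles of d and m,
-- so that we may assume that d runs over a much shorter range than m.  Finally
-- W(X, Y)² ≤ n Σ_{a,a'≤X} Σ_y |Σ_{b,b'≤Y} f(y + a' b' - a b)|.  As Y is much larger than X, the
-- inner sum hardly changes when y is translated by small multiples of g = gcd(a, a'), so it is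
-- an average of sums of f over progressions of common difference g, and g is bounded for most
-- pairs (a, a').
--
-- The real numbers enter through their ν-th rational approximations, ν large: operations on ℝ
-- act termwise, so all of the above are statements about ℚ, with a little room to spare.
module Submission where

-- Two constraints meet in the averaging: translation by `i * g` with `i < u * z` changes the inner
-- sum little only if `z * q ≤ Y`, and progressions of length `u * z` beat the bound `M` on
-- progression sums only if `M * q³ ≤ X * z`. Since `t * H` is comparable to `n` but either of `t`
-- and `H` may be the larger, the exchange of variables is needed in one of two cases. The two
-- bounds on `B` make both `t` and `H` exceed a fixed power of 1/δ. The exponent: let `p` be an
-- integer of order 1/δ. Beating the square of the count takes a saving `P` of order p². The
-- exchange squares `W`, so it asks for a saving of order P², and the bound on `W²` squares again,
-- so `q` has order P⁴, that is p⁸. Besides the q³ above, rounding the scales costs up to q⁴. So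
-- progression sums all below a constant times n / q⁷ are impossible, and q⁷ has order p⁵⁶. Over ℚ,
-- signs and case distinctions by size are decidable and indirect arguments are harmless; for Cauchy
-- reals they would not be available.

module Core where

  open import Algebra.Bundles using (CommutativeMonoid)
  open import Data.List.Base using
      (List; []; _∷_; _++_; foldr; map; length; downFrom; cartesianProductWith; cartesianProduct)
  open import Data.List.Properties using (length-downFrom; length-map)
  open import Data.List.Membership.Propositional using (_∈_; _∉_)
  open import Data.List.Membership.Propositional.Properties using
      (∈-∃++; ∈-downFrom⁺; ∈-downFrom⁻; ∈-map⁺; ∈-map⁻; ∈-cartesianProduct⁻)
  open import Data.List.Relation.Binary.Permutation.Propositional as ↭ using (_↭_; ↭-sym)
  open import Data.List.Relation.Binary.Permutation.Propositional.Properties using (∈-resp-↭; shift)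
  open import Data.List.Relation.Unary.All as All using (All)
  open import Data.List.Relation.Unary.Any using (here; there)
  open import Data.List.Relation.Unary.Unique.Propositional using (Unique; []; _∷_)
  open import Data.List.Relation.Unary.Unique.Propositional.Properties using (downFrom⁺; map⁺)
  open import Data.Nat.Base as ℕ using (ℕ; zero; suc)
  import Data.Nat.Properties as ℕ
  open import Data.Integer.Base as ℤ using (ℤ)
  import Data.Integer.Properties as ℤ
  open import Data.Product.Base using (_×_; _,_; proj₁; proj₂; ∃-syntax)
  open import Data.Rational.Base as ℚ using (ℚ; 0ℚ; 1ℚ; _+_; _*_; -_; _-_; _≤_; _<_; ∣_∣)
  import Data.Rational.Properties as ℚ
  open import Data.Rational.Solver using (module +-*-Solver)
  open import Data.Sum.Base using (_⊎_; inj₁; inj₂)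
  open import Relation.Binary.Definitions using (DecidableEquality)
  open import Relation.Binary.PropositionalEquality using
      (_≡_; _≢_; refl; sym; trans; cong; cong₂; subst; subst₂; setoid; module ≡-Reasoning)
  open import Relation.Nullary using (¬_; Dec; yes; no; contradiction; does)
  open import Data.Bool.Base using (if_then_else_)
  import Algebra.Properties.AbelianGroup ℤ.+-0-abelianGroup as ℤ-Group
  import Data.Integer.Tactic.RingSolver as ℤ-Ring
  open import Data.Nat.Divisibility using (_∣_; _∣?_; divides; ∣⇒≤)
  open import Data.Nat.GCD using (gcd; gcd[m,n]∣m; gcd[m,n]∣n; gcd-GCD; module Bézout)
  import Data.Integer.DivMod as ℤ
  open import Data.Nat.DivMod using (_/_; m/n*n≤m; m≡m%n+[m/n]*n; m%n<n; m≥n⇒m/n>0; /-monoˡ-≤; m*n/n≡m; m/n/o≡m/[n*o])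
  import Data.Nat.Tactic.RingSolver as ℕ-Ring
  open import Data.Fin.Base as Fin using (Fin)
  import Data.Vec.Functional as Tuple
  open import Data.Vec.Base using (Vec; []; _∷_; lookup)

  open import Defs using (module Rational; tuples)
  open Rational using (*-mono-≤; *-nonNeg; ≤-abs; abs-≤; abs-sym; 0≤fromℕ) renaming (fromℕ to ι; fromℕ-suc to ι-suc)

  -- Sums over duplicate-free lists that agree on the support

  module Support {c ℓ} (M : CommutativeMonoid c ℓ) {A : Set} (_≟_ : DecidableEquality A) where

    open CommutativeMonoid M hiding (setoid) renaming (refl to ≈-refl; sym to ≈-sym; trans to ≈-trans)
    open import Data.List.Relation.Binary.Permutation.Setoid.Properties (setoid A) using (Unique-resp-↭)
    open import Data.List.Membership.DecPropositional _≟_ using (_∈?_)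

    total : List A → (A → Carrier) → Carrier
    total xs g = foldr (λ a s → g a ∙ s) ε xs

    total-↭ : ∀ {xs ys} (g : A → Carrier) → xs ↭ ys → total xs g ≈ total ys g
    total-↭ g ↭.refl = ≈-refl
    total-↭ g (↭.prep x p) = ∙-congˡ (total-↭ g p)
    total-↭ g (↭.swap x y p) = ≈-trans (≈-sym (assoc _ _ _))
      (≈-trans (∙-cong (comm _ _) (total-↭ g p)) (assoc _ _ _))
    total-↭ g (↭.trans p q) = ≈-trans (total-↭ g p) (total-↭ g q)

    total-null : ∀ xs (g : A → Carrier) → (∀ {x} → x ∈ xs → g x ≈ ε) → total xs g ≈ ε
    total-null [] g null = ≈-refl
    total-null (x ∷ xs) g null = ≈-trans
      (∙-cong (null (here refl)) (total-null xs g (λ x∈ → null (there x∈)))) (identityˡ ε)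

    -- A common point is brought to the front of `ys` by a permutation and removed from both lists;
    -- a point of `xs` alone contributes `ε`. The monoid is abstract because both ℚ with equality
    -- and ℂ with `_≈ᶜ_` are needed.
    total-support : ∀ {xs ys} (g : A → Carrier) → Unique xs → Unique ys →
      (∀ {x} → x ∈ xs → x ∉ ys → g x ≈ ε) → (∀ {y} → y ∈ ys → y ∉ xs → g y ≈ ε) →
      total xs g ≈ total ys g
    total-support {[]} {ys} g _ _ _ null = ≈-sym (total-null ys g (λ y∈ → null y∈ λ ()))
    total-support {x ∷ xs} {ys} g (x∉xs ∷ u) v nullˣ nullʸ with x ∈? ys
    ... | no x∉ = ≈-trans (∙-cong (nullˣ (here refl) x∉)
        (total-support g u v (λ x∈ → nullˣ (there x∈)) null))
        (identityˡ _)
      where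
      null : ∀ {y} → y ∈ ys → y ∉ xs → g y ≈ ε
      null y∈ y∉ = nullʸ y∈ λ { (here refl) → x∉ y∈ ; (there y∈xs) → y∉ y∈xs }
    ... | yes x∈ with us , vs , refl ← ∈-∃++ x∈ = ≈-trans
        (∙-congˡ (total-support g u (tail v′) nullˣ′ nullʸ′)) (total-↭ g (↭-sym perm))
      where
      perm : us ++ x ∷ vs ↭ x ∷ us ++ vs
      perm = shift x us vs
      v′ = Unique-resp-↭ (↭.↭⇒↭ₛ perm) v
      tail : ∀ {z zs} → Unique {A = A} (z ∷ zs) → Unique zs
      tail (_ ∷ w) = w
      fresh : ∀ {z} {zs : List A} → Unique (z ∷ zs) → ∀ {w} → w ∈ zs → z ≢ w
      fresh (p ∷ _) w∈ = All.lookup p w∈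
      nullˣ′ : ∀ {z} → z ∈ xs → z ∉ us ++ vs → g z ≈ ε
      nullˣ′ z∈ z∉ = nullˣ (there z∈) λ z∈ys → case (∈-resp-↭ perm z∈ys)
        where
        case : _ ∈ x ∷ us ++ vs → _
        case (here refl) = contradiction refl (All.lookup x∉xs z∈)
        case (there z∈′) = z∉ z∈′
      nullʸ′ : ∀ {y} → y ∈ us ++ vs → y ∉ xs → g y ≈ ε
      nullʸ′ y∈ y∉ = nullʸ (∈-resp-↭ (↭-sym perm) (there y∈))
        λ { (here refl) → fresh v′ y∈ refl ; (there y∈xs) → y∉ y∈xs }

  -- Sums over lists and over initial segments of ℕ

  ∑ : ∀ {A : Set} → List A → (A → ℚ) → ℚ
  ∑ [] g = 0ℚ
  ∑ (x ∷ xs) g = g x + ∑ xs g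

  infix 9 _²
  _² : ℚ → ℚ
  a ² = a * a

  0≤² : ∀ a → 0ℚ ≤ a ²
  0≤² a with ℚ.≤-total 0ℚ a
  ... | inj₁ p = *-nonNeg p p
  ... | inj₂ p = subst (0ℚ ≤_) (solve 1 (λ a → :- a :* :- a := a :* a) refl a) (*-nonNeg q q)
    where
    open +-*-Solver
    q = ℚ.neg-antimono-≤ p

  +-nonNeg : ∀ {a b} → 0ℚ ≤ a → 0ℚ ≤ b → 0ℚ ≤ a + b
  +-nonNeg p q = ℚ.+-mono-≤ p q

  *-monoʳ-≤ : ∀ {a b c} → 0ℚ ≤ a → b ≤ c → a * b ≤ a * c
  *-monoʳ-≤ {a} 0≤a = ℚ.*-monoˡ-≤-nonNeg a {{ℚ.nonNegative 0≤a}}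

  *-monoˡ-≤ : ∀ {a b c} → 0ℚ ≤ a → b ≤ c → b * a ≤ c * a
  *-monoˡ-≤ {a} 0≤a = ℚ.*-monoʳ-≤-nonNeg a {{ℚ.nonNegative 0≤a}}

  by-difference : ∀ {a b} d → 0ℚ ≤ d → a + d ≡ b → a ≤ b
  by-difference {a} d 0≤d refl = subst (_≤ a + d) (ℚ.+-identityʳ a) (ℚ.+-monoʳ-≤ a 0≤d)

  ²-cancel-≤ : ∀ {a b} → 0ℚ ≤ b → a ² ≤ b ² → a ≤ b
  ²-cancel-≤ {a} {b} 0≤b p = ℚ.≮⇒≥ λ b<a → ℚ.<-irrefl refl (ℚ.<-≤-trans (strict b<a) p)
    where
    strict : b < a → b ² < a ²
    strict b<a = ℚ.≤-<-trans (*-monoʳ-≤ 0≤b (ℚ.<⇒≤ b<a))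
      (ℚ.*-monoˡ-<-pos a {{ℚ.positive (ℚ.≤-<-trans 0≤b b<a)}} b<a)

  ∣²∣ : ∀ a → ∣ a ∣ ² ≡ a ²
  ∣²∣ a = trans (sym (ℚ.∣p*q∣≡∣p∣*∣q∣ a a)) (ℚ.0≤p⇒∣p∣≡p (0≤² a))

  ι-+ : ∀ m n → ι (m ℕ.+ n) ≡ ι m + ι n
  ι-+ zero n = sym (ℚ.+-identityˡ (ι n))
  ι-+ (suc m) n = begin
    ι (suc (m ℕ.+ n))     ≡⟨ ι-suc (m ℕ.+ n) ⟩
    ι (m ℕ.+ n) + 1ℚ      ≡⟨ cong (_+ 1ℚ) (ι-+ m n) ⟩
    ι m + ι n + 1ℚ        ≡⟨ solve 2 (λ a b → a :+ b :+ con 1ℚ := a :+ con 1ℚ :+ b) refl (ι m) (ι n) ⟩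
    ι m + 1ℚ + ι n        ≡⟨ cong (_+ ι n) (sym (ι-suc m)) ⟩
    ι (suc m) + ι n       ∎
    where
    open ≡-Reasoning
    open +-*-Solver

  ι-* : ∀ m n → ι (m ℕ.* n) ≡ ι m * ι n
  ι-* m n = trans (cong Rational.fromℤ (ℤ.pos-* m n)) (Rational.fromℤ-* (ℤ.+ m) (ℤ.+ n))

  ι-mono : ∀ {m n} → m ℕ.≤ n → ι m ≤ ι n
  ι-mono m≤n = Rational.fromℤ-mono (ℤ.+≤+ m≤n)

  ι-cancel : ∀ {m n} → ι m ≤ ι n → m ℕ.≤ n
  ι-cancel p = ℤ.drop‿+≤+ (Rational.fromℤ-cancel p)

  module _ {A : Set} where

    ∑-cong∈ : ∀ (xs : List A) {g h : A → ℚ} → (∀ {x} → x ∈ xs → g x ≡ h x) → ∑ xs g ≡ ∑ xs h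
    ∑-cong∈ [] eq = refl
    ∑-cong∈ (x ∷ xs) eq = cong₂ _+_ (eq (here refl)) (∑-cong∈ xs (λ x∈ → eq (there x∈)))

    ∑-cong : ∀ (xs : List A) {g h : A → ℚ} → (∀ x → g x ≡ h x) → ∑ xs g ≡ ∑ xs h
    ∑-cong xs eq = ∑-cong∈ xs (λ {x} _ → eq x)

    ∑-mono∈ : ∀ (xs : List A) {g h : A → ℚ} → (∀ {x} → x ∈ xs → g x ≤ h x) → ∑ xs g ≤ ∑ xs h
    ∑-mono∈ [] le = ℚ.≤-refl
    ∑-mono∈ (x ∷ xs) le = ℚ.+-mono-≤ (le (here refl)) (∑-mono∈ xs (λ x∈ → le (there x∈)))

    ∑-mono : ∀ (xs : List A) {g h : A → ℚ} → (∀ x → g x ≤ h x) → ∑ xs g ≤ ∑ xs h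
    ∑-mono xs le = ∑-mono∈ xs (λ {x} _ → le x)

    ∑-zero : ∀ (xs : List A) → ∑ xs (λ _ → 0ℚ) ≡ 0ℚ
    ∑-zero [] = refl
    ∑-zero (x ∷ xs) = trans (ℚ.+-identityˡ _) (∑-zero xs)

    ∑-nonNeg : ∀ (xs : List A) {g : A → ℚ} → (∀ x → 0ℚ ≤ g x) → 0ℚ ≤ ∑ xs g
    ∑-nonNeg xs {g} 0≤g = subst (_≤ ∑ xs g) (∑-zero xs) (∑-mono xs 0≤g)

    ∑-+ : ∀ (xs : List A) (g h : A → ℚ) → ∑ xs (λ x → g x + h x) ≡ ∑ xs g + ∑ xs h
    ∑-+ [] g h = refl
    ∑-+ (x ∷ xs) g h = trans (cong ((g x + h x) +_) (∑-+ xs g h))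
      (solve 4 (λ a b c d → a :+ b :+ (c :+ d) := a :+ c :+ (b :+ d)) refl (g x) (h x) (∑ xs g) (∑ xs h))
      where open +-*-Solver

    ∑-*ˡ : ∀ c (xs : List A) (g : A → ℚ) → ∑ xs (λ x → c * g x) ≡ c * ∑ xs g
    ∑-*ˡ c [] g = sym (ℚ.*-zeroʳ c)
    ∑-*ˡ c (x ∷ xs) g = trans (cong ((c * g x) +_) (∑-*ˡ c xs g)) (sym (ℚ.*-distribˡ-+ c (g x) (∑ xs g)))

    ∑-*ʳ : ∀ c (xs : List A) (g : A → ℚ) → ∑ xs (λ x → g x * c) ≡ ∑ xs g * c
    ∑-*ʳ c xs g = trans (∑-cong xs (λ x → ℚ.*-comm (g x) c)) (trans (∑-*ˡ c xs g) (ℚ.*-comm c (∑ xs g)))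

    ∑-neg : ∀ (xs : List A) (g : A → ℚ) → ∑ xs (λ x → - g x) ≡ - ∑ xs g
    ∑-neg [] g = refl
    ∑-neg (x ∷ xs) g = trans (cong ((- g x) +_) (∑-neg xs g)) (sym (ℚ.neg-distrib-+ (g x) (∑ xs g)))

    ∑-sub : ∀ (xs : List A) (g h : A → ℚ) → ∑ xs (λ x → g x - h x) ≡ ∑ xs g - ∑ xs h
    ∑-sub xs g h = trans (∑-+ xs g (λ x → - h x)) (cong ((∑ xs g) +_) (∑-neg xs h))

    ∑-const : ∀ (xs : List A) c → ∑ xs (λ _ → c) ≡ ι (length xs) * c
    ∑-const [] c = sym (ℚ.*-zeroˡ c)
    ∑-const (x ∷ xs) c = begin
      c + ∑ xs (λ _ → c)        ≡⟨ cong (c +_) (∑-const xs c) ⟩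
      c + ι (length xs) * c     ≡⟨ solve 2 (λ c l → c :+ l :* c := (l :+ con 1ℚ) :* c) refl c (ι (length xs)) ⟩
      (ι (length xs) + 1ℚ) * c  ≡⟨ cong (_* c) (sym (ι-suc (length xs))) ⟩
      ι (suc (length xs)) * c   ∎
      where
      open ≡-Reasoning
      open +-*-Solver

    ∑-bound : ∀ (xs : List A) {g : A → ℚ} c → (∀ {x} → x ∈ xs → g x ≤ c) → ∑ xs g ≤ ι (length xs) * c
    ∑-bound xs {g} c le = subst (∑ xs g ≤_) (∑-const xs c) (∑-mono∈ xs le)

    ∑-++ : ∀ (xs ys : List A) (g : A → ℚ) → ∑ (xs ++ ys) g ≡ ∑ xs g + ∑ ys g
    ∑-++ [] ys g = sym (ℚ.+-identityˡ _)
    ∑-++ (x ∷ xs) ys g = trans (cong (g x +_) (∑-++ xs ys g)) (sym (ℚ.+-assoc (g x) _ _))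

    ∣∑∣ : ∀ (xs : List A) (g : A → ℚ) → ∣ ∑ xs g ∣ ≤ ∑ xs (λ x → ∣ g x ∣)
    ∣∑∣ [] g = ℚ.≤-refl
    ∣∑∣ (x ∷ xs) g = ℚ.≤-trans (ℚ.∣p+q∣≤∣p∣+∣q∣ (g x) (∑ xs g)) (ℚ.+-monoʳ-≤ ∣ g x ∣ (∣∑∣ xs g))

    ∑-deviation : ∀ (xs : List A) (g : A → ℚ) a →
      ∑ xs (λ x → (a - g x) ²) ≡ ι (length xs) * a ² + - (a * ∑ xs g + a * ∑ xs g) + ∑ xs (λ x → g x ²)
    ∑-deviation [] g a = solve 1 (λ a → con 0ℚ := con 0ℚ :* (a :* a) :+ :- (a :* con 0ℚ :+ a :* con 0ℚ) :+ con 0ℚ) refl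
        a
      where open +-*-Solver
    ∑-deviation (x ∷ xs) g a = trans (cong (((a - g x) ²) +_) (∑-deviation xs g a)) (trans
      (solve 5 (λ a y l s t → (a :- y) :* (a :- y) :+ (l :* (a :* a) :+ :- (a :* s :+ a :* s) :+ t)
        := (l :+ con 1ℚ) :* (a :* a) :+ :- (a :* (y :+ s) :+ a :* (y :+ s)) :+ (y :* y :+ t)) refl
        a (g x) (ι (length xs)) (∑ xs g) (∑ xs (λ x → g x ²)))
      (cong (λ l → l * a ² + - (a * ∑ (x ∷ xs) g + a * ∑ (x ∷ xs) g) + ∑ (x ∷ xs) (λ x → g x ²))
        (sym (ι-suc (length xs)))))
      where open +-*-Solver

    -- Induction on the list: adding a head `a` increases the slack `l * t - s²` by exactly the sum
    -- of the squares `(a - g x)²`, which `∑-deviation` expands.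
    cauchy-schwarz : ∀ (xs : List A) (g : A → ℚ) → (∑ xs g) ² ≤ ι (length xs) * ∑ xs (λ x → g x ²)
    cauchy-schwarz [] g = ℚ.≤-refl
    cauchy-schwarz (x ∷ xs) g = begin
      (a + s) ²             ≤⟨ by-difference ((l * t + - s ²) + d) (+-nonNeg slack 0≤d) eq ⟩
      (l + 1ℚ) * (a ² + t)  ≡⟨ cong (_* (a ² + t)) (sym (ι-suc (length xs))) ⟩
      ι (suc (length xs)) * (a ² + t) ∎
      where
      open ℚ.≤-Reasoning
      open +-*-Solver
      a = g x
      s = ∑ xs g
      t = ∑ xs (λ x → g x ²)
      l = ι (length xs)
      d = ∑ xs (λ x → (a - g x) ²)
      0≤d : 0ℚ ≤ d
      0≤d = ∑-nonNeg xs (λ x → 0≤² (a - g x))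
      slack : 0ℚ ≤ l * t + - s ²
      slack = subst (_≤ l * t + - s ²) (ℚ.+-inverseʳ (s ²)) (ℚ.+-monoˡ-≤ (- s ²) (cauchy-schwarz xs g))
      eq : (a + s) ² + ((l * t + - s ²) + d) ≡ (l + 1ℚ) * (a ² + t)
      eq = trans (cong (λ d → (a + s) ² + ((l * t + - s ²) + d)) (∑-deviation xs g a))
        (solve 4 (λ a s l t → (a :+ s) :* (a :+ s) :+
            ((l :* t :+ :- (s :* s)) :+ (l :* (a :* a) :+ :- (a :* s :+ a :* s) :+ t))
          := (l :+ con 1ℚ) :* (a :* a :+ t)) refl a s l t)

  ∑-swap : ∀ {A C : Set} (xs : List A) (ys : List C) (g : A → C → ℚ) →
    ∑ xs (λ x → ∑ ys (g x)) ≡ ∑ ys (λ y → ∑ xs (λ x → g x y))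
  ∑-swap [] ys g = sym (∑-zero ys)
  ∑-swap (x ∷ xs) ys g = trans (cong (∑ ys (g x) +_) (∑-swap xs ys g)) (sym (∑-+ ys (g x) _))

  ∑-map : ∀ {A C : Set} (f : A → C) (xs : List A) (g : C → ℚ) → ∑ (map f xs) g ≡ ∑ xs (λ x → g (f x))
  ∑-map f [] g = refl
  ∑-map f (x ∷ xs) g = cong (g (f x) +_) (∑-map f xs g)

  ∑-square : ∀ {A : Set} (xs : List A) (g : A → ℚ) → (∑ xs g) ² ≡ ∑ xs (λ x → ∑ xs (λ y → g x * g y))
  ∑-square xs g = trans (sym (∑-*ʳ (∑ xs g) xs g)) (∑-cong xs (λ x → sym (∑-*ˡ (g x) xs g)))

  ∑-product : ∀ {A C D : Set} (f : A → C → D) (xs : List A) (ys : List C) (g : D → ℚ) →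
    ∑ (cartesianProductWith f xs ys) g ≡ ∑ xs (λ x → ∑ ys (λ y → g (f x y)))
  ∑-product f [] ys g = refl
  ∑-product f (x ∷ xs) ys g = trans (∑-++ (map (f x) ys) _ g)
    (cong₂ _+_ (∑-map (f x) ys g) (∑-product f xs ys g))

  ∑-foldr : ∀ {A : Set} (xs : List A) (g : A → ℚ) → ∑ xs g ≡ foldr (λ a s → g a + s) 0ℚ xs
  ∑-foldr [] g = refl
  ∑-foldr (x ∷ xs) g = cong (g x +_) (∑-foldr xs g)

  ∑-support : ∀ {A : Set} (_≟_ : DecidableEquality A) {xs ys : List A} (g : A → ℚ) → Unique xs → Unique ys →
      (∀ {x} → x ∈ xs → x ∉ ys → g x ≡ 0ℚ) → (∀ {y} → y ∈ ys → y ∉ xs → g y ≡ 0ℚ) → ∑ xs g ≡ ∑ ys g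
  ∑-support _≟_ {xs} {ys} g u v nullˣ nullʸ = trans (∑-foldr xs g)
    (trans (Support.total-support ℚ.+-0-commutativeMonoid _≟_ g u v nullˣ nullʸ) (sym (∑-foldr ys g)))

  -- The descending order makes `∑< (suc n) g` reduce to `g n + ∑< n g`.
  ∑< : ℕ → (ℕ → ℚ) → ℚ
  ∑< n = ∑ (downFrom n)

  ∑<-first : ∀ n (g : ℕ → ℚ) → ∑< (suc n) g ≡ g 0 + ∑< n (λ i → g (suc i))
  ∑<-first zero g = refl
  ∑<-first (suc n) g = trans (cong (g (suc n) +_) (∑<-first n g))
    (solve 3 (λ a b c → a :+ (b :+ c) := b :+ (a :+ c)) refl (g (suc n)) (g 0) _)
    where open +-*-Solver

  ∑<-split : ∀ m n (g : ℕ → ℚ) → ∑< (m ℕ.+ n) g ≡ ∑< m g + ∑< n (λ i → g (m ℕ.+ i))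
  ∑<-split m zero g = trans (cong (λ z → ∑< z g) (ℕ.+-identityʳ m)) (sym (ℚ.+-identityʳ _))
  ∑<-split m (suc n) g = trans (cong (λ z → ∑< z g) (ℕ.+-suc m n)) (trans
    (cong (g (m ℕ.+ n) +_) (∑<-split m n g))
    (solve 3 (λ a b c → a :+ (b :+ c) := b :+ (a :+ c)) refl (g (m ℕ.+ n)) (∑< m g) _))
    where open +-*-Solver

  ∑<-blocks : ∀ J L (g : ℕ → ℚ) → ∑< (J ℕ.* L) g ≡ ∑< J (λ j → ∑< L (λ i → g (j ℕ.* L ℕ.+ i)))
  ∑<-blocks zero L g = refl
  ∑<-blocks (suc J) L g = trans (cong (λ z → ∑< z g) (ℕ.+-comm L (J ℕ.* L)))
    (trans (∑<-split (J ℕ.* L) L g) (trans (ℚ.+-comm (∑< (J ℕ.* L) g) _)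
      (cong (∑< L (λ i → g (J ℕ.* L ℕ.+ i)) +_) (∑<-blocks J L g))))

  ∑<-bound : ∀ n {g : ℕ → ℚ} c → (∀ {i} → i ℕ.< n → g i ≤ c) → ∑< n g ≤ ι n * c
  ∑<-bound n {g} c le = subst (λ l → ∑< n g ≤ ι l * c) (length-downFrom n)
    (∑-bound (downFrom n) c (λ i∈ → le (∈-downFrom⁻ i∈)))

  ∑<-cauchy-schwarz : ∀ n (g : ℕ → ℚ) → (∑< n g) ² ≤ ι n * ∑< n (λ i → g i ²)
  ∑<-cauchy-schwarz n g = subst (λ l → (∑< n g) ² ≤ ι l * ∑< n (λ i → g i ²)) (length-downFrom n)
    (cauchy-schwarz (downFrom n) g)

  ∑<-cong : ∀ n {g h : ℕ → ℚ} → (∀ {i} → i ℕ.< n → g i ≡ h i) → ∑< n g ≡ ∑< n h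
  ∑<-cong n eq = ∑-cong∈ (downFrom n) (λ i∈ → eq (∈-downFrom⁻ i∈))

  ∑<-mono : ∀ n {g h : ℕ → ℚ} → (∀ {i} → i ℕ.< n → g i ≤ h i) → ∑< n g ≤ ∑< n h
  ∑<-mono n le = ∑-mono∈ (downFrom n) (λ i∈ → le (∈-downFrom⁻ i∈))

  ∑-term : ∀ {A : Set} {xs : List A} {x} (g : A → ℚ) → (∀ x → 0ℚ ≤ g x) → x ∈ xs → g x ≤ ∑ xs g
  ∑-term {xs = _ ∷ xs} g 0≤g (here refl) = by-difference _ (∑-nonNeg xs 0≤g) refl
  ∑-term {xs = y ∷ xs} g 0≤g (there x∈) = ℚ.≤-trans (∑-term g 0≤g x∈)
    (by-difference (g y) (0≤g y) (ℚ.+-comm _ (g y)))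

  ind : ∀ {P : Set} → Dec P → ℚ
  ind d = if does d then 1ℚ else 0ℚ

  ind-yes : ∀ {P : Set} (d : Dec P) → P → ind d ≡ 1ℚ
  ind-yes (yes _) _ = refl
  ind-yes (no ¬p) p = contradiction p ¬p

  ind-no : ∀ {P : Set} (d : Dec P) → ¬ P → ind d ≡ 0ℚ
  ind-no (yes p) ¬p = contradiction p ¬p
  ind-no (no _) _ = refl

  0≤ind : ∀ {P : Set} (d : Dec P) → 0ℚ ≤ ind d
  0≤ind (yes _) = ℚ.nonNegative⁻¹ 1ℚ
  0≤ind (no _) = ℚ.≤-refl

  ind-≤ : ∀ {P : Set} {c} (d : Dec P) → 0ℚ ≤ c → (P → 1ℚ ≤ c) → ind d ≤ c
  ind-≤ (yes p) _ f = f p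
  ind-≤ (no _) 0≤c _ = 0≤c

  ∣ind∣≤1 : ∀ {P : Set} (d : Dec P) → ∣ ind d ∣ ≤ 1ℚ
  ∣ind∣≤1 (yes _) = ℚ.≤-refl
  ∣ind∣≤1 (no _) = ℚ.nonNegative⁻¹ 1ℚ

  -- Multiplying `g` by the indicator of `xs` makes the two sums have the same support; dropping the
  -- indicator on `ys` only increases the sum.
  ∑-subset : ∀ {A : Set} (_≟_ : DecidableEquality A) {xs ys : List A} (g : A → ℚ) → (∀ x → 0ℚ ≤ g x) →
    Unique xs → Unique ys → (∀ {x} → x ∈ xs → x ∈ ys) → ∑ xs g ≤ ∑ ys g
  ∑-subset _≟_ {xs} {ys} g 0≤g u v sub = begin
    ∑ xs g   ≡⟨ ∑-cong∈ xs (λ {x} x∈ → sym (trans (cong (_* g x) (ind-yes (x ∈? xs) x∈)) (ℚ.*-identityˡ (g x)))) ⟩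
    ∑ xs g′  ≡⟨ ∑-support _≟_ g′ u v (λ x∈ x∉ → contradiction (sub x∈) x∉)
                 (λ {y} _ y∉ → trans (cong (_* g y) (ind-no (y ∈? xs) y∉)) (ℚ.*-zeroˡ (g y))) ⟩
    ∑ ys g′  ≤⟨ ∑-mono ys (λ y → restrict y (y ∈? xs)) ⟩
    ∑ ys g   ∎
    where
    open ℚ.≤-Reasoning
    open import Data.List.Membership.DecPropositional _≟_ using (_∈?_)
    g′ = λ x → ind (x ∈? xs) * g x
    restrict : ∀ {P : Set} y (d : Dec P) → ind d * g y ≤ g y
    restrict y (yes _) = ℚ.≤-reflexive (ℚ.*-identityˡ (g y))
    restrict y (no _) = subst (_≤ g y) (sym (ℚ.*-zeroˡ (g y))) (0≤g y)

  ∑<-prefix : ∀ {m n} (g : ℕ → ℚ) → (∀ i → 0ℚ ≤ g i) → m ℕ.≤ n → ∑< m g ≤ ∑< n g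
  ∑<-prefix {m} g 0≤g m≤n with k , refl ← ℕ.m≤n⇒∃[o]m+o≡n m≤n =
    by-difference _ (∑-nonNeg (downFrom k) (λ i → 0≤g (m ℕ.+ i))) (sym (∑<-split m k g))

  ∑<-extend : ∀ {m n} (g : ℕ → ℚ) → m ℕ.≤ n → ∑< m g ≡ ∑< n (λ i → ind (i ℕ.<? m) * g i)
  ∑<-extend {m} g m≤n with k , refl ← ℕ.m≤n⇒∃[o]m+o≡n m≤n = sym (begin
    ∑< (m ℕ.+ k) h                       ≡⟨ ∑<-split m k h ⟩
    ∑< m h + ∑< k (λ i → h (m ℕ.+ i))    ≡⟨ cong₂ _+_
       (∑<-cong m (λ {i} i<m → trans (cong (_* g i) (ind-yes (i ℕ.<? m) i<m)) (ℚ.*-identityˡ (g i))))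
       (trans (∑-cong (downFrom k) (λ i → trans (cong (_* g (m ℕ.+ i))
          (ind-no (m ℕ.+ i ℕ.<? m) (ℕ.≤⇒≯ (ℕ.m≤m+n m i)))) (ℚ.*-zeroˡ (g (m ℕ.+ i)))))
          (∑-zero (downFrom k))) ⟩
    ∑< m g + 0ℚ                          ≡⟨ ℚ.+-identityʳ _ ⟩
    ∑< m g                               ∎)
    where
    open ≡-Reasoning
    h = λ i → ind (i ℕ.<? m) * g i

  -- Symmetric windows and initial intervals of ℤ

  opaque

    window : ℕ → List ℤ
    window T = map (λ i → ℤ.+ i ℤ.- ℤ.+ T) (downFrom (suc (T ℕ.+ T)))

    length-window : ∀ T → length (window T) ≡ suc (T ℕ.+ T)
    length-window T = trans (length-map _ (downFrom (suc (T ℕ.+ T)))) (length-downFrom (suc (T ℕ.+ T)))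

    window-unique : ∀ T → Unique (window T)
    window-unique T = map⁺ (λ {i} {j} eq → ℤ.+-injective (ℤ-Group.∙-cancelʳ (ℤ.- (ℤ.+ T)) (ℤ.+ i) (ℤ.+ j) eq))
      (downFrom⁺ (suc (T ℕ.+ T)))

    ∈-window : ∀ {T} x → ℤ.∣ x ∣ ℕ.≤ T → x ∈ window T
    ∈-window {T} x le = subst (_∈ window T) eq (∈-map⁺ (λ i → ℤ.+ i ℤ.- ℤ.+ T)
      (∈-downFrom⁺ {suc (T ℕ.+ T)} {ℤ.∣ x ℤ.+ ℤ.+ T ∣}
          (ℕ.s≤s (ℕ.≤-trans (ℤ.∣i+j∣≤∣i∣+∣j∣ x (ℤ.+ T)) (ℕ.+-monoˡ-≤ T le)))))
      where
      -T≤x : ℤ.- (ℤ.+ T) ℤ.≤ x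
      -T≤x = subst (ℤ.- (ℤ.+ T) ℤ.≤_) (ℤ.neg-involutive x) (ℤ.neg-mono-≤ (ℤ.≤-trans
        (below (ℤ.- x)) (ℤ.+≤+ (subst (ℕ._≤ T) (sym (ℤ.∣-i∣≡∣i∣ x)) le))))
        where
        below : ∀ y → y ℤ.≤ ℤ.+ ℤ.∣ y ∣
        below (ℤ.+ n) = ℤ.≤-refl
        below ℤ.-[1+ n ] = ℤ.-≤+
      0≤ : ℤ.0ℤ ℤ.≤ x ℤ.+ ℤ.+ T
      0≤ = subst (ℤ._≤ x ℤ.+ ℤ.+ T) (ℤ.+-inverseˡ (ℤ.+ T)) (ℤ.+-monoˡ-≤ (ℤ.+ T) -T≤x)
      eq : ℤ.+ ℤ.∣ x ℤ.+ ℤ.+ T ∣ ℤ.- ℤ.+ T ≡ x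
      eq = trans (cong (ℤ._- ℤ.+ T) (ℤ.0≤i⇒+∣i∣≡i 0≤))
        (ℤ-Group.//-rightDividesʳ (ℤ.+ T) x)

    ∑-window : ∀ T (g : ℤ → ℚ) → ∑ (window T) g ≡ ∑< (suc (T ℕ.+ T)) (λ i → g (ℤ.+ i ℤ.- ℤ.+ T))
    ∑-window T g = ∑-map _ (downFrom (suc (T ℕ.+ T))) g

    window-size : ∀ {T x} → x ∈ window T → ℤ.∣ x ∣ ℕ.≤ T
    window-size {T} x∈ with i , i∈ , refl ← ∈-map⁻ (λ i → ℤ.+ i ℤ.- ℤ.+ T) x∈ =
      subst (ℕ._≤ T) (cong ℤ.∣_∣ (sym (ℤ.m-n≡m⊖n i T))) (size (ℕ.≤-total i T))
      where
      size : i ℕ.≤ T ⊎ T ℕ.≤ i → ℤ.∣ i ℤ.⊖ T ∣ ℕ.≤ T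
      size (inj₁ i≤T) = subst (ℕ._≤ T) (sym (ℤ.∣⊖∣-≤ i≤T)) (ℕ.m∸n≤m T i)
      size (inj₂ T≤i) = subst (ℕ._≤ T) (sym (trans (ℤ.∣m⊖n∣≡∣n⊖m∣ i T) (ℤ.∣⊖∣-≤ T≤i)))
        (subst (i ℕ.∸ T ℕ.≤_) (ℕ.m+n∸n≡m T T) (ℕ.∸-monoˡ-≤ T (ℕ.≤-pred (∈-downFrom⁻ i∈))))

  interval : ℕ → List ℤ
  interval n = map (λ i → ℤ.+ suc i) (downFrom n)

  length-interval : ∀ n → length (interval n) ≡ n
  length-interval n = trans (length-map _ (downFrom n)) (length-downFrom n)

  interval-unique : ∀ n → Unique (interval n)
  interval-unique n = map⁺ (λ eq → ℕ.suc-injective (ℤ.+-injective eq)) (downFrom⁺ n)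

  ∑-interval : ∀ n (g : ℤ → ℚ) → ∑ (interval n) g ≡ ∑< n (λ i → g (ℤ.+ suc i))
  ∑-interval n g = ∑-map _ (downFrom n) g

  interval⁻ : ∀ {n y} → y ∈ interval n → ∃[ j ] j ℕ.< n × y ≡ ℤ.+ suc j
  interval⁻ y∈ with j , j∈ , refl ← ∈-map⁻ (λ i → ℤ.+ suc i) y∈ = j , ∈-downFrom⁻ j∈ , refl

  interval-size : ∀ {n y} → y ∈ interval n → ℤ.∣ y ∣ ℕ.≤ n
  interval-size y∈ with j , j<n , refl ← interval⁻ y∈ = j<n

  interval⊆window : ∀ {n T} → n ℕ.≤ T → ∀ {y} → y ∈ interval n → y ∈ window T
  interval⊆window n≤T {y} y∈ = ∈-window y (ℕ.≤-trans (interval-size y∈) n≤T)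

  -- The translated window still covers [n] by the condition on `T`, and `g` vanishes off [n].
  window-shift : ∀ {n T} s (g : ℤ → ℚ) → (∀ {y} → y ∉ interval n → g y ≡ 0ℚ) → n ℕ.+ ℤ.∣ s ∣ ℕ.≤ T →
    ∑ (window T) (λ x → g (x ℤ.+ s)) ≡ ∑ (interval n) g
  window-shift {n} {T} s g null le = trans (sym (∑-map (ℤ._+ s) (window T) g))
    (∑-support ℤ._≟_ g (map⁺ (λ {x} {y} → ℤ-Group.∙-cancelʳ s x y) (window-unique T)) (interval-unique n)
      (λ _ → null) (λ {y} y∈ y∉ → contradiction (shifted y y∈) y∉))
    where
    shifted : ∀ y → y ∈ interval n → y ∈ map (ℤ._+ s) (window T)
    shifted y y∈ = subst (_∈ map (ℤ._+ s) (window T))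
      (ℤ-Group.//-rightDividesˡ s y)
      (∈-map⁺ (ℤ._+ s) (∈-window (y ℤ.- s) (ℕ.≤-trans (ℤ.∣i-j∣≤∣i∣+∣j∣ y s)
        (ℕ.≤-trans (ℕ.+-monoˡ-≤ ℤ.∣ s ∣ (interval-size y∈)) le))))

  reverse-sum : ∀ b (h : ℤ → ℚ) → (∀ d → h (ℤ.- d) ≡ h d) →
    ∑< b (λ i → h (ℤ.+ i ℤ.- ℤ.+ b)) ≡ ∑< b (λ i → h (ℤ.+ suc i))
  reverse-sum zero h even = refl
  reverse-sum (suc b) h even = trans (∑<-first b (λ i → h (ℤ.+ i ℤ.- ℤ.+ suc b)))
    (cong₂ _+_ (trans (cong h (ℤ.+-identityˡ (ℤ.- (ℤ.+ suc b)))) (even (ℤ.+ suc b)))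
      (trans (∑-cong (downFrom b) (λ i → cong h (trans (ℤ.m-n≡m⊖n (suc i) (suc b))
        (trans (ℤ.[1+m]⊖[1+n]≡m⊖n i b) (sym (ℤ.m-n≡m⊖n i b)))))) (reverse-sum b h even)))

  -- For `i < L` the differences `i - b` meet 0 once and every other integer at most once, all of
  -- size at most `L`. Evenness folds the negative ones onto the positive ones, which accounts for
  -- the two copies of the sum.
  even-row : ∀ {b L} (h : ℤ → ℚ) → (∀ d → 0ℚ ≤ h d) → (∀ d → h (ℤ.- d) ≡ h d) → b ℕ.< L →
    ∑< L (λ i → h (ℤ.+ i ℤ.- ℤ.+ b)) ≤ h ℤ.0ℤ + (∑< L (λ d → h (ℤ.+ suc d)) + ∑< L (λ d → h (ℤ.+ suc d)))
  even-row {b} h 0≤h even b<L with c , refl ← ℕ.m≤n⇒∃[o]m+o≡n b<L = begin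
    ∑< (suc b ℕ.+ c) k                         ≡⟨ cong (λ z → ∑< z k) (sym (ℕ.+-suc b c)) ⟩
    ∑< (b ℕ.+ suc c) k                         ≡⟨ ∑<-split b (suc c) k ⟩
    ∑< b k + ∑< (suc c) (λ i → k (b ℕ.+ i))    ≡⟨ cong₂ _+_ (reverse-sum b h even)
        (trans (∑-cong (downFrom (suc c)) (λ i → cong h (offset i))) (∑<-first c (λ i → h (ℤ.+ i)))) ⟩
    ∑< b h⁺ + (h ℤ.0ℤ + ∑< c h⁺)               ≤⟨ ℚ.+-mono-≤ (∑<-prefix h⁺ 0≤h⁺ (ℕ.m≤n⇒m≤1+n (ℕ.m≤m+n b c)))
        (ℚ.+-monoʳ-≤ (h ℤ.0ℤ) (∑<-prefix h⁺ 0≤h⁺ (ℕ.m≤n+m c (suc b)))) ⟩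
    S + (h ℤ.0ℤ + S)                           ≡⟨ solve 2 (λ s h → s :+ (h :+ s) := h :+ (s :+ s)) refl S (h ℤ.0ℤ) ⟩
    h ℤ.0ℤ + (S + S)                           ∎
    where
    open ℚ.≤-Reasoning
    open +-*-Solver
    k = λ i → h (ℤ.+ i ℤ.- ℤ.+ b)
    h⁺ = λ i → h (ℤ.+ suc i)
    S = ∑< (suc b ℕ.+ c) h⁺
    0≤h⁺ = λ i → 0≤h (ℤ.+ suc i)
    offset : ∀ i → ℤ.+ (b ℕ.+ i) ℤ.- ℤ.+ b ≡ ℤ.+ i
    offset i = trans (cong (ℤ._- ℤ.+ b) (ℤ.+-comm (ℤ.+ b) (ℤ.+ i)))
      (ℤ-Group.//-rightDividesʳ (ℤ.+ b) (ℤ.+ i))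

  -- Autocorrelations

  ∑∑ : ℕ → ℕ → (ℕ → ℕ → ℚ) → ℚ
  ∑∑ X Y g = ∑< X λ a → ∑< Y (g a)

  module Correlation (n : ℕ) (φ : ℤ → ℚ) (φ-bounded : ∀ x → ∣ φ x ∣ ≤ 1ℚ)
                     (φ-supported : ∀ {x} → x ∉ interval n → φ x ≡ 0ℚ) where

    A : ℤ → ℚ
    A d = ∑ (interval n) λ y → φ y * φ (y ℤ.+ d)

    φ²≤1 : ∀ x → φ x ² ≤ 1ℚ
    φ²≤1 x = subst (_≤ 1ℚ) (∣²∣ (φ x))
      (*-mono-≤ (ℚ.0≤∣p∣ (φ x)) (ℚ.nonNegative⁻¹ 1ℚ) (φ-bounded x) (φ-bounded x))

    pairing : ∀ (G : ℤ → ℚ) → ∣ ∑ (interval n) (λ y → φ y * G y) ∣ ≤ ∑ (interval n) (λ y → ∣ G y ∣)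
    pairing G = ℚ.≤-trans (∣∑∣ (interval n) (λ y → φ y * G y)) (∑-mono (interval n) λ y →
      subst₂ _≤_ (sym (ℚ.∣p*q∣≡∣p∣*∣q∣ (φ y) (G y))) (ℚ.*-identityˡ ∣ G y ∣)
        (ℚ.*-monoʳ-≤-nonNeg ∣ G y ∣ {{ℚ.∣-∣-nonNeg (G y)}} (φ-bounded y)))

    pairing² : ∀ {T} (G : ℤ → ℚ) → n ℕ.≤ T →
      ∑ (interval n) (λ y → φ y * G y) ² ≤ ι n * ∑ (window T) (λ x → G x ²)
    pairing² {T} G n≤T = begin
      ∑ (interval n) (λ y → φ y * G y) ²                  ≤⟨ cauchy-schwarz (interval n) (λ y → φ y * G y) ⟩
      ι (length (interval n)) * ∑ (interval n) (λ y → (φ y * G y) ²)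
        ≡⟨ cong (λ l → ι l * ∑ (interval n) (λ y → (φ y * G y) ²)) (length-interval n) ⟩
      ι n * ∑ (interval n) (λ y → (φ y * G y) ²)          ≤⟨ ℚ.*-monoˡ-≤-nonNeg (ι n) (∑-mono (interval n) drop) ⟩
      ι n * ∑ (interval n) (λ y → G y ²)                  ≤⟨ ℚ.*-monoˡ-≤-nonNeg (ι n)
        (∑-subset ℤ._≟_ (λ x → G x ²) (λ x → 0≤² (G x)) (interval-unique n) (window-unique T) (interval⊆window n≤T)) ⟩
      ι n * ∑ (window T) (λ x → G x ²)                    ∎
      where
      open ℚ.≤-Reasoning
      drop : ∀ y → (φ y * G y) ² ≤ G y ²
      drop y = subst₂ _≤_ (solve 2 (λ a b → a :* a :* (b :* b) := a :* b :* (a :* b)) refl (φ y) (G y))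
        (ℚ.*-identityˡ (G y ²)) (*-monoˡ-≤ (0≤² (G y)) (φ²≤1 y))
        where open +-*-Solver

    -- Only `u` is restricted: after the substitution `y = x + u` the factor `φ y` already confines
    -- the sum to [n], wherever `v` leads.
    correlate : ∀ {T} u v → n ℕ.+ ℤ.∣ u ∣ ℕ.≤ T →
      ∑ (window T) (λ x → φ (x ℤ.+ u) * φ (x ℤ.+ v)) ≡ A (v ℤ.- u)
    correlate {T} u v le = trans
      (∑-cong (window T) (λ x → cong (λ z → φ (x ℤ.+ u) * φ z) (shifted x u v)))
      (window-shift u (λ y → φ y * φ (y ℤ.+ (v ℤ.- u)))
        (λ {y} y∉ → trans (cong (_* φ (y ℤ.+ (v ℤ.- u))) (φ-supported y∉)) (ℚ.*-zeroˡ (φ (y ℤ.+ (v ℤ.- u))))) le)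
      where
      shifted : ∀ x u v → x ℤ.+ v ≡ x ℤ.+ u ℤ.+ (v ℤ.- u)
      shifted = ℤ-Ring.solve-∀

    A-even : ∀ d → A (ℤ.- d) ≡ A d
    A-even d = begin
      A (ℤ.- d)                                          ≡⟨ cong A (sym (ℤ.+-identityˡ (ℤ.- d))) ⟩
      A (ℤ.0ℤ ℤ.- d)                                     ≡⟨ sym (correlate d ℤ.0ℤ ℕ.≤-refl) ⟩
      ∑ (window T) (λ x → φ (x ℤ.+ d) * φ (x ℤ.+ ℤ.0ℤ))  ≡⟨ ∑-cong (window T) (λ x → ℚ.*-comm (φ (x ℤ.+ d)) _) ⟩
      ∑ (window T) (λ x → φ (x ℤ.+ ℤ.0ℤ) * φ (x ℤ.+ d))  ≡⟨ correlate ℤ.0ℤ d (ℕ.+-monoʳ-≤ n ℕ.z≤n) ⟩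
      A (d ℤ.- ℤ.0ℤ)                                     ≡⟨ cong A (ℤ.+-identityʳ d) ⟩
      A d                                                ∎
      where
      open ≡-Reasoning
      T = n ℕ.+ ℤ.∣ d ∣

    ∣A∣≤n : ∀ d → ∣ A d ∣ ≤ ι n
    ∣A∣≤n d = begin
      ∣ A d ∣                                        ≤⟨ pairing (λ y → φ (y ℤ.+ d)) ⟩
      ∑ (interval n) (λ y → ∣ φ (y ℤ.+ d) ∣)          ≤⟨ ∑-bound (interval n) 1ℚ (λ {y} _ → φ-bounded (y ℤ.+ d)) ⟩
      ι (length (interval n)) * 1ℚ                   ≡⟨ trans (ℚ.*-identityʳ _) (cong ι (length-interval n)) ⟩
      ι n                                            ∎
      where open ℚ.≤-Reasoning

    energy : ∀ {I : Set} {T} (is : List I) (w : I → ℚ) (u : I → ℤ) →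
      (∀ {i} → i ∈ is → n ℕ.+ ℤ.∣ u i ∣ ℕ.≤ T) →
      ∑ (window T) (λ x → ∑ is (λ i → w i * φ (x ℤ.+ u i)) ²) ≡
      ∑ is (λ i → ∑ is (λ j → w i * w j * A (u j ℤ.- u i)))
    energy {T = T} is w u le = begin
      ∑ (window T) (λ x → ∑ is (g x) ²)
        ≡⟨ ∑-cong (window T) (λ x → ∑-square is (g x)) ⟩
      ∑ (window T) (λ x → ∑ is (λ i → ∑ is (λ j → g x i * g x j)))
        ≡⟨ ∑-swap (window T) is _ ⟩
      ∑ is (λ i → ∑ (window T) (λ x → ∑ is (λ j → g x i * g x j)))
        ≡⟨ ∑-cong is (λ i → ∑-swap (window T) is _) ⟩
      ∑ is (λ i → ∑ is (λ j → ∑ (window T) (λ x → g x i * g x j)))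
        ≡⟨ ∑-cong∈ is (λ {i} i∈ → ∑-cong is (λ j → trans
             (∑-cong (window T) (λ x → solve 4 (λ a b c d → a :* b :* (c :* d) := a :* c :* (b :* d)) refl
               (w i) (φ (x ℤ.+ u i)) (w j) (φ (x ℤ.+ u j))))
             (trans (∑-*ˡ (w i * w j) (window T) _) (cong (w i * w j *_) (correlate (u i) (u j) (le i∈)))))) ⟩
      ∑ is (λ i → ∑ is (λ j → w i * w j * A (u j ℤ.- u i))) ∎
      where
      open ≡-Reasoning
      open +-*-Solver
      g = λ x i → w i * φ (x ℤ.+ u i)

    S : ℕ → ℤ → ℚ
    S Y d = ∑< Y λ b → A (d ℤ.* ℤ.+ suc b)

    W : ℕ → ℕ → ℚ
    W X Y = ∑< X λ a → ∣ S Y (ℤ.+ suc a) ∣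

    ∣S∣-even : ∀ Y d → ∣ S Y (ℤ.- d) ∣ ≡ ∣ S Y d ∣
    ∣S∣-even Y d = cong ∣_∣ (∑-cong (downFrom Y) (λ b →
      trans (cong A (sym (ℤ.neg-distribˡ-* d (ℤ.+ suc b)))) (A-even (d ℤ.* ℤ.+ suc b))))

    ∣S∣≤ : ∀ Y d → ∣ S Y d ∣ ≤ ι Y * ι n
    ∣S∣≤ Y d = ℚ.≤-trans (∣∑∣ (downFrom Y) _) (∑<-bound Y (ι n) (λ {b} _ → ∣A∣≤n (d ℤ.* ℤ.+ suc b)))

    weighted-≤ : ∀ {v w a : ℚ} → ∣ v ∣ ≤ 1ℚ → ∣ w ∣ ≤ 1ℚ → v * w * a ≤ ∣ a ∣
    weighted-≤ {v} {w} {a} p q = begin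
      v * w * a               ≤⟨ ≤-abs (v * w * a) ⟩
      ∣ v * w * a ∣           ≡⟨ trans (ℚ.∣p*q∣≡∣p∣*∣q∣ (v * w) a) (cong (_* ∣ a ∣) (ℚ.∣p*q∣≡∣p∣*∣q∣ v w)) ⟩
      ∣ v ∣ * ∣ w ∣ * ∣ a ∣   ≤⟨ ℚ.*-monoʳ-≤-nonNeg ∣ a ∣ {{ℚ.∣-∣-nonNeg a}}
                                 (*-mono-≤ (ℚ.0≤∣p∣ v) (ℚ.nonNegative⁻¹ 1ℚ) p q) ⟩
      1ℚ * ∣ a ∣              ≡⟨ ℚ.*-identityˡ ∣ a ∣ ⟩
      ∣ a ∣                   ∎
      where open ℚ.≤-Reasoning

    module _ {H T : ℕ} where

      -- After expanding the square, the sum over `m` is taken first. The shifts differ by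
      -- `(c - b) * (m + 1)`, so the pair (b, c) yields `S H (c - b)`. Absolute values remove the
      -- weights, `even-row` folds every row into `W L H`, and the diagonal costs `H * n`.
      weighted-energy : ∀ {L} (w : ℕ → ℚ) (u : ℕ → ℕ → ℤ) → (∀ b → ∣ w b ∣ ≤ 1ℚ) →
        (∀ m b c → u m c ℤ.- u m b ≡ (ℤ.+ c ℤ.- ℤ.+ b) ℤ.* ℤ.+ suc m) →
        (∀ {m b} → m ℕ.< H → b ℕ.< L → n ℕ.+ ℤ.∣ u m b ∣ ℕ.≤ T) →
        ∑< H (λ m → ∑ (window T) λ x → ∑< L (λ b → w b * φ (x ℤ.+ u m b)) ²) ≤
        ι L * (ι H * ι n + (W L H + W L H))
      weighted-energy {L} w u w≤1 step le = begin
        ∑< H (λ m → ∑ (window T) λ x → ∑< L (λ b → w b * φ (x ℤ.+ u m b)) ²)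
          ≡⟨ ∑<-cong H (λ {m} m<H → energy (downFrom L) w (u m) (λ b∈ → le m<H (∈-downFrom⁻ b∈))) ⟩
        ∑< H (λ m → ∑∑ L L λ b c → w b * w c * A (u m c ℤ.- u m b))
          ≡⟨ ∑-cong (downFrom H) (λ m → ∑-cong (downFrom L) λ b → ∑-cong (downFrom L) λ c →
               cong (λ z → w b * w c * A z) (step m b c)) ⟩
        ∑< H (λ m → ∑∑ L L λ b c → w b * w c * A ((ℤ.+ c ℤ.- ℤ.+ b) ℤ.* ℤ.+ suc m))
          ≡⟨ trans (∑-swap (downFrom H) (downFrom L) _) (∑-cong (downFrom L) λ b →
               trans (∑-swap (downFrom H) (downFrom L) _) (∑-cong (downFrom L) λ c →
                 ∑-*ˡ (w b * w c) (downFrom H) _)) ⟩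
        ∑∑ L L (λ b c → w b * w c * S H (ℤ.+ c ℤ.- ℤ.+ b))
          ≤⟨ ∑-mono (downFrom L) (λ b → ∑-mono (downFrom L) λ c → weighted-≤ (w≤1 b) (w≤1 c)) ⟩
        ∑∑ L L (λ b c → ∣ S H (ℤ.+ c ℤ.- ℤ.+ b) ∣)
          ≤⟨ ∑<-bound L _ (λ b<L → ℚ.≤-trans
               (even-row (λ d → ∣ S H d ∣) (λ d → ℚ.0≤∣p∣ (S H d)) (∣S∣-even H) b<L)
               (ℚ.+-monoˡ-≤ _ (∣S∣≤ H ℤ.0ℤ))) ⟩
        ι L * (ι H * ι n + (W L H + W L H)) ∎
        where open ℚ.≤-Reasoning

      -- This shortens the range of `b` from `J * L` to `L`: Cauchy-Schwarz over the `J` blocks,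
      -- each of which obeys the same bound because moving a block changes no difference of shifts.
      block-energy : ∀ {J L} (w : ℕ → ℚ) (u : ℕ → ℕ → ℤ) → (∀ b → ∣ w b ∣ ≤ 1ℚ) →
        (∀ m b c → u m c ℤ.- u m b ≡ (ℤ.+ c ℤ.- ℤ.+ b) ℤ.* ℤ.+ suc m) →
        (∀ {m b} → m ℕ.< H → b ℕ.< J ℕ.* L → n ℕ.+ ℤ.∣ u m b ∣ ℕ.≤ T) →
        ∑< H (λ m → ∑ (window T) λ x → ∑< (J ℕ.* L) (λ b → w b * φ (x ℤ.+ u m b)) ²) ≤
        ι J * (ι J * (ι L * (ι H * ι n + (W L H + W L H))))
      block-energy {J} {L} w u w≤1 step le = begin
        ∑< H (λ m → ∑ (window T) λ x → ∑< (J ℕ.* L) (λ b → w b * φ (x ℤ.+ u m b)) ²)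
          ≡⟨ ∑-cong (downFrom H) (λ m → ∑-cong (window T) λ x → cong _² (∑<-blocks J L _)) ⟩
        ∑< H (λ m → ∑ (window T) λ x → ∑< J (block m x) ²)
          ≤⟨ ∑-mono (downFrom H) (λ m → ∑-mono (window T) λ x → ∑<-cauchy-schwarz J (block m x)) ⟩
        ∑< H (λ m → ∑ (window T) λ x → ι J * ∑< J (λ j → block m x j ²))
          ≡⟨ trans (∑-cong (downFrom H) λ m → ∑-*ˡ (ι J) (window T) _) (∑-*ˡ (ι J) (downFrom H) _) ⟩
        ι J * ∑< H (λ m → ∑ (window T) λ x → ∑< J (λ j → block m x j ²))
          ≡⟨ cong (ι J *_) (trans (∑-cong (downFrom H) λ m → ∑-swap (window T) (downFrom J) _)
               (∑-swap (downFrom H) (downFrom J) _)) ⟩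
        ι J * ∑< J (λ j → ∑< H λ m → ∑ (window T) λ x → block m x j ²)
          ≤⟨ ℚ.*-monoˡ-≤-nonNeg (ι J) (∑<-bound J _ λ {j} j<J →
               weighted-energy (λ i → w (j ℕ.* L ℕ.+ i)) (λ m i → u m (j ℕ.* L ℕ.+ i))
                 (λ i → w≤1 (j ℕ.* L ℕ.+ i))
                 (λ m b c → trans (step m _ _) (cong (ℤ._* ℤ.+ suc m) (offset (ℤ.+ (j ℕ.* L)) (ℤ.+ b) (ℤ.+ c))))
                 (λ m<H i<L → le m<H (within j<J i<L))) ⟩
        ι J * (ι J * (ι L * (ι H * ι n + (W L H + W L H)))) ∎
        where
        open ℚ.≤-Reasoning
        block : ℕ → ℤ → ℕ → ℚ
        block m x j = ∑< L λ i → w (j ℕ.* L ℕ.+ i) * φ (x ℤ.+ u m (j ℕ.* L ℕ.+ i))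
        offset : ∀ o b c → (o ℤ.+ c) ℤ.- (o ℤ.+ b) ≡ c ℤ.- b
        offset = ℤ-Ring.solve-∀
        within : ∀ {j i} → j ℕ.< J → i ℕ.< L → j ℕ.* L ℕ.+ i ℕ.< J ℕ.* L
        within {j} {i} j<J i<L = ℕ.<-≤-trans (ℕ.+-monoʳ-< (j ℕ.* L) i<L)
          (ℕ.≤-trans (ℕ.≤-reflexive (ℕ.+-comm (j ℕ.* L) L)) (ℕ.*-monoˡ-≤ L j<J))

    -- Cauchy-Schwarz in `a` and then in `y` leaves the energy of the sums of `φ (x + a b)` over
    -- `b`. In it `a` plays the part of the multiplier `m`, and the differences of the `b`, cut into
    -- blocks of length `K`, become the outer variable. Indicator weights pad the range `H` to
    -- `J * K`.
    swap-scales : ∀ {L H J K} → H ℕ.≤ J ℕ.* K →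
      W L H ² ≤ ι L * (ι n * (ι J * (ι J * (ι K * (ι L * ι n + (W K L + W K L))))))
    swap-scales {L} {H} {J} {K} H≤JK = begin
      W L H ²                                        ≤⟨ ∑<-cauchy-schwarz L _ ⟩
      ι L * ∑< L (λ a → ∣ S H (ℤ.+ suc a) ∣ ²)       ≤⟨ ℚ.*-monoˡ-≤-nonNeg (ι L) (∑-mono (downFrom L) λ a →
                                                          ℚ.≤-trans (ℚ.≤-reflexive (∣²∣ (S H (ℤ.+ suc a)))) (S²≤ a)) ⟩
      ι L * ∑< L (λ a → ι n * ∑ (window T) λ x → ∑< H (λ b → φ (x ℤ.+ v a b)) ²)
        ≡⟨ cong (ι L *_) (∑-*ˡ (ι n) (downFrom L) _) ⟩
      ι L * (ι n * ∑< L (λ a → ∑ (window T) λ x → ∑< H (λ b → φ (x ℤ.+ v a b)) ²))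
        ≡⟨ cong (λ z → ι L * (ι n * z)) (∑-cong (downFrom L) λ a → ∑-cong (window T) λ x →
             cong _² (∑<-extend _ H≤JK)) ⟩
      ι L * (ι n * ∑< L (λ a → ∑ (window T) λ x → ∑< (J ℕ.* K) (λ b → ind (b ℕ.<? H) * φ (x ℤ.+ v a b)) ²))
        ≤⟨ ℚ.*-monoˡ-≤-nonNeg (ι L) (ℚ.*-monoˡ-≤-nonNeg (ι n)
             (block-energy {J = J} {K} (λ b → ind (b ℕ.<? H)) v (λ b → ∣ind∣≤1 (b ℕ.<? H))
               (λ a b c → difference (ℤ.+ suc a) (ℤ.+ b) (ℤ.+ c)) within)) ⟩
      ι L * (ι n * (ι J * (ι J * (ι K * (ι L * ι n + (W K L + W K L)))))) ∎
      where
      open ℚ.≤-Reasoning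
      T = n ℕ.+ L ℕ.* (J ℕ.* K)
      v : ℕ → ℕ → ℤ
      v a b = ℤ.+ suc a ℤ.* ℤ.+ suc b
      difference : ∀ a b c → a ℤ.* (ℤ.1ℤ ℤ.+ c) ℤ.- a ℤ.* (ℤ.1ℤ ℤ.+ b) ≡ (c ℤ.- b) ℤ.* a
      difference = ℤ-Ring.solve-∀
      within : ∀ {a b} → a ℕ.< L → b ℕ.< J ℕ.* K → n ℕ.+ ℤ.∣ v a b ∣ ℕ.≤ T
      within {a} {b} a<L b<JK = ℕ.+-monoʳ-≤ n (ℕ.≤-trans (ℕ.≤-reflexive (ℤ.∣i*j∣≡∣i∣*∣j∣ (ℤ.+ suc a) (ℤ.+ suc b)))
        (ℕ.*-mono-≤ a<L b<JK))
      S²≤ : ∀ a → S H (ℤ.+ suc a) ² ≤ ι n * ∑ (window T) λ x → ∑< H (λ b → φ (x ℤ.+ v a b)) ²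
      S²≤ a = subst (λ z → z ² ≤ ι n * ∑ (window T) λ x → ∑< H (λ b → φ (x ℤ.+ v a b)) ²)
        (trans (∑-cong (interval n) (λ y → sym (∑-*ˡ (φ y) (downFrom H) _))) (∑-swap (interval n) (downFrom H) _))
        (pairing² (λ x → ∑< H (λ b → φ (x ℤ.+ v a b))) (ℕ.m≤m+n n _))

  -- Sums under small translations

  ∣∑-∑∣ : ∀ {A : Set} (xs : List A) (g h : A → ℚ) → ∣ ∑ xs g - ∑ xs h ∣ ≤ ∑ xs (λ x → ∣ g x - h x ∣)
  ∣∑-∑∣ xs g h = subst (λ z → ∣ z ∣ ≤ ∑ xs (λ x → ∣ g x - h x ∣)) (∑-sub xs g h) (∣∑∣ xs (λ x → g x - h x))

  ∣-∣-triangle : ∀ a b c → ∣ a - c ∣ ≤ ∣ a - b ∣ + ∣ b - c ∣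
  ∣-∣-triangle a b c = subst (λ z → ∣ z ∣ ≤ ∣ a - b ∣ + ∣ b - c ∣)
    (solve 3 (λ a b c → a :- b :+ (b :- c) := a :- c) refl a b c) (ℚ.∣p+q∣≤∣p∣+∣q∣ (a - b) (b - c))
    where open +-*-Solver

  Bounded : ∀ {A : Set} → (A → ℚ) → Set
  Bounded F = ∀ x → ∣ F x ∣ ≤ 1ℚ

  -- The two sums have all but one term in common, so only `F Y` and `F 0` remain.
  shift-by-one : ∀ Y (F : ℤ → ℚ) → Bounded F →
    ∣ ∑< Y (λ b → F (ℤ.+ suc b)) - ∑< Y (λ b → F (ℤ.+ b)) ∣ ≤ ι 2
  shift-by-one Y F F≤1 = begin
    ∣ s - t ∣
      ≡⟨ cong ∣_∣ (solve 4 (λ s t a b → s :- t := (a :+ s) :- (b :+ t) :+ (b :- a)) refl s t (F (ℤ.+ 0)) (F (ℤ.+ Y))) ⟩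
    ∣ F (ℤ.+ 0) + s - (F (ℤ.+ Y) + t) + (F (ℤ.+ Y) - F (ℤ.+ 0)) ∣
      ≡⟨ cong (λ z → ∣ z - (F (ℤ.+ Y) + t) + (F (ℤ.+ Y) - F (ℤ.+ 0)) ∣) (sym (∑<-first Y (λ b → F (ℤ.+ b)))) ⟩
    ∣ (F (ℤ.+ Y) + t) - (F (ℤ.+ Y) + t) + (F (ℤ.+ Y) - F (ℤ.+ 0)) ∣
      ≡⟨ cong ∣_∣ (solve 2 (λ u v → u :- u :+ v := v) refl (F (ℤ.+ Y) + t) (F (ℤ.+ Y) - F (ℤ.+ 0))) ⟩
    ∣ F (ℤ.+ Y) - F (ℤ.+ 0) ∣        ≤⟨ ℚ.∣p-q∣≤∣p∣+∣q∣ (F (ℤ.+ Y)) (F (ℤ.+ 0)) ⟩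
    ∣ F (ℤ.+ Y) ∣ + ∣ F (ℤ.+ 0) ∣    ≤⟨ ℚ.+-mono-≤ (F≤1 (ℤ.+ Y)) (F≤1 (ℤ.+ 0)) ⟩
    1ℚ + 1ℚ                          ∎
    where
    open ℚ.≤-Reasoning
    open +-*-Solver
    s = ∑< Y (λ b → F (ℤ.+ suc b))
    t = ∑< Y (λ b → F (ℤ.+ b))

  shift-ℕ : ∀ Y k (F : ℤ → ℚ) → Bounded F →
    ∣ ∑< Y (λ b → F (ℤ.+ b ℤ.+ ℤ.+ k)) - ∑< Y (λ b → F (ℤ.+ b)) ∣ ≤ ι (k ℕ.+ k)
  shift-ℕ Y zero F F≤1 = ℚ.≤-reflexive (cong ∣_∣ (trans
    (cong (_- ∑< Y (λ b → F (ℤ.+ b))) (∑-cong (downFrom Y) (λ b → cong F (ℤ.+-identityʳ (ℤ.+ b)))))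
    (ℚ.+-inverseʳ (∑< Y (λ b → F (ℤ.+ b))))))
  shift-ℕ Y (suc k) F F≤1 = begin
    ∣ ∑< Y (λ b → F (ℤ.+ b ℤ.+ ℤ.+ suc k)) - t ∣
      ≡⟨ cong (λ z → ∣ z - t ∣) (∑-cong (downFrom Y) (λ b → cong F (assoc (ℤ.+ b) (ℤ.+ k)))) ⟩
    ∣ ∑< Y (λ b → F⁺ (ℤ.+ b ℤ.+ ℤ.+ k)) - t ∣
      ≤⟨ ∣-∣-triangle (∑< Y (λ b → F⁺ (ℤ.+ b ℤ.+ ℤ.+ k))) (∑< Y (λ b → F⁺ (ℤ.+ b))) t ⟩
    ∣ ∑< Y (λ b → F⁺ (ℤ.+ b ℤ.+ ℤ.+ k)) - ∑< Y (λ b → F⁺ (ℤ.+ b)) ∣ + ∣ ∑< Y (λ b → F⁺ (ℤ.+ b)) - t ∣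
      ≤⟨ ℚ.+-mono-≤ (shift-ℕ Y k F⁺ (λ x → F≤1 _)) (shift-by-one Y F F≤1) ⟩
    ι (k ℕ.+ k) + ι 2       ≡⟨ sym (ι-+ (k ℕ.+ k) 2) ⟩
    ι (k ℕ.+ k ℕ.+ 2)       ≡⟨ cong ι (trans (ℕ.+-comm (k ℕ.+ k) 2) (cong suc (sym (ℕ.+-suc k k)))) ⟩
    ι (suc k ℕ.+ suc k)     ∎
    where
    open ℚ.≤-Reasoning
    t = ∑< Y (λ b → F (ℤ.+ b))
    F⁺ = λ x → F (ℤ.1ℤ ℤ.+ x)
    assoc : ∀ b k → b ℤ.+ (ℤ.1ℤ ℤ.+ k) ≡ ℤ.1ℤ ℤ.+ (b ℤ.+ k)
    assoc = ℤ-Ring.solve-∀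

  shift-ℤ : ∀ Y s (F : ℤ → ℚ) → Bounded F →
    ∣ ∑< Y (λ b → F (ℤ.+ b ℤ.+ s)) - ∑< Y (λ b → F (ℤ.+ b)) ∣ ≤ ι (ℤ.∣ s ∣ ℕ.+ ℤ.∣ s ∣)
  shift-ℤ Y (ℤ.+ k) F F≤1 = shift-ℕ Y k F F≤1
  shift-ℤ Y s@(ℤ.-[1+ k ]) F F≤1 = begin
    ∣ t - ∑< Y (λ b → F (ℤ.+ b)) ∣
      ≡⟨ abs-sym t _ ⟩
    ∣ ∑< Y (λ b → F (ℤ.+ b)) - t ∣
      ≡⟨ cong (λ z → ∣ z - t ∣) (∑-cong (downFrom Y)
          (λ b → cong F (sym (ℤ-Group.//-rightDividesʳ (ℤ.+ suc k) (ℤ.+ b))))) ⟩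
    ∣ ∑< Y (λ b → F (ℤ.+ b ℤ.+ ℤ.+ suc k ℤ.+ s)) - t ∣
      ≤⟨ shift-ℕ Y (suc k) (λ x → F (x ℤ.+ s)) (λ x → F≤1 _) ⟩
    ι (suc k ℕ.+ suc k) ∎
    where
    open ℚ.≤-Reasoning
    t = ∑< Y (λ b → F (ℤ.+ b ℤ.+ s))

  -- One coordinate is moved at a time, with `middle` in between; for the other coordinate the order
  -- of summation is exchanged.
  shift-box : ∀ {z} Y r s (F : ℤ → ℤ → ℚ) → (∀ x → Bounded (F x)) → ℤ.∣ r ∣ ℕ.≤ z → ℤ.∣ s ∣ ℕ.≤ z →
    ∣ ∑∑ Y Y (λ b c → F (ℤ.+ b ℤ.+ r) (ℤ.+ c ℤ.+ s)) - ∑∑ Y Y (λ b c → F (ℤ.+ b) (ℤ.+ c)) ∣ ≤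
    ι Y * ι (z ℕ.+ z) + ι Y * ι (z ℕ.+ z)
  shift-box {z} Y r s F F≤1 r≤z s≤z = ℚ.≤-trans (∣-∣-triangle (∑∑ Y Y (λ b c → F (ℤ.+ b ℤ.+ r) (ℤ.+ c ℤ.+ s))) middle
    (∑∑ Y Y (λ b c → F (ℤ.+ b) (ℤ.+ c)))) (ℚ.+-mono-≤
    (row (λ b c → F (ℤ.+ b ℤ.+ r) (ℤ.+ c ℤ.+ s)) (λ b c → F (ℤ.+ b ℤ.+ r) (ℤ.+ c))
      (λ b → ℚ.≤-trans (shift-ℤ Y s (F (ℤ.+ b ℤ.+ r)) (F≤1 _)) (ι-mono (ℕ.+-mono-≤ s≤z s≤z))))
    (subst₂ (λ u v → ∣ u - v ∣ ≤ ι Y * ι (z ℕ.+ z)) (∑-swap (downFrom Y) (downFrom Y) _)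
        (∑-swap (downFrom Y) (downFrom Y) _)
      (row (λ c b → F (ℤ.+ b ℤ.+ r) (ℤ.+ c)) (λ c b → F (ℤ.+ b) (ℤ.+ c))
        (λ c → ℚ.≤-trans (shift-ℤ Y r (λ x → F x (ℤ.+ c)) (λ x → F≤1 x _)) (ι-mono (ℕ.+-mono-≤ r≤z r≤z))))))
    where
    middle = ∑∑ Y Y (λ b c → F (ℤ.+ b ℤ.+ r) (ℤ.+ c))
    row : ∀ (g h : ℕ → ℕ → ℚ) → (∀ b → ∣ ∑< Y (g b) - ∑< Y (h b) ∣ ≤ ι (z ℕ.+ z)) →
      ∣ ∑∑ Y Y g - ∑∑ Y Y h ∣ ≤ ι Y * ι (z ℕ.+ z)
    row g h le = ℚ.≤-trans (∣∑-∑∣ (downFrom Y) _ _) (∑<-bound Y _ (λ {b} _ → le b))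

  bézout : ∀ m n → ∃[ α ] ∃[ β ] ℤ.+ gcd m n ≡ α ℤ.* ℤ.+ m ℤ.+ β ℤ.* ℤ.+ n
  bézout m n with Bézout.identity (gcd-GCD m n)
  ... | Bézout.+- x y eq = ℤ.+ x , ℤ.- (ℤ.+ y) , rearrange (ℤ.+ gcd m n) (ℤ.+ x ℤ.* ℤ.+ m) (ℤ.+ y) (ℤ.+ n)
        (trans (cong (λ z → ℤ.+ gcd m n ℤ.+ z) (sym (ℤ.pos-* y n))) (trans (cong ℤ.+_ eq) (ℤ.pos-* x m)))
    where
    rearrange : ∀ g u y n → g ℤ.+ y ℤ.* n ≡ u → g ≡ u ℤ.+ ℤ.- y ℤ.* n
    rearrange g u y n refl = ring g y n
      where
      ring : ∀ g y n → g ≡ g ℤ.+ y ℤ.* n ℤ.+ ℤ.- y ℤ.* n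
      ring = ℤ-Ring.solve-∀
  ... | Bézout.-+ x y eq = ℤ.- (ℤ.+ x) , ℤ.+ y , rearrange (ℤ.+ gcd m n) (ℤ.+ y ℤ.* ℤ.+ n) (ℤ.+ x) (ℤ.+ m)
        (trans (cong (λ z → ℤ.+ gcd m n ℤ.+ z) (sym (ℤ.pos-* x m))) (trans (cong ℤ.+_ eq) (ℤ.pos-* y n)))
    where
    rearrange : ∀ g u y n → g ℤ.+ y ℤ.* n ≡ u → g ≡ ℤ.- y ℤ.* n ℤ.+ u
    rearrange g u y n refl = ring g y n
      where
      ring : ∀ g y n → g ≡ ℤ.- y ℤ.* n ℤ.+ (g ℤ.+ y ℤ.* n)
      ring = ℤ-Ring.solve-∀

  -- Bézout coefficients of n may be reduced modulo m / gcd m n.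
  small-coefficients : ∀ {m n u z i} → m ≡ u ℕ.* gcd m n → 0 ℕ.< m → m ℕ.≤ z → n ℕ.≤ z → i ℕ.< u ℕ.* z →
    ∃[ s ] ∃[ r ] ℤ.∣ s ∣ ℕ.≤ z × ℤ.∣ r ∣ ℕ.≤ z × ℤ.+ i ℤ.* ℤ.+ gcd m n ≡ s ℤ.* ℤ.+ m ℤ.+ r ℤ.* ℤ.+ n
  small-coefficients {m} {n} {zero} eq 0<m = contradiction (subst (0 ℕ.<_) eq 0<m) λ ()
  small-coefficients {m} {n} {u@(suc _)} {z} {i} m≡ug 0<m m≤z n≤z i<uz
    with α , β , g≡ ← bézout m n | divides v n≡vg ← gcd[m,n]∣n m n =
    s , ℤ.+ r , ∣s∣≤z , ℕ.≤-trans (ℕ.<⇒≤ r<u) (ℕ.≤-trans u≤m m≤z) , identity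
    where
    g = gcd m n
    r = (ℤ.+ i ℤ.* β) ℤ.%ℕ u
    k = (ℤ.+ i ℤ.* β) ℤ./ℕ u
    -- Since `u n = v m`, both being `u v g`, the multiple `k u` removed from the coefficient of `n`
    -- reappears as `k v` in the coefficient of `m`.
    s = ℤ.+ i ℤ.* α ℤ.+ k ℤ.* ℤ.+ v
    r<u : r ℕ.< u
    r<u = ℤ.n%ℕd<d (ℤ.+ i ℤ.* β) u
    0<g : 0 ℕ.< g
    0<g = ℕ.n≢0⇒n>0 λ g≡0 → ℕ.<⇒≢ 0<m (sym (trans m≡ug (trans (cong (u ℕ.*_) g≡0) (ℕ.*-zeroʳ u))))
    u≤m : u ℕ.≤ m
    u≤m = subst (u ℕ.≤_) (sym m≡ug) (ℕ.m≤m*n u g {{ℕ.>-nonZero 0<g}})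
    ring : ∀ i α β g k r u v m n → i ℤ.* β ≡ r ℤ.+ k ℤ.* u → m ≡ u ℤ.* g → n ≡ v ℤ.* g → g ≡ α ℤ.* m ℤ.+ β ℤ.* n →
      i ℤ.* g ≡ (i ℤ.* α ℤ.+ k ℤ.* v) ℤ.* m ℤ.+ r ℤ.* n
    ring i α β g k r u v m n p q t w = begin
      i ℤ.* g                                              ≡⟨ cong (i ℤ.*_) w ⟩
      i ℤ.* (α ℤ.* m ℤ.+ β ℤ.* n)                          ≡⟨ expand i α m β n ⟩
      i ℤ.* α ℤ.* m ℤ.+ i ℤ.* β ℤ.* n                      ≡⟨ cong (λ z → i ℤ.* α ℤ.* m ℤ.+ z ℤ.* n) p ⟩
      i ℤ.* α ℤ.* m ℤ.+ (r ℤ.+ k ℤ.* u) ℤ.* n              ≡⟨ expand′ (i ℤ.* α) m r k u n ⟩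
      i ℤ.* α ℤ.* m ℤ.+ (k ℤ.* (u ℤ.* n) ℤ.+ r ℤ.* n)
        ≡⟨ cong (λ z → i ℤ.* α ℤ.* m ℤ.+ (k ℤ.* z ℤ.+ r ℤ.* n)) un≡vm ⟩
      i ℤ.* α ℤ.* m ℤ.+ (k ℤ.* (v ℤ.* m) ℤ.+ r ℤ.* n)      ≡⟨ collect (i ℤ.* α) m k v (r ℤ.* n) ⟩
      (i ℤ.* α ℤ.+ k ℤ.* v) ℤ.* m ℤ.+ r ℤ.* n              ∎
      where
      open ≡-Reasoning
      expand : ∀ i α m β n → i ℤ.* (α ℤ.* m ℤ.+ β ℤ.* n) ≡ i ℤ.* α ℤ.* m ℤ.+ i ℤ.* β ℤ.* n
      expand = ℤ-Ring.solve-∀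
      expand′ : ∀ a m r k u n → a ℤ.* m ℤ.+ (r ℤ.+ k ℤ.* u) ℤ.* n ≡ a ℤ.* m ℤ.+ (k ℤ.* (u ℤ.* n) ℤ.+ r ℤ.* n)
      expand′ = ℤ-Ring.solve-∀
      collect : ∀ a m k v b → a ℤ.* m ℤ.+ (k ℤ.* (v ℤ.* m) ℤ.+ b) ≡ (a ℤ.+ k ℤ.* v) ℤ.* m ℤ.+ b
      collect = ℤ-Ring.solve-∀
      swap : ∀ u v g → u ℤ.* (v ℤ.* g) ≡ v ℤ.* (u ℤ.* g)
      swap = ℤ-Ring.solve-∀
      un≡vm : u ℤ.* n ≡ v ℤ.* m
      un≡vm = trans (cong (u ℤ.*_) t) (trans (swap u v g) (cong (v ℤ.*_) (sym q)))
    identity : ℤ.+ i ℤ.* ℤ.+ g ≡ s ℤ.* ℤ.+ m ℤ.+ ℤ.+ r ℤ.* ℤ.+ n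
    identity = ring (ℤ.+ i) α β (ℤ.+ g) k (ℤ.+ r) (ℤ.+ u) (ℤ.+ v) (ℤ.+ m) (ℤ.+ n)
      (ℤ.a≡a%ℕn+[a/ℕn]*n (ℤ.+ i ℤ.* β) u) (trans (cong ℤ.+_ m≡ug) (ℤ.pos-* u g)) (trans (cong ℤ.+_ n≡vg) (ℤ.pos-* v g))
          g≡
    ig≤mz : i ℕ.* g ℕ.≤ z ℕ.* m
    ig≤mz = ℕ.≤-trans (ℕ.*-monoˡ-≤ g (ℕ.<⇒≤ i<uz)) (ℕ.≤-reflexive
      (trans (cong (ℕ._* g) (ℕ.*-comm u z)) (trans (ℕ.*-assoc z u g) (cong (z ℕ.*_) (sym m≡ug)))))
    rn≤zm : r ℕ.* n ℕ.≤ z ℕ.* m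
    rn≤zm = ℕ.≤-trans (ℕ.*-mono-≤ (ℕ.≤-trans (ℕ.<⇒≤ r<u) u≤m) n≤z) (ℕ.≤-reflexive (ℕ.*-comm m z))
    sm≡ : s ℤ.* ℤ.+ m ≡ ℤ.+ (i ℕ.* g) ℤ.- ℤ.+ (r ℕ.* n)
    sm≡ = trans (isolate (s ℤ.* ℤ.+ m) (ℤ.+ r ℤ.* ℤ.+ n))
        (cong₂ ℤ._-_ (trans (sym identity) (sym (ℤ.pos-* i g))) (sym (ℤ.pos-* r n)))
      where
      isolate : ∀ a b → a ≡ a ℤ.+ b ℤ.- b
      isolate = ℤ-Ring.solve-∀
    ∣-∣≤ : ∀ {a b c} → a ℕ.≤ c → b ℕ.≤ c → ℤ.∣ ℤ.+ a ℤ.- ℤ.+ b ∣ ℕ.≤ c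
    ∣-∣≤ {a} {b} p q = ℕ.≤-trans (ℕ.≤-reflexive (cong ℤ.∣_∣ (ℤ.m-n≡m⊖n a b)))
      (ℕ.≤-trans (ℤ.∣m⊝n∣≤m⊔n a b) (ℕ.⊔-lub p q))
    -- By the identity, `s m` is the difference of `i g` and `r n`, both of which lie between 0 and
    -- `z m`.
    ∣s∣≤z : ℤ.∣ s ∣ ℕ.≤ z
    ∣s∣≤z = ℕ.*-cancelʳ-≤ _ z m {{ℕ.>-nonZero 0<m}} (ℕ.≤-trans (ℕ.≤-reflexive
      (trans (sym (ℤ.∣i*j∣≡∣i∣*∣j∣ s (ℤ.+ m))) (cong ℤ.∣_∣ sm≡))) (∣-∣≤ ig≤mz rn≤zm))

  -- Pairs with a large greatest common divisor

  -- The count is carried as a natural number because the inductive step is integral: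
  -- `c * g ≤ X < m * g` forces `c < m`, hence `(c + 1) * g ≤ X + 1`.
  divisible-count : ∀ g X → ∃[ c ] ∑< X (λ a → ind (g ∣? suc a)) ≡ ι c × c ℕ.* g ℕ.≤ X
  divisible-count g zero = 0 , refl , ℕ.z≤n
  divisible-count g (suc X) with divisible-count g X | g ∣? suc X
  ... | c , eq , le | no _ = c , trans (ℚ.+-identityˡ _) eq , ℕ.m≤n⇒m≤1+n le
  ... | c , eq , le | yes (divides m sX≡mg) = suc c ,
    trans (cong (1ℚ +_) eq) (trans (ℚ.+-comm 1ℚ (ι c)) (sym (ι-suc c))) ,
    ℕ.≤-trans (ℕ.*-monoˡ-≤ g (ℕ.*-cancelʳ-< g c m (ℕ.≤-trans (ℕ.s≤s le) (ℕ.≤-reflexive sX≡mg))))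
      (ℕ.≤-reflexive (sym sX≡mg))

  divisible-bound : ∀ g X → ι g * ∑< X (λ a → ind (g ∣? suc a)) ≤ ι X
  divisible-bound g X with c , eq , le ← divisible-count g X =
    subst (_≤ ι X) (trans (ι-* c g) (trans (ℚ.*-comm (ι c) (ι g)) (cong (ι g *_) (sym eq)))) (ι-mono le)

  *-cancel-pos : ∀ {a b} c → 0ℚ < c → c * a ≤ c * b → a ≤ b
  *-cancel-pos c 0<c = ℚ.*-cancelˡ-≤-pos c {{ℚ.positive 0<c}}

  0<ι : ∀ {n} → 0 ℕ.< n → 0ℚ < ι n
  0<ι {suc n} _ = ℚ.positive⁻¹ (ι (suc n))

  -- The sum of 1/h² over q < h ≤ q + K is at most 1/q - 1/(q+K) = K/(q(q+K)), with denominators cleared.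
  telescope : ∀ {q} → 0 ℕ.< q → ∀ (V : ℚ) → 0ℚ ≤ V → (c : ℕ → ℚ) →
    (∀ i → (ι (q ℕ.+ suc i) * c i) ² ≤ V) → ∀ K → ι q * ι (q ℕ.+ K) * ∑< K (λ i → c i ²) ≤ ι K * V
  telescope {q} 0<q V 0≤V c le zero = ℚ.≤-reflexive (trans (ℚ.*-zeroʳ (ι q * ι (q ℕ.+ 0))) (sym (ℚ.*-zeroˡ V)))
  telescope {q} 0<q V 0≤V c le (suc K) = *-cancel-pos (p * h) (Rational.*-pos 0<p 0<h) (begin
    p * h * (Q * h * (x ² + S))
      ≡⟨ solve 5 (λ p h Q x S → p :* h :* (Q :* h :* (x :* x :+ S)) :=
           h :* h :* (Q :* p :* S) :+ Q :* p :* ((h :* x) :* (h :* x))) refl p h Q x S ⟩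
    h * h * (Q * p * S) + Q * p * (h * x) ²
      ≤⟨ ℚ.+-mono-≤ (*-monoʳ-≤ (0≤² h) (telescope 0<q V 0≤V c le K))
          (*-monoʳ-≤ (*-nonNeg (0≤fromℕ q) (0≤fromℕ (q ℕ.+ K))) (le K)) ⟩
    h * h * (ι K * V) + Q * p * V
      -- With `p = q + K` and `h = p + 1` one has `h² K + q p + q = p h (K + 1)`, so the slack is
      -- exactly `q V`.
      ≤⟨ by-difference (V * Q) (*-nonNeg 0≤V (0≤fromℕ q)) (certificate h≡) ⟩
    p * h * ((ι K + 1ℚ) * V) ≡⟨ cong (λ z → p * h * (z * V)) (sym (ι-suc K)) ⟩
    p * h * (ι (suc K) * V) ∎)
    where
    open ℚ.≤-Reasoning
    open +-*-Solver
    p = ι (q ℕ.+ K)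
    h = ι (q ℕ.+ suc K)
    Q = ι q
    x = c K
    S = ∑< K (λ i → c i ²)
    0<p : 0ℚ < p
    0<p = 0<ι (ℕ.≤-trans 0<q (ℕ.m≤m+n q K))
    0<h : 0ℚ < h
    0<h = 0<ι (ℕ.≤-trans 0<q (ℕ.m≤m+n q (suc K)))
    h≡ : h ≡ ι q + ι K + 1ℚ
    h≡ = trans (cong ι (ℕ.+-suc q K)) (trans (ι-suc (q ℕ.+ K)) (cong (_+ 1ℚ) (ι-+ q K)))
    certificate : h ≡ ι q + ι K + 1ℚ → h * h * (ι K * V) + Q * p * V + V * Q ≡ p * h * ((ι K + 1ℚ) * V)
    certificate eq = trans (cong₂ (λ h p → h * h * (ι K * V) + Q * p * V + V * Q) eq (ι-+ q K))
      (trans (solve 3 (λ q k v → (q :+ k :+ con 1ℚ) :* (q :+ k :+ con 1ℚ) :* (k :* v) :+ q :* (q :+ k) :* v :+ v :* q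
        := (q :+ k) :* (q :+ k :+ con 1ℚ) :* ((k :+ con 1ℚ) :* v)) refl Q (ι K) V)
        (sym (cong₂ (λ h p → p * h * ((ι K + 1ℚ) * V)) eq (ι-+ q K))))

  -- A pair with gcd above `q` is detected by `h` equal to its gcd. So the number of such pairs is
  -- at most the sum over `h > q` of the squared number of multiples of `h` up to `X`, hence at most
  -- X² times the sum of 1/h², and `telescope` bounds this by X²/q.
  large-gcd-count : ∀ {q} X → 0 ℕ.< q →
    ι q * ∑∑ X X (λ a b → ind (q ℕ.<? gcd (suc a) (suc b))) ≤ ι X * ι X
  large-gcd-count {q} X 0<q = begin
    ι q * ∑∑ X X (λ a b → ind (q ℕ.<? gcd (suc a) (suc b)))
      ≤⟨ ℚ.*-monoˡ-≤-nonNeg (ι q) (∑<-mono X λ a<X → ∑-mono (downFrom X) λ b → detect a<X b) ⟩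
    ι q * ∑∑ X X (λ a b → ∑< X λ i → D i a * D i b)
      ≡⟨ cong (ι q *_) (trans (∑-cong (downFrom X) λ a → ∑-swap (downFrom X) (downFrom X) _)
           (trans (∑-swap (downFrom X) (downFrom X) _) (∑-cong (downFrom X) λ i → sym (∑-square (downFrom X) (D i))))) ⟩
    ι q * ∑< X (λ i → ∑< X (D i) ²)
      ≤⟨ *-cancel-pos (ι (q ℕ.+ X)) (0<ι (ℕ.≤-trans 0<q (ℕ.m≤m+n q X))) bound ⟩
    ι X * ι X ∎
    where
    open ℚ.≤-Reasoning
    open +-*-Solver
    D : ℕ → ℕ → ℚ
    D i a = ind ((q ℕ.+ suc i) ∣? suc a)
    0≤DD : ∀ i a b → 0ℚ ≤ D i a * D i b
    0≤DD i a b = *-nonNeg (0≤ind ((q ℕ.+ suc i) ∣? suc a)) (0≤ind ((q ℕ.+ suc i) ∣? suc b))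
    detect : ∀ {a} → a ℕ.< X → ∀ b → ind (q ℕ.<? gcd (suc a) (suc b)) ≤ ∑< X λ i → D i a * D i b
    detect {a} a<X b = ind-≤ (q ℕ.<? gcd (suc a) (suc b)) (∑-nonNeg (downFrom X) (λ i → 0≤DD i a b)) found
      where
      found : q ℕ.< gcd (suc a) (suc b) → 1ℚ ≤ ∑< X λ i → D i a * D i b
      found q<g with i , eq ← ℕ.m≤n⇒∃[o]m+o≡n q<g =
        subst (_≤ ∑< X λ i → D i a * D i b)
          (cong₂ _*_ (ind-yes (_ ∣? suc a) (subst (_∣ suc a) eq′ (gcd[m,n]∣m (suc a) (suc b))))
                     (ind-yes (_ ∣? suc b) (subst (_∣ suc b) eq′ (gcd[m,n]∣n (suc a) (suc b)))))
          (∑-term (λ i → D i a * D i b) (λ i → 0≤DD i a b) (∈-downFrom⁺ i<X))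
        where
        eq′ : gcd (suc a) (suc b) ≡ q ℕ.+ suc i
        eq′ = trans (sym eq) (sym (ℕ.+-suc q i))
        i<X : i ℕ.< X
        i<X = ℕ.≤-trans (ℕ.≤-trans (ℕ.m≤n+m (suc i) q) (ℕ.≤-reflexive (sym eq′)))
          (ℕ.≤-trans (∣⇒≤ (gcd[m,n]∣m (suc a) (suc b))) a<X)
    bound : ι (q ℕ.+ X) * (ι q * ∑< X (λ i → ∑< X (D i) ²)) ≤ ι (q ℕ.+ X) * (ι X * ι X)
    bound = begin
      ι (q ℕ.+ X) * (ι q * S)     ≡⟨ solve 3 (λ a b c → a :* (b :* c) := b :* a :* c) refl (ι (q ℕ.+ X)) (ι q) S ⟩
      ι q * ι (q ℕ.+ X) * S       ≤⟨ telescope 0<q (ι X * ι X) (0≤² (ι X)) (λ i → ∑< X (D i)) square X ⟩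
      ι X * (ι X * ι X)           ≤⟨ *-monoˡ-≤ (0≤² (ι X)) (ι-mono (ℕ.m≤n+m X q)) ⟩
      ι (q ℕ.+ X) * (ι X * ι X)   ∎
      where
      S = ∑< X (λ i → ∑< X (D i) ²)
      square : ∀ i → (ι (q ℕ.+ suc i) * ∑< X (D i)) ² ≤ ι X * ι X
      square i = *-mono-≤ 0≤l (0≤fromℕ X) le le
        where
        0≤l = *-nonNeg (0≤fromℕ (q ℕ.+ suc i)) (∑-nonNeg (downFrom X) (λ a → 0≤ind ((q ℕ.+ suc i) ∣? suc a)))
        le = divisible-bound (q ℕ.+ suc i) X

  -- If the largest index satisfies the condition, then `(K + 1) * q < X` and counting all `K + 1`
  -- indices is good enough; otherwise that index contributes nothing.
  small-count : ∀ q X K → ι q * ∑< K (λ a → ind (suc a ℕ.* q ℕ.<? X)) ≤ ι X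
  small-count q X zero = subst (_≤ ι X) (sym (ℚ.*-zeroʳ (ι q))) (0≤fromℕ X)
  small-count q X (suc K) = step (suc K ℕ.* q ℕ.<? X)
    where
    open ℚ.≤-Reasoning
    open +-*-Solver
    g = λ a → ind (suc a ℕ.* q ℕ.<? X)
    step : (d : Dec (suc K ℕ.* q ℕ.< X)) → ι q * (ind d + ∑< K g) ≤ ι X
    step (no _) = subst (λ z → ι q * z ≤ ι X) (sym (ℚ.+-identityˡ (∑< K g))) (small-count q X K)
    step (yes lt) = begin
      ι q * (1ℚ + ∑< K g)         ≤⟨ ℚ.*-monoˡ-≤-nonNeg (ι q) (ℚ.+-monoʳ-≤ 1ℚ (∑<-bound K 1ℚ (λ {a} _ →
                                       ind-≤ (suc a ℕ.* q ℕ.<? X) (ℚ.nonNegative⁻¹ 1ℚ) (λ _ → ℚ.≤-refl)))) ⟩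
      ι q * (1ℚ + ι K * 1ℚ)
        ≡⟨ solve 2 (λ q k → q :* (con 1ℚ :+ k :* con 1ℚ) := (k :+ con 1ℚ) :* q) refl (ι q) (ι K) ⟩
      (ι K + 1ℚ) * ι q            ≡⟨ cong (_* ι q) (sym (ι-suc K)) ⟩
      ι (suc K) * ι q             ≡⟨ sym (ι-* (suc K) q) ⟩
      ι (suc K ℕ.* q)             ≤⟨ ι-mono (ℕ.<⇒≤ lt) ⟩
      ι X                         ∎

  sign : ∀ x → ∃[ σ ] ∣ σ ∣ ≤ 1ℚ × ∣ x ∣ ≡ σ * x
  sign x with ℚ.∣p∣≡p∨∣p∣≡-p x
  ... | inj₁ eq = 1ℚ , ℚ.≤-refl , trans eq (sym (ℚ.*-identityˡ x))
  ... | inj₂ eq = - 1ℚ , ℚ.≤-refl , trans eq (solve 1 (λ x → :- x := :- con 1ℚ :* x) refl x)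
    where open +-*-Solver

  -- Averaging over progressions of bounded common difference

  module Progressions (n : ℕ) (φ : ℤ → ℚ) (φ-bounded : Bounded φ)
      (φ-supported : ∀ {x} → x ∉ interval n → φ x ≡ 0ℚ)
      (M : ℚ) (φ-uniform : ∀ y g ℓ → 0 ℕ.< g → ∣ ∑< ℓ (λ i → φ (y ℤ.+ ℤ.+ i ℤ.* ℤ.+ g)) ∣ ≤ M) where

    open Correlation n φ φ-bounded φ-supported

    E : ℕ → ℕ → ℕ → ℤ → ℚ
    E Y a a′ y = ∑∑ Y Y λ b b′ → φ (y ℤ.+ (ℤ.+ suc a′ ℤ.* ℤ.+ suc b′ ℤ.- ℤ.+ suc a ℤ.* ℤ.+ suc b))

    ∣∑∑∣≤ : ∀ {g : ℕ → ℕ → ℚ} Y c → (∀ a b → ∣ g a b ∣ ≤ c) → ∣ ∑∑ Y Y g ∣ ≤ ι Y * (ι Y * c)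
    ∣∑∑∣≤ {g} Y c le = ℚ.≤-trans (∣∑∣ (downFrom Y) _) (∑<-bound Y _ λ {a} _ →
      ℚ.≤-trans (∣∑∣ (downFrom Y) (g a)) (∑<-bound Y c λ {b} _ → le a b))

    ∣E∣≤Y² : ∀ Y a a′ y → ∣ E Y a a′ y ∣ ≤ ι Y * (ι Y * 1ℚ)
    ∣E∣≤Y² Y a a′ y = ∣∑∑∣≤ Y 1ℚ λ b b′ → φ-bounded _

    -- `ℓ` copies of `E` at `y` are compared with the values of `E` at `y + i g`, `i < ℓ`. Writing
    -- `i g` as `s (a + 1) + r (a′ + 1)` with small coefficients turns each translation of `y` into
    -- a small translation of the box (b, b′). For fixed (b, b′), on the other hand, the sum over
    -- `i` is a progression sum of difference `g`, hence at most `M`.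
    ∣E∣-bound : ∀ {Y u z} a a′ y → suc a ≡ u ℕ.* gcd (suc a) (suc a′) → a ℕ.< z → a′ ℕ.< z →
      ι (u ℕ.* z) * ∣ E Y a a′ y ∣ ≤ ι Y * (ι Y * M) + ι (u ℕ.* z) * (ι Y * ι (z ℕ.+ z) + ι Y * ι (z ℕ.+ z))
    ∣E∣-bound {Y} {u} {z} a a′ y a≡ug a<z a′<z = begin
      ι ℓ * ∣ e ∣
        ≡⟨ trans (cong (_* ∣ e ∣) (sym (ℚ.0≤p⇒∣p∣≡p (0≤fromℕ ℓ)))) (sym (ℚ.∣p*q∣≡∣p∣*∣q∣ (ι ℓ) e)) ⟩
      ∣ ι ℓ * e ∣
        ≡⟨ cong ∣_∣ (trans (cong (λ l → ι l * e) (sym (length-downFrom ℓ))) (sym (∑-const (downFrom ℓ) e))) ⟩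
      ∣ ∑< ℓ (λ _ → e) ∣     ≡⟨ cong ∣_∣ (solve 2 (λ s t → s := t :- (t :- s)) refl (∑< ℓ (λ _ → e)) (∑< ℓ e⁺)) ⟩
      ∣ ∑< ℓ e⁺ - (∑< ℓ e⁺ - ∑< ℓ (λ _ → e)) ∣
        ≤⟨ ℚ.∣p-q∣≤∣p∣+∣q∣ (∑< ℓ e⁺) _ ⟩
      ∣ ∑< ℓ e⁺ ∣ + ∣ ∑< ℓ e⁺ - ∑< ℓ (λ _ → e) ∣
        ≤⟨ ℚ.+-mono-≤ main (ℚ.≤-trans (∣∑-∑∣ (downFrom ℓ) e⁺ (λ _ → e)) (∑<-bound ℓ _ shifted)) ⟩
      ι Y * (ι Y * M) + ι ℓ * (ι Y * ι (z ℕ.+ z) + ι Y * ι (z ℕ.+ z)) ∎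
      where
      open ℚ.≤-Reasoning
      open +-*-Solver
      ℓ = u ℕ.* z
      g = gcd (suc a) (suc a′)
      e = E Y a a′ y
      e⁺ = λ i → E Y a a′ (y ℤ.+ ℤ.+ i ℤ.* ℤ.+ g)
      0<g : 0 ℕ.< g
      0<g = ℕ.n≢0⇒n>0 λ g≡0 → contradiction (trans a≡ug (trans (cong (u ℕ.*_) g≡0) (ℕ.*-zeroʳ u))) λ ()
      main : ∣ ∑< ℓ e⁺ ∣ ≤ ι Y * (ι Y * M)
      main = subst (λ s → ∣ s ∣ ≤ ι Y * (ι Y * M))
        (sym (trans (∑-swap (downFrom ℓ) (downFrom Y) _)
            (∑-cong (downFrom Y) λ b → ∑-swap (downFrom ℓ) (downFrom Y) _)))
        (∣∑∑∣≤ Y M λ b b′ → subst (λ s → ∣ s ∣ ≤ M)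
          (∑-cong (downFrom ℓ) λ i → cong φ
              (regroup y (ℤ.+ suc a′ ℤ.* ℤ.+ suc b′ ℤ.- ℤ.+ suc a ℤ.* ℤ.+ suc b) (ℤ.+ i ℤ.* ℤ.+ g)))
          (φ-uniform (y ℤ.+ (ℤ.+ suc a′ ℤ.* ℤ.+ suc b′ ℤ.- ℤ.+ suc a ℤ.* ℤ.+ suc b)) g ℓ 0<g))
        where
        regroup : ∀ y d i → y ℤ.+ d ℤ.+ i ≡ y ℤ.+ i ℤ.+ d
        regroup = ℤ-Ring.solve-∀
      -- The summand is extended to integer indices, as the box may move in negative directions; the
      -- first index moves by `- s` because `b` enters with a minus sign.
      F : ℤ → ℤ → ℚ
      F p q = φ (y ℤ.+ (ℤ.+ suc a′ ℤ.* (ℤ.1ℤ ℤ.+ q) ℤ.- ℤ.+ suc a ℤ.* (ℤ.1ℤ ℤ.+ p)))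
      shifted : ∀ {i} → i ℕ.< ℓ → ∣ e⁺ i - e ∣ ≤ ι Y * ι (z ℕ.+ z) + ι Y * ι (z ℕ.+ z)
      shifted {i} i<ℓ with s , r , ∣s∣≤z , ∣r∣≤z , eq ← small-coefficients {suc a} {suc a′} {u} a≡ug ℕ.z<s a<z a′<z i<ℓ =
        subst (λ t → ∣ t - e ∣ ≤ ι Y * ι (z ℕ.+ z) + ι Y * ι (z ℕ.+ z))
          (∑-cong (downFrom Y) λ b → ∑-cong (downFrom Y) λ b′ → cong φ
            (trans (moved y (ℤ.+ suc a) (ℤ.+ suc a′) (ℤ.+ b) (ℤ.+ b′) s r) (cong (λ t → y ℤ.+ t ℤ.+ _) (sym eq))))
          (shift-box Y (ℤ.- s) r F (λ _ _ → φ-bounded _) (subst (ℕ._≤ z) (sym (ℤ.∣-i∣≡∣i∣ s)) ∣s∣≤z) ∣r∣≤z)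
        where
        moved : ∀ y a a′ b b′ s r →
          y ℤ.+ (a′ ℤ.* (ℤ.1ℤ ℤ.+ (b′ ℤ.+ r)) ℤ.- a ℤ.* (ℤ.1ℤ ℤ.+ (b ℤ.+ ℤ.- s))) ≡
          y ℤ.+ (s ℤ.* a ℤ.+ r ℤ.* a′) ℤ.+ (a′ ℤ.* (ℤ.1ℤ ℤ.+ b′) ℤ.- a ℤ.* (ℤ.1ℤ ℤ.+ b))
        moved = ℤ-Ring.solve-∀

    -- The signs `σ` linearise the absolute values, so that `W X Y` is the pairing of `φ` with `G`,
    -- to which Cauchy-Schwarz applies. Opening the autocorrelations in the energy of `G` gives
    -- pairings of `φ` with `E`, and `φ` is dropped from these by its bound 1.
    W²≤ : ∀ X Y → W X Y ² ≤ ι n * ∑∑ X X λ a a′ → ∑ (interval n) λ y → ∣ E Y a a′ y ∣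
    W²≤ X Y = begin
      W X Y ²                                          ≡⟨ cong _² W≡ ⟩
      ∑ (interval n) (λ y → φ y * G y) ²               ≤⟨ pairing² G (ℕ.m≤m+n n (X ℕ.* Y)) ⟩
      ι n * ∑ (window T) (λ x → G x ²)
        ≡⟨ cong (ι n *_) (trans (energy is w u within) (∑-product _,_ (downFrom X) (downFrom Y) _)) ⟩
      ι n * ∑∑ X Y (λ a b → ∑ is λ j → σ a * w j * A (u j ℤ.- v a b))
        ≡⟨ cong (ι n *_) (∑-cong (downFrom X) λ a → trans
             (∑-cong (downFrom Y) λ b → ∑-product _,_ (downFrom X) (downFrom Y) _) (∑-swap (downFrom Y) (downFrom X) _))
                 ⟩
      ι n * ∑∑ X X (λ a a′ → ∑∑ Y Y λ b b′ → σ a * σ a′ * A (v a′ b′ ℤ.- v a b))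
        ≡⟨ cong (ι n *_) (∑-cong (downFrom X) λ a → ∑-cong (downFrom X) λ a′ → trans
             (∑-cong (downFrom Y) λ b → ∑-*ˡ (σ a * σ a′) (downFrom Y) _) (∑-*ˡ (σ a * σ a′) (downFrom Y) _)) ⟩
      ι n * ∑∑ X X (λ a a′ → σ a * σ a′ * ∑∑ Y Y λ b b′ → A (v a′ b′ ℤ.- v a b))
        ≤⟨ ℚ.*-monoˡ-≤-nonNeg (ι n) (∑-mono (downFrom X) λ a → ∑-mono (downFrom X) λ a′ →
             ℚ.≤-trans (weighted-≤ (σ≤1 a) (σ≤1 a′)) (inner a a′)) ⟩
      ι n * ∑∑ X X (λ a a′ → ∑ (interval n) λ y → ∣ E Y a a′ y ∣) ∎
      where
      open ℚ.≤-Reasoning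
      open +-*-Solver
      T = n ℕ.+ X ℕ.* Y
      is = cartesianProduct (downFrom X) (downFrom Y)
      σ : ℕ → ℚ
      σ a = proj₁ (sign (S Y (ℤ.+ suc a)))
      σ≤1 : ∀ a → ∣ σ a ∣ ≤ 1ℚ
      σ≤1 a = proj₁ (proj₂ (sign (S Y (ℤ.+ suc a))))
      v : ℕ → ℕ → ℤ
      v a b = ℤ.+ suc a ℤ.* ℤ.+ suc b
      w : ℕ × ℕ → ℚ
      w (a , _) = σ a
      u : ℕ × ℕ → ℤ
      u (a , b) = v a b
      G : ℤ → ℚ
      G x = ∑ is λ i → w i * φ (x ℤ.+ u i)
      within : ∀ {i} → i ∈ is → n ℕ.+ ℤ.∣ u i ∣ ℕ.≤ T
      within {a , b} i∈ with a∈ , b∈ ← ∈-cartesianProduct⁻ (downFrom X) (downFrom Y) i∈ =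
        ℕ.+-monoʳ-≤ n (ℕ.≤-trans (ℕ.≤-reflexive (ℤ.∣i*j∣≡∣i∣*∣j∣ (ℤ.+ suc a) (ℤ.+ suc b)))
          (ℕ.*-mono-≤ (∈-downFrom⁻ a∈) (∈-downFrom⁻ b∈)))
      W≡ : W X Y ≡ ∑ (interval n) (λ y → φ y * G y)
      W≡ = begin-equality
        ∑< X (λ a → ∣ S Y (ℤ.+ suc a) ∣)         ≡⟨ ∑-cong (downFrom X) (λ a → proj₂ (proj₂ (sign (S Y (ℤ.+ suc a))))) ⟩
        ∑< X (λ a → σ a * S Y (ℤ.+ suc a))       ≡⟨ ∑-cong (downFrom X) (λ a → sym (∑-*ˡ (σ a) (downFrom Y) _)) ⟩
        ∑∑ X Y (λ a b → σ a * A (v a b))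
          ≡⟨ sym (∑-product _,_ (downFrom X) (downFrom Y) (λ i → w i * A (u i))) ⟩
        ∑ is (λ i → w i * A (u i))               ≡⟨ ∑-cong is (λ i → trans (sym (∑-*ˡ (w i) (interval n) _))
                                                      (∑-cong (interval n) λ y → solve 3
                                                          (λ a b c → a :* (b :* c) := b :* (a :* c)) refl (w i) (φ y)
                                                              (φ (y ℤ.+ u i)))) ⟩
        ∑ is (λ i → ∑ (interval n) λ y → φ y * (w i * φ (y ℤ.+ u i)))
                                                 ≡⟨ ∑-swap is (interval n) _ ⟩
        ∑ (interval n) (λ y → ∑ is λ i → φ y * (w i * φ (y ℤ.+ u i)))
                                                 ≡⟨ ∑-cong (interval n) (λ y → ∑-*ˡ (φ y) is _) ⟩
        ∑ (interval n) (λ y → φ y * G y)         ∎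
      inner : ∀ a a′ → ∣ ∑∑ Y Y (λ b b′ → A (v a′ b′ ℤ.- v a b)) ∣ ≤ ∑ (interval n) λ y → ∣ E Y a a′ y ∣
      inner a a′ = subst (λ s → ∣ s ∣ ≤ ∑ (interval n) λ y → ∣ E Y a a′ y ∣)
        (trans (∑-cong (interval n) λ y → trans (sym (∑-*ˡ (φ y) (downFrom Y) _))
            (∑-cong (downFrom Y) λ b → sym (∑-*ˡ (φ y) (downFrom Y) _)))
          (trans (∑-swap (interval n) (downFrom Y) _) (∑-cong (downFrom Y) λ b → ∑-swap (interval n) (downFrom Y) _)))
        (pairing (E Y a a′))

    module _ {X Y z q : ℕ} (0<q : 0 ℕ.< q) (X≤z : X ℕ.≤ z) (zq≤Y : z ℕ.* q ℕ.≤ Y)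
             (Mq³≤Xz : M * ι (q ℕ.* q ℕ.* q) ≤ ι (X ℕ.* z)) where

      private
        Y² = ι Y * ι Y

        0≤Y² : 0ℚ ≤ Y²
        0≤Y² = 0≤² (ι Y)

      -- Here `X ≤ (a + 1) q = u g q ≤ u q²`, so `M q³ ≤ X z` gives `M q ≤ u z = ℓ`, and the
      -- progression sums contribute at most Y². The translation errors contribute `4 Y z q ≤ 4 Y²`.
      ∣E∣-typical : ∀ {a a′} y → a ℕ.< X → a′ ℕ.< X → ¬ q ℕ.< gcd (suc a) (suc a′) → ¬ suc a ℕ.* q ℕ.< X →
        ι q * ∣ E Y a a′ y ∣ ≤ Y² * ι 5
      ∣E∣-typical {a} {a′} y a<X a′<X q≮g aq≮X with divides u a≡ug ← gcd[m,n]∣m (suc a) (suc a′) =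
        *-cancel-pos (ι ℓ) (0<ι 0<ℓ) (begin
          ι ℓ * (ι q * e)         ≡⟨ solve 3 (λ l q e → l :* (q :* e) := q :* (l :* e)) refl (ι ℓ) (ι q) e ⟩
          ι q * (ι ℓ * e)
            ≤⟨ ℚ.*-monoˡ-≤-nonNeg (ι q) (∣E∣-bound {Y} {u} a a′ y a≡ug (ℕ.<-≤-trans a<X X≤z) (ℕ.<-≤-trans a′<X X≤z)) ⟩
          ι q * (ι Y * (ι Y * M) + ι ℓ * (ι Y * ι (z ℕ.+ z) + ι Y * ι (z ℕ.+ z)))
            ≡⟨ cong (λ t → ι q * (ι Y * (ι Y * M) + ι ℓ * (ι Y * t + ι Y * t))) (ι-+ z z) ⟩
          ι q * (ι Y * (ι Y * M) + ι ℓ * (ι Y * (ι z + ι z) + ι Y * (ι z + ι z)))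
            ≡⟨ solve 5 (λ q Y M l z → q :* (Y :* (Y :* M) :+ l :* (Y :* (z :+ z) :+ Y :* (z :+ z)))
                 := Y :* Y :* (M :* q) :+ l :* (con (ι 4) :* Y) :* (z :* q)) refl (ι q) (ι Y) M (ι ℓ) (ι z) ⟩
          Y² * (M * ι q) + ι ℓ * (ι 4 * ι Y) * (ι z * ι q)
            ≤⟨ ℚ.+-mono-≤ (*-monoʳ-≤ 0≤Y² Mq≤ℓ)
                 (*-monoʳ-≤ (*-nonNeg (0≤fromℕ ℓ) (*-nonNeg (0≤fromℕ 4) (0≤fromℕ Y)))
                   (subst (_≤ ι Y) (ι-* z q) (ι-mono zq≤Y))) ⟩
          Y² * ι ℓ + ι ℓ * (ι 4 * ι Y) * ι Y
            ≡⟨ solve 2 (λ Y l → Y :* Y :* l :+ l :* (con (ι 4) :* Y) :* Y := l :* (Y :* Y :* con (ι 5))) refl (ι Y)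
                (ι ℓ) ⟩
          ι ℓ * (Y² * ι 5)         ∎)
        where
        open ℚ.≤-Reasoning
        open +-*-Solver
        ℓ = u ℕ.* z
        g = gcd (suc a) (suc a′)
        e = ∣ E Y a a′ y ∣
        0<u : 0 ℕ.< u
        0<u = ℕ.n≢0⇒n>0 λ { refl → contradiction a≡ug λ () }
        0<ℓ : 0 ℕ.< ℓ
        0<ℓ = ℕ.*-mono-< 0<u (ℕ.<-≤-trans (ℕ.≤-<-trans ℕ.z≤n a<X) X≤z)
        X≤uq² : X ℕ.≤ u ℕ.* (q ℕ.* q)
        X≤uq² = ℕ.≤-trans (ℕ.≮⇒≥ aq≮X) (ℕ.≤-trans (ℕ.≤-reflexive (trans (cong (ℕ._* q) a≡ug) (ℕ.*-assoc u g q)))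
          (ℕ.*-monoʳ-≤ u (ℕ.*-monoˡ-≤ q (ℕ.≮⇒≥ q≮g))))
        Mq≤ℓ : M * ι q ≤ ι ℓ
        Mq≤ℓ = *-cancel-pos (ι (q ℕ.* q)) (0<ι (ℕ.*-mono-< 0<q 0<q)) (begin
          ι (q ℕ.* q) * (M * ι q)
            ≡⟨ solve 3 (λ a M b → a :* (M :* b) := M :* (a :* b)) refl (ι (q ℕ.* q)) M (ι q) ⟩
          M * (ι (q ℕ.* q) * ι q)       ≡⟨ cong (M *_) (sym (ι-* (q ℕ.* q) q)) ⟩
          M * ι (q ℕ.* q ℕ.* q)         ≤⟨ Mq³≤Xz ⟩
          ι (X ℕ.* z)                   ≤⟨ ι-mono (ℕ.*-monoˡ-≤ z X≤uq²) ⟩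
          ι (u ℕ.* (q ℕ.* q) ℕ.* z)
            ≡⟨ cong ι (trans (cong (ℕ._* z) (ℕ.*-comm u (q ℕ.* q))) (ℕ.*-assoc (q ℕ.* q) u z)) ⟩
          ι (q ℕ.* q ℕ.* ℓ)             ≡⟨ ι-* (q ℕ.* q) ℓ ⟩
          ι (q ℕ.* q) * ι ℓ             ∎)

      -- Exceptional pairs receive the trivial bound through the indicators, so that summing over
      -- all pairs becomes a matter of counting.
      ∣E∣≤ : ∀ {a a′} y → a ℕ.< X → a′ ℕ.< X → ι q * ∣ E Y a a′ y ∣ ≤
        Y² * (ι 5 + ι q * (ind (q ℕ.<? gcd (suc a) (suc a′)) + ind (suc a ℕ.* q ℕ.<? X)))
      ∣E∣≤ {a} {a′} y a<X a′<X = split (q ℕ.<? gcd (suc a) (suc a′)) (suc a ℕ.* q ℕ.<? X)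
        where
        open ℚ.≤-Reasoning
        open +-*-Solver
        trivial : ∀ {r} → 0ℚ ≤ r → ι q * ∣ E Y a a′ y ∣ ≤ Y² * (ι 5 + ι q * (1ℚ + r))
        trivial {r} 0≤r = ℚ.≤-trans (ℚ.*-monoˡ-≤-nonNeg (ι q) (∣E∣≤Y² Y a a′ y))
          (by-difference (Y² * (ι 5 + ι q * r)) (*-nonNeg 0≤Y² (+-nonNeg (0≤fromℕ 5) (*-nonNeg (0≤fromℕ q) 0≤r)))
            (solve 3 (λ Y q r → q :* (Y :* (Y :* con 1ℚ)) :+ Y :* Y :* (con (ι 5) :+ q :* r)
              := Y :* Y :* (con (ι 5) :+ q :* (con 1ℚ :+ r))) refl (ι Y) (ι q) r))
        split : (d : Dec (q ℕ.< gcd (suc a) (suc a′))) (d′ : Dec (suc a ℕ.* q ℕ.< X)) →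
          ι q * ∣ E Y a a′ y ∣ ≤ Y² * (ι 5 + ι q * (ind d + ind d′))
        split (yes _) d′ = trivial (0≤ind d′)
        split (no _) (yes _) = trivial {0ℚ} ℚ.≤-refl
        split (no q≮g) (no aq≮X) = subst (λ t → ι q * ∣ E Y a a′ y ∣ ≤ Y² * t)
          (solve 1 (λ q → con (ι 5) := con (ι 5) :+ q :* (con 0ℚ :+ con 0ℚ)) refl (ι q))
              (∣E∣-typical y a<X a′<X q≮g aq≮X)

      -- The constant is 5 + 1 + 1: typical pairs, pairs with gcd above `q`, and pairs whose first
      -- member is below X/q.
      qW²≤ : ι q * W X Y ² ≤ ι 7 * (ι n * (ι X * ι Y)) ²
      qW²≤ = begin
        ι q * W X Y ²                                        ≤⟨ ℚ.*-monoˡ-≤-nonNeg (ι q) (W²≤ X Y) ⟩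
        ι q * (ι n * ∑∑ X X λ a a′ → ∑ (interval n) λ y → ∣ E Y a a′ y ∣)
          ≡⟨ solve 3 (λ q n s → q :* (n :* s) := n :* (q :* s)) refl (ι q) (ι n)
              (∑∑ X X λ a a′ → ∑ (interval n) λ y → ∣ E Y a a′ y ∣) ⟩
        ι n * (ι q * ∑∑ X X λ a a′ → ∑ (interval n) λ y → ∣ E Y a a′ y ∣)
          ≡⟨ cong (ι n *_) (trans (sym (∑-*ˡ (ι q) (downFrom X) _)) (∑-cong (downFrom X) λ a →
               trans (sym (∑-*ˡ (ι q) (downFrom X) _)) (∑-cong (downFrom X) λ a′ → sym (∑-*ˡ (ι q) (interval n) _)))) ⟩
        ι n * ∑∑ X X (λ a a′ → ∑ (interval n) λ y → ι q * ∣ E Y a a′ y ∣)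
          ≤⟨ ℚ.*-monoˡ-≤-nonNeg (ι n) (∑<-mono X λ {a} a<X → ∑<-mono X λ {a′} a′<X →
               subst (λ l → ∑ (interval n) (λ y → ι q * ∣ E Y a a′ y ∣) ≤ ι l * (Y² * (ι 5 + ι q * (i₁ a a′ + i₂ a))))
                 (length-interval n) (∑-bound (interval n) _ (λ {y} _ → ∣E∣≤ y a<X a′<X))) ⟩
        ι n * ∑∑ X X (λ a a′ → ι n * (Y² * (ι 5 + ι q * (i₁ a a′ + i₂ a))))
          ≡⟨ cong (ι n *_) (trans (∑-cong (downFrom X) λ a → trans (∑-*ˡ (ι n) (downFrom X) _)
              (cong (ι n *_) (∑-*ˡ Y² (downFrom X) _)))
               (trans (∑-*ˡ (ι n) (downFrom X) _) (cong (ι n *_) (∑-*ˡ Y² (downFrom X) _)))) ⟩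
        ι n * (ι n * (Y² * ∑∑ X X (λ a a′ → ι 5 + ι q * (i₁ a a′ + i₂ a))))
          ≤⟨ ℚ.*-monoˡ-≤-nonNeg (ι n) (ℚ.*-monoˡ-≤-nonNeg (ι n) (*-monoʳ-≤ 0≤Y² count)) ⟩
        ι n * (ι n * (Y² * (ι 7 * (ι X * ι X))))
          ≡⟨ solve 3 (λ n X Y → n :* (n :* (Y :* Y :* (con (ι 7) :* (X :* X)))) := con (ι 7) :*
              ((n :* (X :* Y)) :* (n :* (X :* Y)))) refl (ι n) (ι X) (ι Y) ⟩
        ι 7 * (ι n * (ι X * ι Y)) ² ∎
        where
        open ℚ.≤-Reasoning
        open +-*-Solver
        i₁ : ℕ → ℕ → ℚ
        i₁ a a′ = ind (q ℕ.<? gcd (suc a) (suc a′))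
        i₂ : ℕ → ℚ
        i₂ a = ind (suc a ℕ.* q ℕ.<? X)
        constant : ∀ c → ∑< X (λ _ → c) ≡ ι X * c
        constant c = trans (∑-const (downFrom X) c) (cong (λ l → ι l * c) (length-downFrom X))
        count : ∑∑ X X (λ a a′ → ι 5 + ι q * (i₁ a a′ + i₂ a)) ≤ ι 7 * (ι X * ι X)
        count = begin
          ∑∑ X X (λ a a′ → ι 5 + ι q * (i₁ a a′ + i₂ a))
            ≡⟨ ∑-cong (downFrom X) (λ a → trans (∑-+ (downFrom X) _ _) (cong₂ _+_ (constant (ι 5))
                 (trans (∑-*ˡ (ι q) (downFrom X) _)
                     (cong (ι q *_) (trans (∑-+ (downFrom X) (i₁ a) _) (cong (∑< X (i₁ a) +_) (constant (i₂ a)))))))) ⟩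
          ∑< X (λ a → ι X * ι 5 + ι q * (∑< X (i₁ a) + ι X * i₂ a))
            ≡⟨ trans (∑-+ (downFrom X) _ _) (cong₂ _+_ (constant (ι X * ι 5)) (trans (∑-*ˡ (ι q) (downFrom X) _)
                 (cong (ι q *_) (trans (∑-+ (downFrom X) _ _) (cong (∑∑ X X i₁ +_) (∑-*ˡ (ι X) (downFrom X) i₂)))))) ⟩
          ι X * (ι X * ι 5) + ι q * (∑∑ X X i₁ + ι X * ∑< X i₂)
            ≡⟨ solve 4 (λ X q s t → X :* (X :* con (ι 5)) :+ q :* (s :+ X :* t) := con (ι 5) :* (X :* X) :+ q :* s :+ X
                :* (q :* t)) refl (ι X) (ι q) (∑∑ X X i₁) (∑< X i₂) ⟩
          ι 5 * (ι X * ι X) + ι q * ∑∑ X X i₁ + ι X * (ι q * ∑< X i₂)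
            ≤⟨ ℚ.+-mono-≤ (ℚ.+-monoʳ-≤ (ι 5 * (ι X * ι X)) (large-gcd-count X 0<q))
                (ℚ.*-monoˡ-≤-nonNeg (ι X) (small-count q X X)) ⟩
          ι 5 * (ι X * ι X) + ι X * ι X + ι X * ι X
            ≡⟨ solve 1 (λ X → con (ι 5) :* (X :* X) :+ X :* X :+ X :* X := con (ι 7) :* (X :* X)) refl (ι X) ⟩
          ι 7 * (ι X * ι X) ∎

      W-small : ∀ {P} → 7 ℕ.* (P ℕ.* P) ℕ.≤ q → ι P * W X Y ≤ ι n * (ι X * ι Y)
      W-small {P} 7P²≤q = ²-cancel-≤ (*-nonNeg (0≤fromℕ n) (*-nonNeg (0≤fromℕ X) (0≤fromℕ Y)))
          (*-cancel-pos (ι 7) (0<ι {7} ℕ.z<s) (begin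
        ι 7 * (ι P * W X Y) ²
          ≡⟨ solve 2 (λ P w → con (ι 7) :* (P :* w :* (P :* w)) := con (ι 7) :* (P :* P) :* (w :* w)) refl (ι P) (W X Y)
              ⟩
        ι 7 * (ι P * ι P) * W X Y ²
          ≡⟨ cong (_* W X Y ²) (sym (trans (ι-* 7 (P ℕ.* P)) (cong (ι 7 *_) (ι-* P P)))) ⟩
        ι (7 ℕ.* (P ℕ.* P)) * W X Y ²    ≤⟨ *-monoˡ-≤ (0≤² (W X Y)) (ι-mono 7P²≤q) ⟩
        ι q * W X Y ²                    ≤⟨ qW²≤ ⟩
        ι 7 * (ι n * (ι X * ι Y)) ²      ∎))
        where
        open ℚ.≤-Reasoning
        open +-*-Solver

  -- Choice of the scales

  m≤2[m/n]n : ∀ m n .{{_ : ℕ.NonZero n}} → n ℕ.≤ m → m ℕ.≤ m / n ℕ.* n ℕ.+ m / n ℕ.* n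
  m≤2[m/n]n m n n≤m = ℕ.≤-trans (ℕ.≤-reflexive (m≡m%n+[m/n]*n m n))
    (ℕ.+-monoˡ-≤ (m / n ℕ.* n) (ℕ.≤-trans (ℕ.<⇒≤ (m%n<n m n))
      (ℕ.m≤n*m n (m / n) {{ℕ.>-nonZero (m≥n⇒m/n>0 n≤m)}})))

  module _ (n : ℕ) (φ : ℤ → ℚ) (φ-bounded : Bounded φ)
      (φ-supported : ∀ {x} → x ∉ interval n → φ x ≡ 0ℚ)
      (M : ℚ) (φ-uniform : ∀ y g ℓ → 0 ℕ.< g → ∣ ∑< ℓ (λ i → φ (y ℤ.+ ℤ.+ i ℤ.* ℤ.+ g)) ∣ ≤ M)
      {H t P q : ℕ} (0<P : 0 ℕ.< P) (q-large : 7 ℕ.* ((12 ℕ.* (P ℕ.* P)) ℕ.* (12 ℕ.* (P ℕ.* P))) ℕ.≤ q)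
      (H-large : q ℕ.* q ℕ.* (12 ℕ.* (P ℕ.* P)) ℕ.≤ H) (t-large : q ℕ.* q ℕ.* (12 ℕ.* (P ℕ.* P)) ℕ.≤ t)
      (n≤tH : n ℕ.≤ t ℕ.* H) (M-small : M * ι (8 ℕ.* (q ℕ.* q ℕ.* (q ℕ.* q) ℕ.* (q ℕ.* q ℕ.* q))) ≤ ι n) where

    open Correlation n φ φ-bounded φ-supported
    open Progressions n φ φ-bounded φ-supported M φ-uniform

    private
      -- The saving needed in the exchanged sum for `P` to survive `swap-scales`. There `W L H`
      -- occurs squared, which gives P²; the 12 is 4 from `J K ≤ 2 H`, squared, times 3 for the
      -- diagonal and the two copies of `W K L`.
      P′ = 12 ℕ.* (P ℕ.* P)

      P≤P′ : P ℕ.≤ P′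
      P≤P′ = ℕ.≤-trans (ℕ.m≤m*n P P {{ℕ.>-nonZero 0<P}}) (ℕ.m≤n*m (P ℕ.* P) 12)

      0<P′ : 0 ℕ.< P′
      0<P′ = ℕ.<-≤-trans 0<P P≤P′

      0<q : 0 ℕ.< q
      0<q = ℕ.<-≤-trans (ℕ.*-mono-< {0} {7} ℕ.z<s (ℕ.*-mono-< 0<P′ 0<P′)) q-large

      instance
        q≢0 : ℕ.NonZero q
        q≢0 = ℕ.>-nonZero 0<q
        qq≢0 : ℕ.NonZero (q ℕ.* q)
        qq≢0 = ℕ.m*n≢0 q q

      q≤q² : q ℕ.≤ q ℕ.* q
      q≤q² = ℕ.m≤m*n q q

      q²≤ : ∀ {m} → q ℕ.* q ℕ.* P′ ℕ.≤ m → q ℕ.* q ℕ.≤ m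
      q²≤ = ℕ.≤-trans (ℕ.m≤m*n (q ℕ.* q) P′ {{ℕ.>-nonZero 0<P′}})

      0≤M : 0ℚ ≤ M
      0≤M = φ-uniform ℤ.0ℤ 1 0 ℕ.z<s

      -- The division by `q` leaves room for the intermediate scale `z`, which must satisfy both
      -- `X ≤ z` and `z * q ≤ Y`.
      L = t / q

      -- d is the loss in n ≤ t H ≤ 4 d X z caused by rounding the scales X and z.
      Mq³≤ : ∀ {d X z} → 0 ℕ.< d → d ℕ.≤ q ℕ.* q ℕ.* (q ℕ.* q) → t ℕ.* H ℕ.≤ 4 ℕ.* d ℕ.* (X ℕ.* z) →
        M * ι (q ℕ.* q ℕ.* q) ≤ ι (X ℕ.* z)
      Mq³≤ {d} {X} {z} 0<d d≤q⁴ tH≤ = *-cancel-pos (ι (4 ℕ.* d)) (0<ι (ℕ.*-mono-< {0} {4} ℕ.z<s 0<d)) (begin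
        ι (4 ℕ.* d) * (M * ι (q ℕ.* q ℕ.* q))
          ≡⟨ solve 3 (λ d M Q → d :* (M :* Q) := M :* (d :* Q)) refl (ι (4 ℕ.* d)) M (ι (q ℕ.* q ℕ.* q)) ⟩
        M * (ι (4 ℕ.* d) * ι (q ℕ.* q ℕ.* q))       ≡⟨ cong (M *_) (sym (ι-* (4 ℕ.* d) (q ℕ.* q ℕ.* q))) ⟩
        M * ι (4 ℕ.* d ℕ.* (q ℕ.* q ℕ.* q))         ≤⟨ *-monoʳ-≤ 0≤M (ι-mono (ℕ.≤-trans
              (ℕ.*-monoˡ-≤ (q ℕ.* q ℕ.* q) (ℕ.*-mono-≤ {4} {8} (ℕ.s≤s (ℕ.s≤s (ℕ.s≤s (ℕ.s≤s ℕ.z≤n)))) d≤q⁴))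
              (ℕ.≤-reflexive (ℕ.*-assoc 8 (q ℕ.* q ℕ.* (q ℕ.* q)) (q ℕ.* q ℕ.* q))))) ⟩
        M * ι (8 ℕ.* (q ℕ.* q ℕ.* (q ℕ.* q) ℕ.* (q ℕ.* q ℕ.* q))) ≤⟨ M-small ⟩
        ι n                                         ≤⟨ ι-mono (ℕ.≤-trans n≤tH tH≤) ⟩
        ι (4 ℕ.* d ℕ.* (X ℕ.* z))                   ≡⟨ ι-* (4 ℕ.* d) (X ℕ.* z) ⟩
        ι (4 ℕ.* d) * ι (X ℕ.* z)                   ∎)
        where
        open ℚ.≤-Reasoning
        open +-*-Solver

      -- The scales are `X = t / q`, `z = H / q` and `Y = H`. Each rounding loses at most a factor
      -- 2, so `t H ≤ 4 q² X z`.
      W-small-direct : t ℕ.≤ H → ι P * W L H ≤ ι n * (ι L * ι H)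
      W-small-direct t≤H = W-small {z = H / q} 0<q (/-monoˡ-≤ q t≤H) (m/n*n≤m H q)
        (Mq³≤ {q ℕ.* q} {L} (ℕ.*-mono-< 0<q 0<q) (ℕ.m≤m*n (q ℕ.* q) (q ℕ.* q)) (ℕ.≤-trans
          (ℕ.*-mono-≤ (m≤2[m/n]n t q (ℕ.≤-trans q≤q² (q²≤ t-large))) (m≤2[m/n]n H q (ℕ.≤-trans q≤q² (q²≤ H-large))))
          (ℕ.≤-reflexive (rearrange L (H / q) q)))) {P}
        (ℕ.≤-trans (ℕ.*-monoʳ-≤ 7 (ℕ.*-mono-≤ P≤P′ P≤P′)) q-large)
        where
        rearrange : ∀ L z q → (L ℕ.* q ℕ.+ L ℕ.* q) ℕ.* (z ℕ.* q ℕ.+ z ℕ.* q) ≡ 4 ℕ.* (q ℕ.* q) ℕ.* (L ℕ.* z)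
        rearrange = ℕ-Ring.solve-∀

      -- When H < t the roles of the two variables are exchanged first, after shrinking H to K.
      W-small-swapped : H ℕ.≤ t → ι P * W L H ≤ ι n * (ι L * ι H)
      W-small-swapped H≤t = ²-cancel-≤ (*-nonNeg (0≤fromℕ n) (*-nonNeg (0≤fromℕ L) (0≤fromℕ H)))
        (*-cancel-pos (ι 12 * ι K) (Rational.*-pos (0<ι {12} ℕ.z<s) (0<ι 0<K)) (begin
          ι 12 * ι K * (ι P * W L H) ²
            ≡⟨ solve 3 (λ P k w → con (ι 12) :* k :* (P :* w :* (P :* w)) := con (ι 12) :* (P :* P) :* k :* (w :* w))
                refl (ι P) (ι K) (W L H) ⟩
          ι 12 * (ι P * ι P) * ι K * W L H ²
            ≡⟨ cong (λ p → p * ι K * W L H ²) ιP′ ⟩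
          p * ι K * W L H ²
            ≤⟨ *-monoʳ-≤ (*-nonNeg (0≤fromℕ P′) (0≤fromℕ K)) (swap-scales {L} {H} {J} {K} H≤JK) ⟩
          p * ι K * (ι L * (ι n * (ι J * (ι J * (ι K * (ι L * ι n + (W K L + W K L)))))))
            ≡⟨ solve 6 (λ p k l n j w → p :* k :* (l :* (n :* (j :* (j :* (k :* (l :* n :+ (w :+ w)))))))
                 := l :* n :* (j :* k :* (j :* k)) :* (p :* (l :* n) :+ (p :* w :+ p :* w))) refl p (ι K) (ι L) (ι n)
                     (ι J) (W K L) ⟩
          ι L * ι n * (ι J * ι K * (ι J * ι K)) * (p * (ι L * ι n) + (p * W K L + p * W K L))
            ≤⟨ *-mono-≤ (*-nonNeg (*-nonNeg (0≤fromℕ L) (0≤fromℕ n)) (0≤² (ι J * ι K)))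
                 (+-nonNeg 0≤klN (+-nonNeg 0≤klN′ 0≤klN′))
                 (*-monoʳ-≤ (*-nonNeg (0≤fromℕ L) (0≤fromℕ n))
                   (*-mono-≤ (*-nonNeg (0≤fromℕ J) (0≤fromℕ K)) (0≤fromℕ (H ℕ.+ H)) JK≤2H JK≤2H))
                 (ℚ.+-mono-≤ (*-monoˡ-≤ (*-nonNeg (0≤fromℕ L) (0≤fromℕ n)) (ι-mono P′≤K))
                   (ℚ.+-mono-≤ small small)) ⟩
          ι L * ι n * (ι (H ℕ.+ H) * ι (H ℕ.+ H)) * (ι K * (ι L * ι n) + (ι n * (ι K * ι L) + ι n * (ι K * ι L)))
            ≡⟨ cong (λ h → ι L * ι n * (h * h) * (ι K * (ι L * ι n) + (ι n * (ι K * ι L) + ι n * (ι K * ι L))))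
                (ι-+ H H) ⟩
          ι L * ι n * ((ι H + ι H) * (ι H + ι H)) * (ι K * (ι L * ι n) + (ι n * (ι K * ι L) + ι n * (ι K * ι L)))
            ≡⟨ solve 4 (λ l n h k → l :* n :* ((h :+ h) :* (h :+ h)) :*
                (k :* (l :* n) :+ (n :* (k :* l) :+ n :* (k :* l)))
                 := con (ι 12) :* k :* ((n :* (l :* h)) :* (n :* (l :* h)))) refl (ι L) (ι n) (ι H) (ι K) ⟩
          ι 12 * ι K * (ι n * (ι L * ι H)) ² ∎))
        where
        open ℚ.≤-Reasoning
        open +-*-Solver
        -- The long range is now `L = t / q` and the intermediate scale `z = L / q` is `t / q²`, so
        -- the short range has to be `H` divided by q² to stay below `z`.
        K = H / (q ℕ.* q)
        J = 2 ℕ.* (q ℕ.* q)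
        p = ι P′
        ιP′ : ι 12 * (ι P * ι P) ≡ p
        ιP′ = sym (trans (ι-* 12 (P ℕ.* P)) (cong (ι 12 *_) (ι-* P P)))
        P′≤K : P′ ℕ.≤ K
        P′≤K = subst (ℕ._≤ K) (trans (cong (_/ (q ℕ.* q)) (ℕ.*-comm (q ℕ.* q) P′)) (m*n/n≡m P′ (q ℕ.* q)))
            (/-monoˡ-≤ (q ℕ.* q) H-large)
        0<K : 0 ℕ.< K
        0<K = ℕ.<-≤-trans 0<P′ P′≤K
        H≤JK : H ℕ.≤ J ℕ.* K
        H≤JK = ℕ.≤-trans (m≤2[m/n]n H (q ℕ.* q) (q²≤ H-large)) (ℕ.≤-reflexive (double K (q ℕ.* q)))
          where
          double : ∀ k q → k ℕ.* q ℕ.+ k ℕ.* q ≡ 2 ℕ.* q ℕ.* k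
          double = ℕ-Ring.solve-∀
        JK≤2H : ι J * ι K ≤ ι (H ℕ.+ H)
        JK≤2H = subst (_≤ ι (H ℕ.+ H)) (ι-* J K) (ι-mono (ℕ.≤-trans (ℕ.≤-reflexive (double K (q ℕ.* q)))
          (ℕ.+-mono-≤ (m/n*n≤m H (q ℕ.* q)) (m/n*n≤m H (q ℕ.* q)))))
          where
          double : ∀ k q → 2 ℕ.* q ℕ.* k ≡ k ℕ.* q ℕ.+ k ℕ.* q
          double = ℕ-Ring.solve-∀
        z≡ : L / q ≡ t / (q ℕ.* q)
        z≡ = m/n/o≡m/[n*o] t q q
        small : p * W K L ≤ ι n * (ι K * ι L)
        small = W-small {z = L / q} 0<q (subst (K ℕ.≤_) (sym z≡) (/-monoˡ-≤ (q ℕ.* q) H≤t)) (m/n*n≤m L q)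
          (Mq³≤ {q ℕ.* q ℕ.* (q ℕ.* q)} {K} (ℕ.*-mono-< (ℕ.*-mono-< 0<q 0<q) (ℕ.*-mono-< 0<q 0<q)) ℕ.≤-refl
            (ℕ.≤-trans (ℕ.*-mono-≤ (m≤2[m/n]n t (q ℕ.* q) (q²≤ t-large)) (m≤2[m/n]n H (q ℕ.* q) (q²≤ H-large)))
              (ℕ.≤-reflexive (trans (rearrange (t / (q ℕ.* q)) K (q ℕ.* q))
                  (cong (λ z → 4 ℕ.* (q ℕ.* q ℕ.* (q ℕ.* q)) ℕ.* (K ℕ.* z)) (sym z≡))))))
          {P′} q-large
          where
          rearrange : ∀ z k q → (z ℕ.* q ℕ.+ z ℕ.* q) ℕ.* (k ℕ.* q ℕ.+ k ℕ.* q) ≡ 4 ℕ.* (q ℕ.* q) ℕ.* (k ℕ.* z)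
          rearrange = ℕ-Ring.solve-∀
        0≤klN : 0ℚ ≤ ι K * (ι L * ι n)
        0≤klN = *-nonNeg (0≤fromℕ K) (*-nonNeg (0≤fromℕ L) (0≤fromℕ n))
        0≤klN′ : 0ℚ ≤ ι n * (ι K * ι L)
        0≤klN′ = *-nonNeg (0≤fromℕ n) (*-nonNeg (0≤fromℕ K) (0≤fromℕ L))

      W-small′ : ι P * W L H ≤ ι n * (ι L * ι H)
      W-small′ with ℕ.≤-total t H
      ... | inj₁ t≤H = W-small-direct t≤H
      ... | inj₂ H≤t = W-small-swapped H≤t

    -- The shifts are covered by `6 q` blocks of length `L`: `2 t + 1 ≤ 3 t ≤ 6 q L ≤ 6 t`. The
    -- diagonal and the two copies of `W L H` give a factor 3, and 3 times 6² is 108.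
    linear-form-bound : ∀ {T} (w : ℕ → ℚ) → Bounded w → n ℕ.+ 7 ℕ.* t ℕ.* H ℕ.≤ T →
      ι P * ∑< H (λ m → ∑ (window T) λ x → ∑< (suc (t ℕ.+ t)) (λ b → w b * φ (x ℤ.+ (ℤ.+ b ℤ.- ℤ.+ t) ℤ.* ℤ.+ suc m)) ²)
          ≤
      ι 108 * (ι t * ι t * (ι n * ι H))
    linear-form-bound {T} w w≤1 T-large = begin
      ι P * ∑< H (λ m → ∑ (window T) λ x → ∑< (suc (t ℕ.+ t)) (λ b → w b * φ (x ℤ.+ u m b)) ²)
        ≡⟨ cong (ι P *_) (∑-cong (downFrom H) λ m → ∑-cong (window T) λ x → cong _² (trans (∑<-extend _ 2t+1≤JL)
             (∑-cong (downFrom (J ℕ.* L)) λ b → sym (ℚ.*-assoc (ind (b ℕ.<? suc (t ℕ.+ t))) (w b) _)))) ⟩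
      ι P * ∑< H (λ m → ∑ (window T) λ x → ∑< (J ℕ.* L) (λ b → w′ b * φ (x ℤ.+ u m b)) ²)
        ≤⟨ ℚ.*-monoˡ-≤-nonNeg (ι P) (block-energy {J = J} {L} w′ u w′≤1
             (λ m b c → difference (ℤ.+ b) (ℤ.+ c) (ℤ.+ t) (ℤ.+ suc m)) within) ⟩
      ι P * (ι J * (ι J * (ι L * (ι H * ι n + (W L H + W L H)))))
        ≡⟨ solve 6 (λ p j l h n w → p :* (j :* (j :* (l :* (h :* n :+ (w :+ w))))) := j :* j :* l :*
            (p :* (h :* n) :+ (p :* w :+ p :* w)))
             refl (ι P) (ι J) (ι L) (ι H) (ι n) (W L H) ⟩
      ι J * ι J * ι L * (ι P * (ι H * ι n) + (ι P * W L H + ι P * W L H))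
        ≤⟨ *-monoʳ-≤ (*-nonNeg (0≤² (ι J)) (0≤fromℕ L))
             (ℚ.+-mono-≤ (*-monoˡ-≤ (*-nonNeg (0≤fromℕ H) (0≤fromℕ n)) (ι-mono P≤L))
               (ℚ.+-mono-≤ W-small′ W-small′)) ⟩
      ι J * ι J * ι L * (ι L * (ι H * ι n) + (ι n * (ι L * ι H) + ι n * (ι L * ι H)))
        ≡⟨ solve 4 (λ j l h n → j :* j :* l :* (l :* (h :* n) :+ (n :* (l :* h) :+ n :* (l :* h)))
             := con (ι 3) :* (j :* l :* (j :* l) :* (n :* h))) refl (ι J) (ι L) (ι H) (ι n) ⟩
      ι 3 * (ι J * ι L * (ι J * ι L) * (ι n * ι H))
        ≤⟨ ℚ.*-monoˡ-≤-nonNeg (ι 3) (*-monoˡ-≤ (*-nonNeg (0≤fromℕ n) (0≤fromℕ H))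
             (*-mono-≤ (*-nonNeg (0≤fromℕ J) (0≤fromℕ L)) (0≤fromℕ (6 ℕ.* t)) JL≤ JL≤)) ⟩
      ι 3 * (ι (6 ℕ.* t) * ι (6 ℕ.* t) * (ι n * ι H))
        ≡⟨ cong (λ s → ι 3 * (s * s * (ι n * ι H))) (ι-* 6 t) ⟩
      ι 3 * (ι 6 * ι t * (ι 6 * ι t) * (ι n * ι H))
        ≡⟨ solve 3 (λ t n h → con (ι 3) :* (con (ι 6) :* t :* (con (ι 6) :* t) :* (n :* h)) := con (ι 108) :*
            (t :* t :* (n :* h))) refl (ι t) (ι n) (ι H) ⟩
      ι 108 * (ι t * ι t * (ι n * ι H)) ∎
      where
      open ℚ.≤-Reasoning
      open +-*-Solver
      J = 6 ℕ.* q
      u : ℕ → ℕ → ℤ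
      u m b = (ℤ.+ b ℤ.- ℤ.+ t) ℤ.* ℤ.+ suc m
      w′ : ℕ → ℚ
      w′ b = ind (b ℕ.<? suc (t ℕ.+ t)) * w b
      w′≤1 : Bounded w′
      w′≤1 b = ℚ.≤-trans (ℚ.≤-reflexive (ℚ.∣p*q∣≡∣p∣*∣q∣ (ind (b ℕ.<? suc (t ℕ.+ t))) (w b)))
        (*-mono-≤ (ℚ.0≤∣p∣ (ind (b ℕ.<? suc (t ℕ.+ t)))) (ℚ.nonNegative⁻¹ 1ℚ) (∣ind∣≤1 (b ℕ.<? suc (t ℕ.+ t))) (w≤1 b))
      difference : ∀ b c t m → (c ℤ.- t) ℤ.* m ℤ.- (b ℤ.- t) ℤ.* m ≡ (c ℤ.- b) ℤ.* m
      difference = ℤ-Ring.solve-∀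
      P≤L : P ℕ.≤ L
      P≤L = subst (ℕ._≤ L) (m*n/n≡m P q) (/-monoˡ-≤ q (ℕ.≤-trans (ℕ.≤-reflexive (ℕ.*-comm P q))
        (ℕ.≤-trans (ℕ.*-mono-≤ q≤q² P≤P′) t-large)))
      Lq≤t : L ℕ.* q ℕ.≤ t
      Lq≤t = m/n*n≤m t q
      6qL≡ : ∀ q L → 6 ℕ.* q ℕ.* L ≡ 6 ℕ.* (L ℕ.* q)
      6qL≡ = ℕ-Ring.solve-∀
      JL≤6t : J ℕ.* L ℕ.≤ 6 ℕ.* t
      JL≤6t = ℕ.≤-trans (ℕ.≤-reflexive (6qL≡ q L)) (ℕ.*-monoʳ-≤ 6 Lq≤t)
      JL≤ : ι J * ι L ≤ ι (6 ℕ.* t)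
      JL≤ = subst (_≤ ι (6 ℕ.* t)) (ι-* J L) (ι-mono JL≤6t)
      2t+1≤JL : suc (t ℕ.+ t) ℕ.≤ J ℕ.* L
      2t+1≤JL = ℕ.≤-trans (ℕ.+-monoˡ-≤ (t ℕ.+ t) 0<t)
          (ℕ.≤-trans (ℕ.+-mono-≤ t≤ (ℕ.+-mono-≤ t≤ t≤)) (ℕ.≤-reflexive (triple q L)))
        where
        0<t : 0 ℕ.< t
        0<t = ℕ.<-≤-trans (ℕ.*-mono-< 0<q 0<q) (q²≤ t-large)
        t≤ = m≤2[m/n]n t q (ℕ.≤-trans q≤q² (q²≤ t-large))
        triple : ∀ q L → (L ℕ.* q ℕ.+ L ℕ.* q) ℕ.+ ((L ℕ.* q ℕ.+ L ℕ.* q) ℕ.+ (L ℕ.* q ℕ.+ L ℕ.* q)) ≡ 6 ℕ.* q ℕ.* L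
        triple = ℕ-Ring.solve-∀
      within : ∀ {m b} → m ℕ.< H → b ℕ.< J ℕ.* L → n ℕ.+ ℤ.∣ u m b ∣ ℕ.≤ T
      within {m} {b} m<H b<JL = ℕ.≤-trans (ℕ.+-monoʳ-≤ n (begin-ℕ)) T-large
        where
        begin-ℕ : ℤ.∣ u m b ∣ ℕ.≤ 7 ℕ.* t ℕ.* H
        begin-ℕ = ℕ.≤-trans (ℕ.≤-reflexive (ℤ.∣i*j∣≡∣i∣*∣j∣ (ℤ.+ b ℤ.- ℤ.+ t) (ℤ.+ suc m)))
          (ℕ.*-mono-≤ (ℕ.≤-trans (ℤ.∣i-j∣≤∣i∣+∣j∣ (ℤ.+ b) (ℤ.+ t)) (ℕ.≤-trans
            (ℕ.+-monoˡ-≤ t (ℕ.≤-trans (ℕ.<⇒≤ b<JL) JL≤6t)) (ℕ.≤-reflexive (ℕ.+-comm (6 ℕ.* t) t)))) m<H)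

  -- Complex linear forms

  ℚ[i] : Set
  ℚ[i] = ℚ × ℚ

  infixl 6 _⊕_
  infixl 7 _⊗_

  _⊕_ _⊗_ : ℚ[i] → ℚ[i] → ℚ[i]
  (a , b) ⊕ (c , d) = a + c , b + d
  (a , b) ⊗ (c , d) = a * c + - (b * d) , a * d + b * c

  ∥_∥² : ℚ[i] → ℚ
  ∥ a , b ∥² = a * a + b * b

  ∑ᶜ : ∀ {A : Set} → List A → (A → ℚ[i]) → ℚ[i]
  ∑ᶜ xs g = ∑ xs (λ x → proj₁ (g x)) , ∑ xs (λ x → proj₂ (g x))

  ∏ᶜ : ∀ {k} → (Fin k → ℚ[i]) → ℚ[i]
  ∏ᶜ = Tuple.foldr _⊗_ (1ℚ , 0ℚ)

  -- The bound is on components because clipping acts on components; squared moduli are then at most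
  -- 2.
  Small : ∀ {A : Set} → (A → ℚ[i]) → Set
  Small g = ∀ x → ∣ proj₁ (g x) ∣ ≤ 1ℚ × ∣ proj₂ (g x) ∣ ≤ 1ℚ

  module _ where
    open +-*-Solver

    ⊗-assoc : ∀ u v w → (u ⊗ v) ⊗ w ≡ u ⊗ (v ⊗ w)
    ⊗-assoc (a , b) (c , d) (e , f) = cong₂ _,_
      (solve 6 (λ a b c d e f → (a :* c :+ :- (b :* d)) :* e :+ :- ((a :* d :+ b :* c) :* f)
        := a :* (c :* e :+ :- (d :* f)) :+ :- (b :* (c :* f :+ d :* e))) refl a b c d e f)
      (solve 6 (λ a b c d e f → (a :* c :+ :- (b :* d)) :* f :+ (a :* d :+ b :* c) :* e
        := a :* (c :* f :+ d :* e) :+ b :* (c :* e :+ :- (d :* f))) refl a b c d e f)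

    ⊗-comm : ∀ u v → u ⊗ v ≡ v ⊗ u
    ⊗-comm (a , b) (c , d) = cong₂ _,_
      (solve 4 (λ a b c d → a :* c :+ :- (b :* d) := c :* a :+ :- (d :* b)) refl a b c d)
      (solve 4 (λ a b c d → a :* d :+ b :* c := c :* b :+ d :* a) refl a b c d)

    ⊗-identityˡ : ∀ u → (1ℚ , 0ℚ) ⊗ u ≡ u
    ⊗-identityˡ (a , b) = cong₂ _,_
      (solve 2 (λ a b → con 1ℚ :* a :+ :- (con 0ℚ :* b) := a) refl a b)
      (solve 2 (λ a b → con 1ℚ :* b :+ con 0ℚ :* a := b) refl a b)

    ∥⊗∥² : ∀ u v → ∥ u ⊗ v ∥² ≡ ∥ u ∥² * ∥ v ∥²
    ∥⊗∥² (a , b) (c , d) = solve 4 (λ a b c d →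
      (a :* c :+ :- (b :* d)) :* (a :* c :+ :- (b :* d)) :+ (a :* d :+ b :* c) :* (a :* d :+ b :* c)
        := (a :* a :+ b :* b) :* (c :* c :+ d :* d)) refl a b c d

    -- The factor `f` of the head coordinate joins the weight `p`.
    ⊗-swap : ∀ p f l r → p ⊗ (l ⊗ (f ⊗ r)) ≡ (p ⊗ f) ⊗ (l ⊗ r)
    ⊗-swap p f l r = trans (cong (p ⊗_)
        (trans (sym (⊗-assoc l f r)) (trans (cong (_⊗ r) (⊗-comm l f)) (⊗-assoc f l r))))
      (sym (⊗-assoc p f (l ⊗ r)))

    -- In `l ⊗ f` everything is collected that depends on the isolated coordinate.
    ⊗-isolate : ∀ p f l r → p ⊗ (l ⊗ (f ⊗ r)) ≡ (p ⊗ r) ⊗ (l ⊗ f)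
    ⊗-isolate p f l r = trans (cong (λ z → p ⊗ (l ⊗ z)) (⊗-comm f r)) (⊗-swap p r l f)

  0≤∥∥² : ∀ z → 0ℚ ≤ ∥ z ∥²
  0≤∥∥² (a , b) = +-nonNeg (0≤² a) (0≤² b)

  ∥∥²≤2 : ∀ {A : Set} {g : A → ℚ[i]} → Small g → ∀ x → ∥ g x ∥² ≤ ι 2
  ∥∥²≤2 {g = g} small x = ℚ.+-mono-≤ (square _ (proj₁ (small x))) (square _ (proj₂ (small x)))
    where
    square : ∀ a → ∣ a ∣ ≤ 1ℚ → a * a ≤ 1ℚ
    square a le = subst (_≤ 1ℚ) (∣²∣ a) (*-mono-≤ (ℚ.0≤∣p∣ a) (ℚ.nonNegative⁻¹ 1ℚ) le le)

  module _ {A : Set} where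

    ∑ᶜ-cong : ∀ (xs : List A) {g h : A → ℚ[i]} → (∀ x → g x ≡ h x) → ∑ᶜ xs g ≡ ∑ᶜ xs h
    ∑ᶜ-cong xs eq = cong₂ _,_ (∑-cong xs (λ x → cong proj₁ (eq x))) (∑-cong xs (λ x → cong proj₂ (eq x)))

    ∑ᶜ-*ˡ : ∀ c (xs : List A) (g : A → ℚ[i]) → ∑ᶜ xs (λ x → c ⊗ g x) ≡ c ⊗ ∑ᶜ xs g
    ∑ᶜ-*ˡ (a , b) xs g = cong₂ _,_
      (trans (∑-+ xs _ _) (cong₂ _+_ (∑-*ˡ a xs _) (trans (∑-neg xs _) (cong -_ (∑-*ˡ b xs _)))))
      (trans (∑-+ xs _ _) (cong₂ _+_ (∑-*ˡ a xs _) (∑-*ˡ b xs _)))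

    ∥∑∥² : ∀ (xs : List A) (g : A → ℚ[i]) → ∥ ∑ᶜ xs g ∥² ≤ ι (length xs) * ∑ xs (λ x → ∥ g x ∥²)
    ∥∑∥² xs g = ℚ.≤-trans (ℚ.+-mono-≤ (cauchy-schwarz xs (λ x → proj₁ (g x))) (cauchy-schwarz xs (λ x → proj₂ (g x))))
      (ℚ.≤-reflexive (trans (sym (ℚ.*-distribˡ-+ (ι (length xs)) (∑ xs (λ x → proj₁ (g x) ²))
          (∑ xs (λ x → proj₂ (g x) ²))))
        (cong (ι (length xs) *_) (sym (∑-+ xs (λ x → proj₁ (g x) ²) (λ x → proj₂ (g x) ²))))))

  ∑ᶜ-swap : ∀ {A C : Set} (xs : List A) (ys : List C) (g : A → C → ℚ[i]) →
    ∑ᶜ xs (λ x → ∑ᶜ ys (g x)) ≡ ∑ᶜ ys (λ y → ∑ᶜ xs (λ x → g x y))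
  ∑ᶜ-swap xs ys g = cong₂ _,_ (∑-swap xs ys _) (∑-swap xs ys _)

  ∑ᶜ-product : ∀ {A C D : Set} (f : A → C → D) (xs : List A) (ys : List C) (g : D → ℚ[i]) →
    ∑ᶜ (cartesianProductWith f xs ys) g ≡ ∑ᶜ xs (λ x → ∑ᶜ ys (λ y → g (f x y)))
  ∑ᶜ-product f xs ys g = cong₂ _,_ (∑-product f xs ys _) (∑-product f xs ys _)

  infixr 9 _^^_
  _^^_ : ℚ → ℕ → ℚ
  c ^^ zero = 1ℚ
  c ^^ suc k = c * c ^^ k

  ^^-nonNeg : ∀ {c} → 0ℚ ≤ c → ∀ k → 0ℚ ≤ c ^^ k
  ^^-nonNeg 0≤c zero = ℚ.nonNegative⁻¹ 1ℚ
  ^^-nonNeg 0≤c (suc k) = *-nonNeg 0≤c (^^-nonNeg 0≤c k)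

  length-tuples : ∀ {A : Set} (xs : List A) k → ι (length (tuples xs k)) ≡ ι (length xs) ^^ k
  length-tuples xs zero = refl
  length-tuples {A} xs (suc k) = begin
    ι (length (tuples xs (suc k)))             ≡⟨ sym (trans (∑-const (tuples xs (suc k)) 1ℚ) (ℚ.*-identityʳ _)) ⟩
    ∑ (tuples xs (suc k)) (λ _ → 1ℚ)           ≡⟨ ∑-product _∷_ xs (tuples xs k) _ ⟩
    ∑ xs (λ _ → ∑ (tuples xs k) (λ _ → 1ℚ))    ≡⟨ ∑-const xs _ ⟩
    ι (length xs) * ∑ (tuples xs k) (λ _ → 1ℚ) ≡⟨ cong (ι (length xs) *_) (trans (∑-const (tuples xs k) 1ℚ)
                                                   (trans (ℚ.*-identityʳ _) (length-tuples xs k))) ⟩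
    ι (length xs) * ι (length xs) ^^ k         ∎
    where open ≡-Reasoning

  ∥∏∥² : ∀ {k} {v : Fin k → ℚ[i]} → (∀ j → ∥ v j ∥² ≤ ι 2) → ∥ ∏ᶜ v ∥² ≤ ι 2 ^^ k
  ∥∏∥² {zero} le = ℚ.≤-refl
  ∥∏∥² {suc k} {v} le = ℚ.≤-trans (ℚ.≤-reflexive (∥⊗∥² (v Fin.zero) _))
    (*-mono-≤ (0≤∥∥² (v Fin.zero)) (^^-nonNeg (0≤fromℕ 2) k) (le Fin.zero) (∥∏∥² (λ j → le (Fin.suc j))))

  *-^^ : ∀ a b k → (a * b) ^^ k ≡ a ^^ k * b ^^ k
  *-^^ a b zero = refl
  *-^^ a b (suc k) = trans (cong (a * b *_) (*-^^ a b k))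
    (solve 4 (λ a b c d → a :* b :* (c :* d) := a :* c :* (b :* d)) refl a b (a ^^ k) (b ^^ k))
    where open +-*-Solver

  -- All factors but the i-th are bounded trivially.
  module _ {O : Set} (xs : List ℤ) (Ω : List O) (s : ℚ) (0≤s : 0ℚ ≤ s) (Z : ℚ) (0≤Z : 0ℚ ≤ Z) where

    private
      l = ι (length xs)
      -- The price of one discarded coordinate: 2 bounds its factor, and Cauchy-Schwarz over the
      -- coordinate followed by summation gives l².
      r = ι 2 * (l * l)

      0≤l : 0ℚ ≤ l
      0≤l = 0≤fromℕ (length xs)

      0≤r : 0ℚ ≤ r
      0≤r = *-nonNeg (0≤fromℕ 2) (*-nonNeg 0≤l 0≤l)

    isolate-factor : ∀ {k} (i : Fin (suc k)) (F : Fin (suc k) → ℤ → O → ℚ[i]) →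
      (∀ j b ω → ∥ F j b ω ∥² ≤ ι 2) →
      (∀ (w : ℤ → ℚ[i]) → Small w → s * ∑ Ω (λ ω → ∥ ∑ᶜ xs (λ b → w b ⊗ F i b ω) ∥²) ≤ Z) →
      (Λ : Vec ℤ (suc k) → ℚ[i]) → Small Λ → (p : O → ℚ[i]) (K : ℚ) → 0ℚ ≤ K → (∀ ω → ∥ p ω ∥² ≤ K) →
      s * ∥ ∑ᶜ (tuples xs (suc k)) (λ v → ∑ᶜ Ω (λ ω → p ω ⊗ (Λ v ⊗ ∏ᶜ (λ j → F j (lookup v j) ω)))) ∥² ≤
      K * r ^^ k * (ι (length Ω) * Z)
    -- For a fixed tail `v` the coefficients `Λ (b ∷ v)` are admissible weights in `b`, while the
    -- other factors and `p` depend on `ω` only. Cauchy-Schwarz over the tails and over `Ω` leaves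
    -- the energy bounded by `form≤Z`.
    isolate-factor {k} Fin.zero F F≤2 form≤Z Λ small p K 0≤K p≤K = begin
      s * ∥ ∑ᶜ (tuples xs (suc k)) (λ v → ∑ᶜ Ω (λ ω → p ω ⊗ (Λ v ⊗ ∏ᶜ (λ j → F j (lookup v j) ω)))) ∥²
        ≡⟨ cong (λ z → s * ∥ z ∥²) (trans (∑ᶜ-product _∷_ xs vs _) (trans (∑ᶜ-swap xs vs _)
             (∑ᶜ-cong vs λ v → trans (∑ᶜ-swap xs Ω _) (∑ᶜ-cong Ω λ ω →
               trans (∑ᶜ-cong xs λ b → ⊗-isolate (p ω) (F Fin.zero b ω) (Λ (b ∷ v)) (rest v ω))
                   (∑ᶜ-*ˡ (p ω ⊗ rest v ω) xs _))))) ⟩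
      s * ∥ ∑ᶜ vs (λ v → ∑ᶜ Ω (term v)) ∥²
        ≤⟨ *-monoʳ-≤ 0≤s (∥∑∥² vs _) ⟩
      s * (ι (length vs) * ∑ vs (λ v → ∥ ∑ᶜ Ω (term v) ∥²))
        ≡⟨ trans (solve 3 (λ s n t → s :* (n :* t) := n :* (s :* t)) refl s (ι (length vs))
            (∑ vs (λ v → ∥ ∑ᶜ Ω (term v) ∥²)))
             (cong (ι (length vs) *_) (sym (∑-*ˡ s vs _))) ⟩
      ι (length vs) * ∑ vs (λ v → s * ∥ ∑ᶜ Ω (term v) ∥²)
        ≤⟨ ℚ.*-monoˡ-≤-nonNeg (ι (length vs)) (∑-bound vs _ (λ {v} _ → each v)) ⟩
      ι (length vs) * (ι (length vs) * (K * ι 2 ^^ k * (ι (length Ω) * Z)))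
        ≡⟨ cong (λ n → n * (n * (K * ι 2 ^^ k * (ι (length Ω) * Z)))) (length-tuples xs k) ⟩
      l ^^ k * (l ^^ k * (K * ι 2 ^^ k * (ι (length Ω) * Z)))
        ≡⟨ solve 4 (λ a K b c → a :* (a :* (K :* b :* c)) := K :* (b :* (a :* a)) :* c) refl (l ^^ k) K (ι 2 ^^ k)
            (ι (length Ω) * Z) ⟩
      K * (ι 2 ^^ k * (l ^^ k * l ^^ k)) * (ι (length Ω) * Z)
        ≡⟨ cong (λ z → K * z * (ι (length Ω) * Z))
            (sym (trans (*-^^ (ι 2) (l * l) k) (cong (ι 2 ^^ k *_) (*-^^ l l k)))) ⟩
      K * r ^^ k * (ι (length Ω) * Z) ∎
      where
      open ℚ.≤-Reasoning
      open +-*-Solver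
      vs = tuples xs k
      rest : Vec ℤ k → O → ℚ[i]
      rest v ω = ∏ᶜ (λ j → F (Fin.suc j) (lookup v j) ω)
      form : Vec ℤ k → O → ℚ[i]
      form v ω = ∑ᶜ xs (λ b → Λ (b ∷ v) ⊗ F Fin.zero b ω)
      term : Vec ℤ k → O → ℚ[i]
      term v ω = (p ω ⊗ rest v ω) ⊗ form v ω
      each : ∀ v → s * ∥ ∑ᶜ Ω (term v) ∥² ≤ K * ι 2 ^^ k * (ι (length Ω) * Z)
      each v = begin
        s * ∥ ∑ᶜ Ω (term v) ∥²                                   ≤⟨ *-monoʳ-≤ 0≤s (∥∑∥² Ω (term v)) ⟩
        s * (ι (length Ω) * ∑ Ω (λ ω → ∥ term v ω ∥²))
          ≤⟨ *-monoʳ-≤ 0≤s (ℚ.*-monoˡ-≤-nonNeg (ι (length Ω)) (∑-mono Ω λ ω →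
               ℚ.≤-trans (ℚ.≤-reflexive (trans (∥⊗∥² (p ω ⊗ rest v ω) (form v ω))
                   (cong (_* ∥ form v ω ∥²) (∥⊗∥² (p ω) (rest v ω)))))
                 (ℚ.*-monoʳ-≤-nonNeg ∥ form v ω ∥² {{ℚ.nonNegative (0≤∥∥² (form v ω))}}
                   (*-mono-≤ (0≤∥∥² (p ω)) (^^-nonNeg (0≤fromℕ 2) k) (p≤K ω) (∥∏∥² (λ j → F≤2 (Fin.suc j) _ ω)))))) ⟩
        s * (ι (length Ω) * ∑ Ω (λ ω → K * ι 2 ^^ k * ∥ form v ω ∥²))
          ≡⟨ cong (λ z → s * (ι (length Ω) * z)) (∑-*ˡ (K * ι 2 ^^ k) Ω _) ⟩
        s * (ι (length Ω) * (K * ι 2 ^^ k * ∑ Ω (λ ω → ∥ form v ω ∥²)))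
          ≡⟨ solve 4 (λ s n K t → s :* (n :* (K :* t)) := K :* (n :* (s :* t))) refl s (ι (length Ω)) (K * ι 2 ^^ k)
              (∑ Ω (λ ω → ∥ form v ω ∥²)) ⟩
        K * ι 2 ^^ k * (ι (length Ω) * (s * ∑ Ω (λ ω → ∥ form v ω ∥²)))
          ≤⟨ *-monoʳ-≤ (*-nonNeg 0≤K (^^-nonNeg (0≤fromℕ 2) k))
               (ℚ.*-monoˡ-≤-nonNeg (ι (length Ω)) (form≤Z (λ b → Λ (b ∷ v)) (λ b → small (b ∷ v)))) ⟩
        K * ι 2 ^^ k * (ι (length Ω) * Z) ∎
    -- Cauchy-Schwarz over the head `b`; its factor moves into `p`, and `K` doubles. The induction
    -- therefore needs an arbitrary weight `p`.
    isolate-factor {suc k} (Fin.suc i) F F≤2 form≤Z Λ small p K 0≤K p≤K = begin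
      s * ∥ ∑ᶜ (tuples xs (suc (suc k))) (λ v → ∑ᶜ Ω (λ ω → p ω ⊗ (Λ v ⊗ ∏ᶜ (λ j → F j (lookup v j) ω)))) ∥²
        ≡⟨ cong (λ z → s * ∥ z ∥²) (trans (∑ᶜ-product _∷_ xs vs _) (∑ᶜ-cong xs λ b → ∑ᶜ-cong vs λ v → ∑ᶜ-cong Ω λ ω →
             ⊗-swap (p ω) (F Fin.zero b ω) (Λ (b ∷ v)) (∏ᶜ (λ j → F (Fin.suc j) (lookup v j) ω)))) ⟩
      s * ∥ ∑ᶜ xs term ∥²
        ≤⟨ *-monoʳ-≤ 0≤s (∥∑∥² xs term) ⟩
      s * (l * ∑ xs (λ b → ∥ term b ∥²))
        ≡⟨ trans (solve 3 (λ s n t → s :* (n :* t) := n :* (s :* t)) refl s l (∑ xs (λ b → ∥ term b ∥²)))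
            (cong (l *_) (sym (∑-*ˡ s xs _))) ⟩
      l * ∑ xs (λ b → s * ∥ term b ∥²)
        ≤⟨ *-monoʳ-≤ 0≤l (∑-bound xs _ (λ {b} _ → each b)) ⟩
      l * (l * (K * ι 2 * r ^^ k * (ι (length Ω) * Z)))
        ≡⟨ solve 4 (λ l K a b → l :* (l :* (K :* con (ι 2) :* a :* b)) := K :* (con (ι 2) :* (l :* l) :* a) :* b) refl l
            K (r ^^ k) (ι (length Ω) * Z) ⟩
      K * r ^^ suc k * (ι (length Ω) * Z) ∎
      where
      open ℚ.≤-Reasoning
      open +-*-Solver
      vs = tuples xs (suc k)
      term : ℤ → ℚ[i]
      term b = ∑ᶜ vs (λ v → ∑ᶜ Ω (λ ω → (p ω ⊗ F Fin.zero b ω) ⊗ (Λ (b ∷ v) ⊗ ∏ᶜ (λ j → F (Fin.suc j) (lookup v j) ω))))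
      each : ∀ b → s * ∥ term b ∥² ≤ K * ι 2 * r ^^ k * (ι (length Ω) * Z)
      each b = isolate-factor i (λ j → F (Fin.suc j)) (λ j → F≤2 (Fin.suc j)) form≤Z (λ v → Λ (b ∷ v))
          (λ v → small (b ∷ v))
        (λ ω → p ω ⊗ F Fin.zero b ω) (K * ι 2) (*-nonNeg 0≤K (0≤fromℕ 2))
        (λ ω → ℚ.≤-trans (ℚ.≤-reflexive (∥⊗∥² (p ω) (F Fin.zero b ω)))
            (*-mono-≤ (0≤∥∥² (p ω)) (0≤fromℕ 2) (p≤K ω) (F≤2 Fin.zero b ω)))

  -- Upper bound for the count when progression sums are small

  ^^-mono : ∀ {a b} k → 0ℚ ≤ a → a ≤ b → a ^^ k ≤ b ^^ k
  ^^-mono zero _ _ = ℚ.≤-refl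
  ^^-mono (suc k) 0≤a a≤b = *-mono-≤ 0≤a (^^-nonNeg (ℚ.≤-trans 0≤a a≤b) k) a≤b (^^-mono k 0≤a a≤b)

  module _ {n H t P q : ℕ} {k : ℕ} (0<P : 0 ℕ.< P) (q-large : 7 ℕ.* ((12 ℕ.* (P ℕ.* P)) ℕ.* (12 ℕ.* (P ℕ.* P))) ℕ.≤ q)
      (H-large : q ℕ.* q ℕ.* (12 ℕ.* (P ℕ.* P)) ℕ.≤ H) (t-large : q ℕ.* q ℕ.* (12 ℕ.* (P ℕ.* P)) ℕ.≤ t)
      (n≤tH : n ℕ.≤ t ℕ.* H)
      (f : Fin (suc k) → ℤ → ℚ[i]) (f-small : ∀ j → Small (f j))
      (i : Fin (suc k)) (f-supported : ∀ {x} → x ∉ interval n → f i x ≡ (0ℚ , 0ℚ))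
      (M : ℚ) (M-small : M * ι (8 ℕ.* (q ℕ.* q ℕ.* (q ℕ.* q) ℕ.* (q ℕ.* q ℕ.* q))) ≤ ι n)
      (re-uniform : ∀ y g ℓ → 0 ℕ.< g → ∣ ∑< ℓ (λ j → proj₁ (f i (y ℤ.+ ℤ.+ j ℤ.* ℤ.+ g))) ∣ ≤ M)
      (im-uniform : ∀ y g ℓ → 0 ℕ.< g → ∣ ∑< ℓ (λ j → proj₂ (f i (y ℤ.+ ℤ.+ j ℤ.* ℤ.+ g))) ∣ ≤ M) where

    private
      -- The padded shifts are at most `6 t` in number and are recentred by `t`, so they have size
      -- at most `7 t`.
      T = n ℕ.+ 7 ℕ.* t ℕ.* H

      Ω = cartesianProduct (window T) (interval H)

      B = ι t * ι t * (ι n * ι H)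

      0≤B : 0ℚ ≤ B
      0≤B = *-nonNeg (0≤² (ι t)) (*-nonNeg (0≤fromℕ n) (0≤fromℕ H))

      form : (ℤ → ℚ) → (ℤ → ℚ) → ℕ → ℤ → ℚ
      form w φ m x = ∑ (window t) λ b → w b * φ (x ℤ.+ b ℤ.* ℤ.+ suc m)

      form-bound : ∀ (φ : ℤ → ℚ) → Bounded φ → (∀ {x} → x ∉ interval n → φ x ≡ 0ℚ) →
        (∀ y g ℓ → 0 ℕ.< g → ∣ ∑< ℓ (λ j → φ (y ℤ.+ ℤ.+ j ℤ.* ℤ.+ g)) ∣ ≤ M) →
        ∀ w → Bounded w → ι P * ∑< H (λ m → ∑ (window T) λ x → form w φ m x ²) ≤ ι 108 * B
      form-bound φ φ≤1 supp uni w w≤1 = subst (λ z → ι P * z ≤ ι 108 * B)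
        (∑-cong (downFrom H) λ m → ∑-cong (window T) λ x → cong _² (sym (∑-window t _)))
        (linear-form-bound n φ φ≤1 supp M uni 0<P q-large H-large t-large n≤tH M-small
          (λ b → w (ℤ.+ b ℤ.- ℤ.+ t)) (λ b → w≤1 _) ℕ.≤-refl)

      -- Real and imaginary parts of weights and function give four real forms a, b, c, d, and
      -- `(a - b)² + (c + d)²` is at most twice the sum of their squares; 864 is 2 times 4 times
      -- 108.
      complex-form-bound : ∀ (w : ℤ → ℚ[i]) → Small w →
        ι P * ∑ Ω (λ { (x , m) → ∥ ∑ᶜ (window t) (λ b → w b ⊗ f i (x ℤ.+ b ℤ.* m)) ∥² }) ≤ ι 864 * B
      complex-form-bound w small = begin
        ι P * ∑ Ω (λ { (x , m) → ∥ ∑ᶜ (window t) (λ b → w b ⊗ f i (x ℤ.+ b ℤ.* m)) ∥² })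
          ≡⟨ cong (ι P *_) (trans (∑-product _,_ (window T) (interval H) _)
              (trans (∑-swap (window T) (interval H) _) (∑-interval H _))) ⟩
        ι P * ∑< H (λ m → ∑ (window T) λ x → ∥ ∑ᶜ (window t) (λ b → w b ⊗ f i (x ℤ.+ b ℤ.* ℤ.+ suc m)) ∥²)
          ≤⟨ ℚ.*-monoˡ-≤-nonNeg (ι P) (∑-mono (downFrom H) λ m → ∑-mono (window T) λ x → parts m x) ⟩
        ι P * ∑< H (λ m → ∑ (window T) λ x → ι 2 * (a m x ² + b m x ² + (c m x ² + d m x ²)))
          ≡⟨ cong (ι P *_) (trans (∑-cong (downFrom H) λ m → trans (∑-*ˡ (ι 2) (window T) _)
              (cong (ι 2 *_) (four (window T) _ _ _ _)))
               (trans (∑-*ˡ (ι 2) (downFrom H) _) (cong (ι 2 *_) (four (downFrom H) _ _ _ _)))) ⟩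
        ι P * (ι 2 * (total a + total b + (total c + total d)))
          ≡⟨ solve 5 (λ p a b c d → p :* (con (ι 2) :* (a :+ b :+ (c :+ d))) := con (ι 2) :*
              (p :* a :+ p :* b :+ (p :* c :+ p :* d)))
               refl (ι P) (total a) (total b) (total c) (total d) ⟩
        ι 2 * (ι P * total a + ι P * total b + (ι P * total c + ι P * total d))
          ≤⟨ ℚ.*-monoˡ-≤-nonNeg (ι 2) (ℚ.+-mono-≤ (ℚ.+-mono-≤ (re w₁ s₁) (im w₂ s₂)) (ℚ.+-mono-≤ (im w₁ s₁) (re w₂ s₂)))
              ⟩
        ι 2 * (ι 108 * B + ι 108 * B + (ι 108 * B + ι 108 * B))
          ≡⟨ solve 1 (λ B → con (ι 2) :* (con (ι 108) :* B :+ con (ι 108) :* B :+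
              (con (ι 108) :* B :+ con (ι 108) :* B)) := con (ι 864) :* B) refl B ⟩
        ι 864 * B ∎
        where
        open ℚ.≤-Reasoning
        open +-*-Solver
        w₁ w₂ φ₁ φ₂ : ℤ → ℚ
        w₁ b = proj₁ (w b)
        w₂ b = proj₂ (w b)
        φ₁ x = proj₁ (f i x)
        φ₂ x = proj₂ (f i x)
        s₁ : Bounded w₁
        s₁ b = proj₁ (small b)
        s₂ : Bounded w₂
        s₂ b = proj₂ (small b)
        a b c d : ℕ → ℤ → ℚ
        a = form w₁ φ₁
        b = form w₂ φ₂
        c = form w₁ φ₂
        d = form w₂ φ₁
        total : (ℕ → ℤ → ℚ) → ℚ
        total g = ∑< H λ m → ∑ (window T) λ x → g m x ²
        re : ∀ w → Bounded w → ι P * total (form w φ₁) ≤ ι 108 * B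
        re = form-bound φ₁ (λ x → proj₁ (f-small i x)) (λ x∉ → cong proj₁ (f-supported x∉)) re-uniform
        im : ∀ w → Bounded w → ι P * total (form w φ₂) ≤ ι 108 * B
        im = form-bound φ₂ (λ x → proj₂ (f-small i x)) (λ x∉ → cong proj₂ (f-supported x∉)) im-uniform
        four : ∀ {A : Set} (xs : List A) (g h g′ h′ : A → ℚ) →
          ∑ xs (λ x → g x + h x + (g′ x + h′ x)) ≡ ∑ xs g + ∑ xs h + (∑ xs g′ + ∑ xs h′)
        four xs g h g′ h′ = trans (∑-+ xs _ _) (cong₂ _+_ (∑-+ xs g h) (∑-+ xs g′ h′))
        parts : ∀ m x → ∥ ∑ᶜ (window t) (λ b → w b ⊗ f i (x ℤ.+ b ℤ.* ℤ.+ suc m)) ∥² ≤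
          ι 2 * (a m x ² + b m x ² + (c m x ² + d m x ²))
        parts m x = subst (_≤ ι 2 * (a m x ² + b m x ² + (c m x ² + d m x ²)))
          (sym (cong₂ (λ u v → u ² + v ²) (∑-sub (window t) _ _) (∑-+ (window t) _ _)))
          (by-difference ((a m x + b m x) ² + (c m x - d m x) ²) (+-nonNeg (0≤² (a m x + b m x)) (0≤² (c m x - d m x)))
            (solve 4 (λ a b c d → ((a :- b) :* (a :- b) :+ (c :+ d) :* (c :+ d)) :+
                ((a :+ b) :* (a :+ b) :+ (c :- d) :* (c :- d))
              := con (ι 2) :* (a :* a :+ b :* b :+ (c :* c :+ d :* d))) refl (a m x) (b m x) (c m x) (d m x)))

    -- A coordinate ranges over `2 t + 1 ≤ 3 t` values, so its price in `isolate-factor` is at most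
    -- 2 times 9 t². Moreover `T ≤ 8 C n`, so `x` takes at most `17 C n` values, and 17 times 864 is
    -- 14688.
    counting-bound : ∀ {C} → 0 ℕ.< C → t ℕ.* H ℕ.≤ C ℕ.* n → (Λ : Vec ℤ (suc k) → ℚ[i]) → Small Λ →
      ι P * ∥ ∑ᶜ (tuples (window t) (suc k)) (λ v → Λ v ⊗ ∑ᶜ (window T) λ x → ∑ᶜ (interval H) λ m →
                ∏ᶜ λ j → f j (x ℤ.+ lookup v j ℤ.* m)) ∥² ≤
      ι 18 ^^ k * ι 14688 * ι C * (ι t ^^ suc k * (ι n * ι H)) ²
    counting-bound {C} 0<C tH≤Cn Λ small = begin
      ι P * ∥ ∑ᶜ vs (λ v → Λ v ⊗ ∑ᶜ (window T) λ x → ∑ᶜ (interval H) λ m → ∏ᶜ λ j → f j (x ℤ.+ lookup v j ℤ.* m)) ∥²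
        ≡⟨ cong (λ z → ι P * ∥ z ∥²) (∑ᶜ-cong vs λ v → sym (trans (∑ᶜ-cong Ω λ ω → ⊗-identityˡ _)
             (trans (∑ᶜ-*ˡ (Λ v) Ω _) (cong (Λ v ⊗_) (∑ᶜ-product _,_ (window T) (interval H) _))))) ⟩
      ι P * ∥ ∑ᶜ vs (λ v → ∑ᶜ Ω (λ ω → (1ℚ , 0ℚ) ⊗ (Λ v ⊗ ∏ᶜ (λ j → F j (lookup v j) ω)))) ∥²
        ≤⟨ isolate-factor (window t) Ω (ι P) (0≤fromℕ P) (ι 864 * B) (*-nonNeg (0≤fromℕ 864) 0≤B) i F
             (λ j b ω → ∥∥²≤2 (f-small j) _) complex-form-bound Λ small (λ _ → 1ℚ , 0ℚ) 1ℚ (ℚ.nonNegative⁻¹ 1ℚ)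
                 (λ _ → ℚ.≤-refl) ⟩
      1ℚ * r ^^ k * (ι (length Ω) * (ι 864 * B))
        ≤⟨ *-mono-≤ (subst (0ℚ ≤_) (sym (ℚ.*-identityˡ (r ^^ k))) (^^-nonNeg 0≤r k)) 0≤right
             (subst (_≤ (ι 18 * (ι t * ι t)) ^^ k) (sym (ℚ.*-identityˡ (r ^^ k))) (^^-mono k 0≤r r≤))
             (*-monoˡ-≤ (*-nonNeg (0≤fromℕ 864) 0≤B) Ω≤) ⟩
      (ι 18 * (ι t * ι t)) ^^ k * (ι 17 * ι C * (ι n * ι H) * (ι 864 * B))
        ≡⟨ cong (_* (ι 17 * ι C * (ι n * ι H) * (ι 864 * B)))
            (trans (*-^^ (ι 18) (ι t * ι t) k) (cong (ι 18 ^^ k *_) (*-^^ (ι t) (ι t) k))) ⟩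
      ι 18 ^^ k * (ι t ^^ k * ι t ^^ k) * (ι 17 * ι C * (ι n * ι H) * (ι 864 * B))
        ≡⟨ solve 6 (λ a u c t n h → a :* (u :* u) :*
            (con (ι 17) :* c :* (n :* h) :* (con (ι 864) :* (t :* t :* (n :* h))))
             := a :* con (ι 14688) :* c :* ((t :* u :* (n :* h)) :* (t :* u :* (n :* h)))) refl (ι 18 ^^ k) (ι t ^^ k)
                 (ι C) (ι t) (ι n) (ι H) ⟩
      ι 18 ^^ k * ι 14688 * ι C * (ι t ^^ suc k * (ι n * ι H)) ² ∎
      where
      open ℚ.≤-Reasoning
      open +-*-Solver
      vs = tuples (window t) (suc k)
      F : Fin (suc k) → ℤ → ℤ × ℤ → ℚ[i]
      F j b (x , m) = f j (x ℤ.+ b ℤ.* m)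
      r = ι 2 * (ι (length (window t)) * ι (length (window t)))
      0≤r : 0ℚ ≤ r
      0≤r = *-nonNeg (0≤fromℕ 2) (0≤² (ι (length (window t))))
      0<P′ : 0 ℕ.< 12 ℕ.* (P ℕ.* P)
      0<P′ = ℕ.*-mono-< {0} {12} ℕ.z<s (ℕ.*-mono-< 0<P 0<P)
      0<q : 0 ℕ.< q
      0<q = ℕ.<-≤-trans (ℕ.*-mono-< {0} {7} ℕ.z<s (ℕ.*-mono-< 0<P′ 0<P′)) q-large
      0<q²P′ : 0 ℕ.< q ℕ.* q ℕ.* (12 ℕ.* (P ℕ.* P))
      0<q²P′ = ℕ.*-mono-< (ℕ.*-mono-< 0<q 0<q) 0<P′
      0<t : 0 ℕ.< t
      0<t = ℕ.<-≤-trans 0<q²P′ t-large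
      0<n : 0 ℕ.< n
      0<n = ℕ.n≢0⇒n>0 λ { refl → ℕ.<⇒≱ (ℕ.*-mono-< 0<t (ℕ.<-≤-trans 0<q²P′ H-large))
        (subst (t ℕ.* H ℕ.≤_) (ℕ.*-zeroʳ C) tH≤Cn) }
      l≤ : ι (length (window t)) ≤ ι 3 * ι t
      l≤ = subst (ι (length (window t)) ≤_) (ι-* 3 t) (ι-mono (ℕ.≤-trans (ℕ.≤-reflexive (length-window t))
        (ℕ.≤-trans (ℕ.+-monoˡ-≤ (t ℕ.+ t) 0<t) (ℕ.≤-reflexive (triple t)))))
        where
        triple : ∀ t → t ℕ.+ (t ℕ.+ t) ≡ 3 ℕ.* t
        triple = ℕ-Ring.solve-∀
      r≤ : r ≤ ι 18 * (ι t * ι t)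
      r≤ = ℚ.≤-trans (ℚ.*-monoˡ-≤-nonNeg (ι 2)
          (*-mono-≤ (0≤fromℕ (length (window t))) (*-nonNeg (0≤fromℕ 3) (0≤fromℕ t)) l≤ l≤))
        (ℚ.≤-reflexive (solve 1 (λ t → con (ι 2) :* (con (ι 3) :* t :* (con (ι 3) :* t)) := con (ι 18) :* (t :* t)) refl
            (ι t)))
      length-Ω : ι (length Ω) ≡ ι (suc (T ℕ.+ T)) * ι H
      length-Ω = trans (sym (trans (∑-const Ω 1ℚ) (ℚ.*-identityʳ _))) (trans (∑-product _,_ (window T) (interval H) _)
        (trans (∑-const (window T) _) (cong₂ _*_ (cong ι (length-window T))
          (trans (∑-const (interval H) 1ℚ) (trans (ℚ.*-identityʳ _) (cong ι (length-interval H)))))))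
      T≤ : suc (T ℕ.+ T) ℕ.≤ 17 ℕ.* (C ℕ.* n)
      T≤ = ℕ.≤-trans (ℕ.+-mono-≤ 0<Cn (ℕ.+-mono-≤ T≤8 T≤8)) (ℕ.≤-reflexive (collect (C ℕ.* n)))
        where
        0<Cn : 0 ℕ.< C ℕ.* n
        0<Cn = ℕ.*-mono-< 0<C 0<n
        T≤8 : T ℕ.≤ 8 ℕ.* (C ℕ.* n)
        T≤8 = ℕ.+-mono-≤ (ℕ.m≤n*m n C {{ℕ.>-nonZero 0<C}})
            (ℕ.≤-trans (ℕ.≤-reflexive (ℕ.*-assoc 7 t H)) (ℕ.*-monoʳ-≤ 7 tH≤Cn))
        collect : ∀ c → c ℕ.+ (8 ℕ.* c ℕ.+ 8 ℕ.* c) ≡ 17 ℕ.* c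
        collect = ℕ-Ring.solve-∀
      Ω≤ : ι (length Ω) ≤ ι 17 * ι C * (ι n * ι H)
      Ω≤ = begin
        ι (length Ω)                    ≡⟨ length-Ω ⟩
        ι (suc (T ℕ.+ T)) * ι H         ≤⟨ ℚ.*-monoʳ-≤-nonNeg (ι H) (ι-mono T≤) ⟩
        ι (17 ℕ.* (C ℕ.* n)) * ι H      ≡⟨ cong (_* ι H) (trans (ι-* 17 (C ℕ.* n)) (cong (ι 17 *_) (ι-* C n))) ⟩
        ι 17 * (ι C * ι n) * ι H
          ≡⟨ solve 3 (λ c n h → con (ι 17) :* (c :* n) :* h := con (ι 17) :* c :* (n :* h)) refl (ι C) (ι n) (ι H) ⟩
        ι 17 * ι C * (ι n * ι H)        ∎
      0≤right : 0ℚ ≤ ι 17 * ι C * (ι n * ι H) * (ι 864 * B)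
      0≤right = *-nonNeg (*-nonNeg (*-nonNeg (0≤fromℕ 17) (0≤fromℕ C)) (*-nonNeg (0≤fromℕ n) (0≤fromℕ H)))
          (*-nonNeg (0≤fromℕ 864) 0≤B)

  -- Downward search from twice the ceiling of 1/a: the least multiple that reaches 2 overshoots by
  -- at most `a ≤ 1`.
  multiple-between : ∀ {a} → 0ℚ < a → a ≤ 1ℚ → ∃[ p ] ι 2 ≤ ι p * a × ι p * a ≤ ι 3
  multiple-between {a} 0<a a≤1 = search (2 ℕ.* Rational.ceil w) (begin
    ι 2
      ≡⟨ sym (trans (cong (ι 2 *_) (trans (ℚ.*-comm w a) (Rational.*-inv a 0<a))) (ℚ.*-identityʳ (ι 2))) ⟩
    ι 2 * (w * a)                ≤⟨ ℚ.*-monoˡ-≤-nonNeg (ι 2) (*-monoˡ-≤ (ℚ.<⇒≤ 0<a) (Rational.≤-ceil w)) ⟩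
    ι 2 * (ι (Rational.ceil w) * a)
      ≡⟨ trans (sym (ℚ.*-assoc (ι 2) (ι (Rational.ceil w)) a)) (cong (_* a) (sym (ι-* 2 (Rational.ceil w)))) ⟩
    ι (2 ℕ.* Rational.ceil w) * a ∎)
    where
    open ℚ.≤-Reasoning
    w = Rational.inv a 0<a
    search : ∀ m → ι 2 ≤ ι m * a → ∃[ p ] ι 2 ≤ ι p * a × ι p * a ≤ ι 3
    search zero le with () ← ι-cancel {2} {0} (subst (ι 2 ≤_) (ℚ.*-zeroˡ a) le)
    search (suc m) le with ι 2 ℚ.≤? ι m * a
    ... | yes le′ = search m le′
    ... | no ≰ = suc m , le , (begin
      ι (suc m) * a
        ≡⟨ trans (cong (_* a) (ι-suc m)) (trans (ℚ.*-distribʳ-+ a (ι m) 1ℚ) (cong (ι m * a +_) (ℚ.*-identityˡ a))) ⟩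
      ι m * a + a       ≤⟨ ℚ.+-mono-≤ (ℚ.<⇒≤ (ℚ.≰⇒> ≰)) a≤1 ⟩
      ι 2 + 1ℚ          ∎)

  -- Powers and explicit constants

  ι-^ : ∀ m k → ι (m ℕ.^ k) ≡ ι m ^^ k
  ι-^ m zero = refl
  ι-^ m (suc k) = trans (ι-* m (m ℕ.^ k)) (cong (ι m *_) (ι-^ m k))

  ^^-+ : ∀ a m k → a ^^ (m ℕ.+ k) ≡ a ^^ m * a ^^ k
  ^^-+ a zero k = sym (ℚ.*-identityˡ (a ^^ k))
  ^^-+ a (suc m) k = trans (cong (a *_) (^^-+ a m k)) (sym (ℚ.*-assoc a (a ^^ m) (a ^^ k)))

  ^^-^^ : ∀ a m k → (a ^^ m) ^^ k ≡ a ^^ (k ℕ.* m)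
  ^^-^^ a m zero = refl
  ^^-^^ a m (suc k) = trans (cong (a ^^ m *_) (^^-^^ a m k)) (sym (^^-+ a m (k ℕ.* m)))

  ^^-pos : ∀ {a} → 0ℚ < a → ∀ k → 0ℚ < a ^^ k
  ^^-pos 0<a zero = ℚ.positive⁻¹ 1ℚ
  ^^-pos 0<a (suc k) = Rational.*-pos 0<a (^^-pos 0<a k)

  1^^ : ∀ k → 1ℚ ^^ k ≡ 1ℚ
  1^^ zero = refl
  1^^ (suc k) = trans (ℚ.*-identityˡ _) (1^^ k)

  -- The definitions are opaque because normalising these numbers is infeasible.
  -- K is chosen so that P = K p² exceeds 16 κ V², where V = 2 p (2 C₁)^(k+1), and
  -- scale p = 8 q⁷ with q = 7 (12 P²)² is then a constant times p⁵⁶.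
  module Constants (k c₀ : ℕ) where

    -- The window of radius `C₁ n / H` has to contain all integers in [-C₀B, C₀B]; after clearing
    -- `H` and rounding this requires `c₀ (n + 1) + 1 ≤ C₁ n`. The constant of `counting-bound` for
    -- `C = C₁` is `κ`.
    C₁ κ : ℕ
    C₁ = 3 ℕ.* c₀
    κ = 18 ℕ.^ k ℕ.* 14688 ℕ.* C₁

    opaque

      -- Since `t ≤ 2 C₁ B`, this is the loss from replacing the `k + 1` factors `t` by `B`.
      E : ℕ
      E = (2 ℕ.* C₁) ℕ.^ suc k

      ι-E : ι E ≡ ι (2 ℕ.* C₁) ^^ suc k
      ι-E = ι-^ (2 ℕ.* C₁) (suc k)

    ι-loss : ∀ p → ι (2 ℕ.* p ℕ.* E) ≡ ι 2 * ι p * ι (2 ℕ.* C₁) ^^ suc k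
    ι-loss p = trans (ι-* (2 ℕ.* p) E) (cong₂ _*_ (ι-* 2 p) ι-E)

    opaque

      K : ℕ
      K = suc (64 ℕ.* κ ℕ.* (E ℕ.* E))

      K-def : K ≡ 1 ℕ.+ 64 ℕ.* κ ℕ.* (E ℕ.* E)
      K-def = refl

    0<K : 0 ℕ.< K
    0<K = ℕ.≤-trans (ℕ.s≤s ℕ.z≤n) (ℕ.≤-reflexive (sym K-def))

    largeP : ℕ → ℕ
    largeP p = K ℕ.* (p ℕ.* p)

    modulus : ℕ → ℕ
    modulus p = 7 ℕ.* ((12 ℕ.* (largeP p ℕ.* largeP p)) ℕ.* (12 ℕ.* (largeP p ℕ.* largeP p)))

    opaque

      scale : ℕ → ℕ
      scale p = 8 ℕ.* (modulus p ℕ.* modulus p ℕ.* (modulus p ℕ.* modulus p) ℕ.*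
          (modulus p ℕ.* modulus p ℕ.* modulus p))

      scale-def : ∀ p → scale p ≡ 8 ℕ.*
          (modulus p ℕ.* modulus p ℕ.* (modulus p ℕ.* modulus p) ℕ.* (modulus p ℕ.* modulus p ℕ.* modulus p))
      scale-def p = refl

    -- `modulus` is homogeneous of degree 8 in `p`, and `scale` has degree 7 in `modulus`.
    scale-power : ∀ p → ι (scale p) ≡ ι (scale 1) * ι p ^^ 56
    scale-power p = begin
      ι (scale p)                  ≡⟨ cong ι (trans (scale-def p)
                                        (trans (cong (λ q → 8 ℕ.* (q ℕ.* q ℕ.* (q ℕ.* q) ℕ.* (q ℕ.* q ℕ.* q)))
                                            (modulus-power K (p ℕ.* p)))
                                        (trans (seventh (modulus 1) r) (cong (ℕ._* r⁷) (sym (scale-def 1)))))) ⟩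
      ι (scale 1 ℕ.* r⁷)           ≡⟨ ι-* (scale 1) r⁷ ⟩
      ι (scale 1) * ι r⁷
        ≡⟨ cong (λ m → ι (scale 1) * ι m) (trans (^7 r) (trans (cong (ℕ._^ 7) (^8 p)) (ℕ.^-*-assoc p 8 7))) ⟩
      ι (scale 1) * ι (p ℕ.^ 56)   ≡⟨ cong (ι (scale 1) *_) (ι-^ p 56) ⟩
      ι (scale 1) * ι p ^^ 56      ∎
      where
      open ≡-Reasoning
      r r⁷ : ℕ
      r = p ℕ.* p ℕ.* (p ℕ.* p) ℕ.* (p ℕ.* p ℕ.* (p ℕ.* p))
      r⁷ = r ℕ.* r ℕ.* (r ℕ.* r) ℕ.* (r ℕ.* r ℕ.* r)
      modulus-power : ∀ K s → 7 ℕ.* ((12 ℕ.* (K ℕ.* s ℕ.* (K ℕ.* s))) ℕ.* (12 ℕ.* (K ℕ.* s ℕ.* (K ℕ.* s)))) ≡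
        7 ℕ.* ((12 ℕ.* (K ℕ.* 1 ℕ.* (K ℕ.* 1))) ℕ.* (12 ℕ.* (K ℕ.* 1 ℕ.* (K ℕ.* 1)))) ℕ.* (s ℕ.* s ℕ.* (s ℕ.* s))
      modulus-power = ℕ-Ring.solve-∀
      seventh : ∀ q r → 8 ℕ.* (q ℕ.* r ℕ.* (q ℕ.* r) ℕ.* (q ℕ.* r ℕ.* (q ℕ.* r)) ℕ.*
          (q ℕ.* r ℕ.* (q ℕ.* r) ℕ.* (q ℕ.* r))) ≡
        8 ℕ.* (q ℕ.* q ℕ.* (q ℕ.* q) ℕ.* (q ℕ.* q ℕ.* q)) ℕ.* (r ℕ.* r ℕ.* (r ℕ.* r) ℕ.* (r ℕ.* r ℕ.* r))
      seventh = ℕ-Ring.solve-∀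
      ^7 : ∀ r → r ℕ.* r ℕ.* (r ℕ.* r) ℕ.* (r ℕ.* r ℕ.* r) ≡ r ℕ.* (r ℕ.* (r ℕ.* (r ℕ.* (r ℕ.* (r ℕ.* (r ℕ.* 1))))))
      ^7 = ℕ-Ring.solve-∀
      ^8 : ∀ p → p ℕ.* p ℕ.* (p ℕ.* p) ℕ.* (p ℕ.* p ℕ.* (p ℕ.* p)) ≡ p ℕ.*
          (p ℕ.* (p ℕ.* (p ℕ.* (p ℕ.* (p ℕ.* (p ℕ.* (p ℕ.* 1)))))))
      ^8 = ℕ-Ring.solve-∀

    module _ {p : ℕ} (0<p : 0 ℕ.< p) where

      0<largeP : 0 ℕ.< largeP p
      0<largeP = ℕ.*-mono-< 0<K (ℕ.*-mono-< 0<p 0<p)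

      private
        P = largeP p
        q = modulus p
        P′ = 12 ℕ.* (P ℕ.* P)

        0<P′ : 0 ℕ.< P′
        0<P′ = ℕ.*-mono-< {0} {12} ℕ.z<s (ℕ.*-mono-< 0<largeP 0<largeP)

        P′≤q : P′ ℕ.≤ q
        P′≤q = ℕ.≤-trans (ℕ.m≤m*n P′ P′ {{ℕ.>-nonZero 0<P′}}) (ℕ.m≤n*m (P′ ℕ.* P′) 7)

        0<q : 0 ℕ.< q
        0<q = ℕ.<-≤-trans 0<P′ P′≤q

        q²P′≤scale : q ℕ.* q ℕ.* P′ ℕ.≤ scale p
        q²P′≤scale = ℕ.≤-trans (ℕ.*-monoʳ-≤ (q ℕ.* q) P′≤q) (ℕ.≤-trans
          (ℕ.m≤n*m (q ℕ.* q ℕ.* q) (q ℕ.* q ℕ.* (q ℕ.* q))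
              {{ℕ.>-nonZero (ℕ.*-mono-< (ℕ.*-mono-< 0<q 0<q) (ℕ.*-mono-< 0<q 0<q))}})
          (subst (q ℕ.* q ℕ.* (q ℕ.* q) ℕ.* (q ℕ.* q ℕ.* q) ℕ.≤_) (sym (scale-def p))
            (ℕ.m≤n*m (q ℕ.* q ℕ.* (q ℕ.* q) ℕ.* (q ℕ.* q ℕ.* q)) 8)))

      0<scale : 0 ℕ.< scale p
      0<scale = ℕ.<-≤-trans (ℕ.*-mono-< (ℕ.*-mono-< 0<q 0<q) 0<P′) q²P′≤scale

      module _ {n H : ℕ} (0<c₀ : 0 ℕ.< c₀) (H-large : scale p ℕ.≤ H) (n-large : H ℕ.* scale p ℕ.≤ n)
          .{{_ : ℕ.NonZero H}} where

        t : ℕ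
        t = (C₁ ℕ.* n) / H

        n≤C₁n : n ℕ.≤ C₁ ℕ.* n
        n≤C₁n = ℕ.m≤n*m n C₁ {{ℕ.>-nonZero (ℕ.*-mono-< {0} {3} ℕ.z<s 0<c₀)}}

        H≤n : H ℕ.≤ n
        H≤n = ℕ.≤-trans (ℕ.m≤m*n H (scale p) {{ℕ.>-nonZero 0<scale}}) n-large

        -- Rounding down `C₁ n / H` loses at most a factor 2, which `C₁ ≥ 3` compensates.
        n≤tH : n ℕ.≤ t ℕ.* H
        n≤tH = ℕ.*-cancelˡ-≤ 2 (ℕ.≤-trans (ℕ.≤-trans (ℕ.m≤m+n (2 ℕ.* n) n) (ℕ.≤-trans (ℕ.≤-reflexive (triple n))
          (ℕ.*-monoˡ-≤ n (ℕ.m≤m*n 3 c₀ {{ℕ.>-nonZero 0<c₀}}))))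
              (ℕ.≤-trans (m≤2[m/n]n (C₁ ℕ.* n) H (ℕ.≤-trans H≤n n≤C₁n))
          (ℕ.≤-reflexive (cong (t ℕ.* H ℕ.+_) (sym (ℕ.+-identityʳ (t ℕ.* H)))))))
          where
          triple : ∀ n → 2 ℕ.* n ℕ.+ n ≡ 3 ℕ.* n
          triple = ℕ-Ring.solve-∀

        scale≤t : scale p ℕ.≤ t
        scale≤t = subst (ℕ._≤ t) (m*n/n≡m (scale p) H) (/-monoˡ-≤ H (ℕ.≤-trans (ℕ.≤-reflexive (ℕ.*-comm (scale p) H))
          (ℕ.≤-trans n-large n≤C₁n)))

        volume : ℚ
        volume = ι t ^^ suc k * (ι n * ι H)

        0<volume : 0ℚ < volume
        0<volume = Rational.*-pos (^^-pos (0<ι (ℕ.<-≤-trans 0<scale scale≤t)) (suc k))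
          (Rational.*-pos (0<ι (ℕ.<-≤-trans 0<scale (ℕ.≤-trans H-large H≤n))) (0<ι (ℕ.<-≤-trans 0<scale H-large)))

        -- If `M * scale p ≤ n`, then `counting-bound` gives `P R ≤ κ U²`. Together with the lower
        -- bound `U² ≤ 16 V² R` this yields `P U² ≤ 16 κ V² U²`, which the choice of `P` excludes.
        large-progression-sum : (f : Fin (suc k) → ℤ → ℚ[i]) → (∀ j → Small (f j)) → (Λ : Vec ℤ (suc k) → ℚ[i]) → Small
            Λ →
          let T = n ℕ.+ 7 ℕ.* t ℕ.* H
              count = ∑ᶜ (tuples (window t) (suc k)) (λ v → Λ v ⊗ ∑ᶜ (window T) λ x → ∑ᶜ (interval H) λ m →
                        ∏ᶜ λ j → f j (x ℤ.+ lookup v j ℤ.* m))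
          in volume ² ≤ ι 16 * ι (2 ℕ.* p ℕ.* E) ² * ∥ count ∥² →
          (i : Fin (suc k)) → (∀ {x} → x ∉ interval n → f i x ≡ (0ℚ , 0ℚ)) → (M : ℚ) →
          (∀ y g ℓ → 0 ℕ.< g → ∣ ∑< ℓ (λ j → proj₁ (f i (y ℤ.+ ℤ.+ j ℤ.* ℤ.+ g))) ∣ ≤ M) →
          (∀ y g ℓ → 0 ℕ.< g → ∣ ∑< ℓ (λ j → proj₂ (f i (y ℤ.+ ℤ.+ j ℤ.* ℤ.+ g))) ∣ ≤ M) →
          ι n < M * ι (scale p)
        large-progression-sum f f-small Λ Λ-small lower i supp M re im = ℚ.≰⇒> λ M-small → ℚ.<-irrefl refl (begin-strict
          ι P * U ²                            ≤⟨ ℚ.*-monoˡ-≤-nonNeg (ι P) lower ⟩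
          ι P * (ι 16 * V ² * R)
            ≡⟨ solve 3 (λ p v r → p :* (con (ι 16) :* (v :* v) :* r) := con (ι 16) :* (v :* v) :* (p :* r)) refl (ι P) V
                R ⟩
          ι 16 * V ² * (ι P * R)               ≤⟨ *-monoʳ-≤ (*-nonNeg (0≤fromℕ 16) (0≤² V))
              (counting-bound {n} {H} {t} {P} {q} {k} 0<largeP ℕ.≤-refl (ℕ.≤-trans q²P′≤scale H-large)
                  (ℕ.≤-trans q²P′≤scale scale≤t) n≤tH
                f f-small i supp M (subst (λ s → M * ι s ≤ ι n) (scale-def p) M-small) re im
                    (ℕ.*-mono-< {0} {3} ℕ.z<s 0<c₀) (m/n*n≤m (C₁ ℕ.* n) H) Λ Λ-small) ⟩
          ι 16 * V ² * (ι 18 ^^ k * ι 14688 * ι C₁ * U ²)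
            ≡⟨ cong (λ z → ι 16 * V ² * (z * U ²)) (sym (trans (ι-* (18 ℕ.^ k ℕ.* 14688) C₁) (cong (_* ι C₁)
                 (trans (ι-* (18 ℕ.^ k) 14688) (cong (_* ι 14688) (ι-^ 18 k)))))) ⟩
          ι 16 * V ² * (ι κ * U ²)
            ≡⟨ trans (solve 3 (λ v c u → con (ι 16) :* (v :* v) :* (c :* (u :* u)) := con (ι 16) :* c :* (v :* v) :*
                (u :* u)) refl V (ι κ) U)
                                                    (cong (_* U ²) (sym ι-constant)) ⟩
          ι (16 ℕ.* κ ℕ.* (2 ℕ.* p ℕ.* E ℕ.* (2 ℕ.* p ℕ.* E))) * U ²
            <⟨ ℚ.*-monoˡ-<-pos (U ²) {{ℚ.positive (Rational.*-pos 0<volume 0<volume)}} (ι-strict P-large) ⟩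
          ι P * U ² ∎)
          where
          open ℚ.≤-Reasoning
          open +-*-Solver
          U = volume
          V = ι (2 ℕ.* p ℕ.* E)
          R = ∥ ∑ᶜ (tuples (window t) (suc k))
              (λ v → Λ v ⊗ ∑ᶜ (window (n ℕ.+ 7 ℕ.* t ℕ.* H)) λ x → ∑ᶜ (interval H) λ m →
                        ∏ᶜ λ j → f j (x ℤ.+ lookup v j ℤ.* m)) ∥²
          ι-constant : ι (16 ℕ.* κ ℕ.* (2 ℕ.* p ℕ.* E ℕ.* (2 ℕ.* p ℕ.* E))) ≡ ι 16 * ι κ * V ²
          ι-constant = trans (ι-* (16 ℕ.* κ) _) (cong₂ _*_ (ι-* 16 κ) (ι-* (2 ℕ.* p ℕ.* E) (2 ℕ.* p ℕ.* E)))
          ι-strict : ∀ {m n} → m ℕ.< n → ι m < ι n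
          ι-strict {m} m<n = ℚ.<-≤-trans (subst₂ _<_ (ℚ.+-identityʳ (ι m)) (sym (ι-suc m))
              (ℚ.+-monoʳ-< (ι m) (ℚ.positive⁻¹ 1ℚ))) (ι-mono m<n)
          P-large : 16 ℕ.* κ ℕ.* (2 ℕ.* p ℕ.* E ℕ.* (2 ℕ.* p ℕ.* E)) ℕ.< P
          P-large = ℕ.≤-trans (ℕ.+-monoˡ-≤ _ (ℕ.*-mono-< 0<p 0<p))
              (ℕ.≤-reflexive (trans (expand κ p E) (cong (ℕ._* (p ℕ.* p)) (sym K-def))))
            where
            expand : ∀ κ p E → p ℕ.* p ℕ.+ 16 ℕ.* κ ℕ.* (2 ℕ.* p ℕ.* E ℕ.* (2 ℕ.* p ℕ.* E)) ≡
                (1 ℕ.+ 64 ℕ.* κ ℕ.* (E ℕ.* E)) ℕ.* (p ℕ.* p)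
            expand = ℕ-Ring.solve-∀

  -- Inequalities between the approximations

  +-cancelʳ-≤ : ∀ {a b} c → a + c ≤ b + c → a ≤ b
  +-cancelʳ-≤ {a} {b} c le = subst₂ _≤_ (cancel a) (cancel b) (ℚ.+-monoˡ-≤ (- c) le)
    where
    open +-*-Solver
    cancel : ∀ a → a + c + - c ≡ a
    cancel a = solve 2 (λ a c → a :+ c :+ :- c := a) refl a c

  -- For `u = p`, all but one of the powers of δ cancel against `u ^^ e` at the cost of `4 ^^ e`;
  -- the last one beats the constants. The leading 4 is room for rounding when `n` and `H` are
  -- bounded below.
  scale-small : ∀ {δ u S K} e → 0ℚ ≤ δ → 0ℚ ≤ u → 0ℚ ≤ K → S ≡ K * u ^^ e → u * δ ≤ ι 4 → δ * (ι 4 * (ι 4 ^^ e * K)) ≤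
      1ℚ →
    ι 4 * (δ ^^ suc e * S) ≤ 1ℚ
  scale-small {δ} {u} {S} {K} e 0≤δ 0≤u 0≤K refl uδ≤4 small = begin
    ι 4 * (δ * δ ^^ e * (K * u ^^ e))
      ≡⟨ solve 4 (λ d x K u → con (ι 4) :* (d :* x :* (K :* u)) := d :* (con (ι 4) :* (u :* x :* K))) refl δ (δ ^^ e) K
          (u ^^ e) ⟩
    δ * (ι 4 * (u ^^ e * δ ^^ e * K))      ≡⟨ cong (λ z → δ * (ι 4 * (z * K))) (sym (*-^^ u δ e)) ⟩
    δ * (ι 4 * ((u * δ) ^^ e * K))         ≤⟨ *-monoʳ-≤ 0≤δ (ℚ.*-monoˡ-≤-nonNeg (ι 4)
        (*-monoˡ-≤ 0≤K (^^-mono e (*-nonNeg 0≤u 0≤δ) uδ≤4))) ⟩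
    δ * (ι 4 * (ι 4 ^^ e * K))             ≤⟨ small ⟩
    1ℚ                                     ∎
    where
    open ℚ.≤-Reasoning
    open +-*-Solver

  -- Here `x` is a power of δ and `y` its inverse, so `4 G ≤ y ≤ B + 1`. Multiplying by `H` gives
  -- `4 G H ≤ N + H ≤ n + 1 + H`, and `H ≤ H G` and `n + 1 ≤ 2 n` leave `3 G H ≤ 2 n`.
  n-is-large : ∀ {x y B N G H n} → 0 ℕ.< G → 0 ℕ.< n → 0ℚ ≤ y → x * y ≡ 1ℚ → ι 4 * (x * ι G) ≤ 1ℚ →
    y ≤ B + 1ℚ → B * ι H ≡ N → N ≤ ι (suc n) → H ℕ.* G ℕ.≤ n
  n-is-large {x} {y} {B} {N} {G} {H} {n} 0<G 0<n 0≤y xy≡1 small y≤ BH≡N N≤ = ℕ.*-cancelˡ-≤ 3 (ℕ.≤-trans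
    (ℕ.+-cancelʳ-≤ (H ℕ.* G) (3 ℕ.* (H ℕ.* G)) (2 ℕ.* n)
        (ℕ.≤-trans (ℕ.≤-reflexive (collect H G)) (ℕ.≤-trans (ι-cancel bound)
      (ℕ.+-mono-≤ (ℕ.≤-trans (ℕ.+-monoˡ-≤ n 0<n) (ℕ.≤-reflexive (double n))) (ℕ.m≤m*n H G {{ℕ.>-nonZero 0<G}})))))
    (ℕ.*-monoˡ-≤ n {2} {3} (ℕ.s≤s (ℕ.s≤s ℕ.z≤n))))
    where
    open ℚ.≤-Reasoning
    open +-*-Solver
    collect : ∀ H G → 3 ℕ.* (H ℕ.* G) ℕ.+ H ℕ.* G ≡ 4 ℕ.* G ℕ.* H
    collect = ℕ-Ring.solve-∀
    double : ∀ n → n ℕ.+ n ≡ 2 ℕ.* n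
    double = ℕ-Ring.solve-∀
    bound : ι (4 ℕ.* G ℕ.* H) ≤ ι (suc n ℕ.+ H)
    bound = begin
      ι (4 ℕ.* G ℕ.* H)
        ≡⟨ trans (ι-* (4 ℕ.* G) H) (cong (_* ι H)
            (trans (ι-* 4 G) (trans (sym (ℚ.*-identityʳ _)) (cong (ι 4 * ι G *_) (sym xy≡1))))) ⟩
      ι 4 * ι G * (x * y) * ι H
        ≡⟨ cong (_* ι H) (solve 3 (λ g x y → con (ι 4) :* g :* (x :* y) := con (ι 4) :* (x :* g) :* y) refl (ι G) x y) ⟩
      ι 4 * (x * ι G) * y * ι H     ≤⟨ ℚ.*-monoʳ-≤-nonNeg (ι H) (*-monoˡ-≤ 0≤y small) ⟩
      1ℚ * y * ι H                  ≤⟨ ℚ.*-monoʳ-≤-nonNeg (ι H) (ℚ.≤-trans (ℚ.≤-reflexive (ℚ.*-identityˡ y)) y≤) ⟩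
      (B + 1ℚ) * ι H                ≡⟨ solve 2 (λ b h → (b :+ con 1ℚ) :* h := b :* h :+ h) refl B (ι H) ⟩
      B * ι H + ι H                 ≤⟨ ℚ.+-monoˡ-≤ (ι H) (ℚ.≤-trans (ℚ.≤-reflexive BH≡N) N≤) ⟩
      ι (suc n) + ι H               ≡⟨ sym (ι-+ (suc n) H) ⟩
      ι (suc n ℕ.+ H)               ∎

  -- Multiplying the upper bound for `B` by `4 G H` gives `4 G N ≤ N H + G ≤ N H + 2 N G`, hence
  -- `2 G ≤ H`.
  H-is-large : ∀ {x B N ε G H} → ι 4 * (x * ι G) ≤ 1ℚ → B ≤ N * x + ε → ι 4 * (ε * ι H) ≡ 1ℚ →
    B * ι H ≡ N → 1ℚ ≤ ι 2 * N → G ℕ.≤ H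
  H-is-large {x} {B} {N} {ε} {G} {H} small B≤ 4εH≡1 BH≡N 1≤2N = ℕ.≤-trans (ℕ.m≤n*m G 2)
      (ι-cancel (*-cancel-pos N 0<N (begin
    N * ι (2 ℕ.* G)               ≡⟨ cong (N *_) (ι-* 2 G) ⟩
    N * (ι 2 * ι G)               ≤⟨ +-cancelʳ-≤ (ι 2 * N * ι G) bound ⟩
    N * ι H                       ∎)))
    where
    open ℚ.≤-Reasoning
    open +-*-Solver
    0<N : 0ℚ < N
    0<N = ℚ.*-cancelˡ-<-nonNeg (ι 2) (ℚ.<-≤-trans (ℚ.positive⁻¹ 1ℚ) 1≤2N)
    bound : N * (ι 2 * ι G) + ι 2 * N * ι G ≤ N * ι H + ι 2 * N * ι G
    bound = begin
      N * (ι 2 * ι G) + ι 2 * N * ι G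
        ≡⟨ solve 2 (λ n g → n :* (con (ι 2) :* g) :+ con (ι 2) :* n :* g := con (ι 4) :* g :* n) refl N (ι G) ⟩
      ι 4 * ι G * N                               ≡⟨ cong (ι 4 * ι G *_) (sym BH≡N) ⟩
      ι 4 * ι G * (B * ι H)
        ≤⟨ *-monoʳ-≤ (*-nonNeg (0≤fromℕ 4) (0≤fromℕ G)) (ℚ.*-monoʳ-≤-nonNeg (ι H) B≤) ⟩
      ι 4 * ι G * ((N * x + ε) * ι H)
        ≡⟨ solve 5 (λ g n x e h → con (ι 4) :* g :* ((n :* x :+ e) :* h) := n :* h :* (con (ι 4) :* (x :* g)) :+ g :*
            (con (ι 4) :* (e :* h)))
                                                       refl (ι G) N x ε (ι H) ⟩
      N * ι H * (ι 4 * (x * ι G)) + ι G * (ι 4 * (ε * ι H))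
        ≤⟨ ℚ.+-mono-≤ (*-monoʳ-≤ (*-nonNeg (ℚ.<⇒≤ 0<N) (0≤fromℕ H)) small)
             (ℚ.*-monoˡ-≤-nonNeg (ι G) (ℚ.≤-trans (ℚ.≤-reflexive 4εH≡1) 1≤2N)) ⟩
      N * ι H * 1ℚ + ι G * (ι 2 * N)
        ≡⟨ solve 3 (λ n h g → n :* h :* con 1ℚ :+ g :* (con (ι 2) :* n) := n :* h :+ con (ι 2) :* n :* g) refl N (ι H)
            (ι G) ⟩
      N * ι H + ι 2 * N * ι G                     ∎

  -- The lower bound on the count is turned into one free of `B` and δ: `N² / B` is `N H`, and a
  -- factor `p δ ≥ 1` is inserted. The shape `N * (N * 1ℚ)` is the unfolding of `N ^ 2`.
  volume-bound : ∀ {δ B N w s p n t H D} k → 1ℚ ≤ ι p * δ → ι t ≤ D * B → ι n ≤ ι 2 * N → w * B ≡ 1ℚ → B * ι H ≡ N →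
    δ * B ^^ k * (N * (N * 1ℚ) * w) ≤ s → 0ℚ ≤ D →
    ι t ^^ k * (ι n * ι H) ≤ ι 2 * ι p * D ^^ k * s
  volume-bound {δ} {B} {N} {w} {s} {p} {n} {t} {H} {D} k 1≤pδ t≤DB n≤2N wB≡1 BH≡N le 0≤D = begin
    ι t ^^ k * (ι n * ι H)                          ≡⟨ sym (ℚ.*-identityˡ _) ⟩
    1ℚ * (ι t ^^ k * (ι n * ι H))
      ≤⟨ *-mono-≤ (ℚ.nonNegative⁻¹ 1ℚ) (*-nonNeg (^^-nonNeg 0≤DB k) (*-nonNeg 0≤2N (0≤fromℕ H))) 1≤pδ
        (*-mono-≤ (^^-nonNeg (0≤fromℕ t) k) (*-nonNeg 0≤2N (0≤fromℕ H)) (^^-mono k (0≤fromℕ t) t≤DB)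
            (ℚ.*-monoʳ-≤-nonNeg (ι H) n≤2N)) ⟩
    ι p * δ * ((D * B) ^^ k * (ι 2 * N * ι H))      ≡⟨ cong (λ z → ι p * δ * (z * (ι 2 * N * ι H))) (*-^^ D B k) ⟩
    ι p * δ * (D ^^ k * B ^^ k * (ι 2 * N * ι H))
      ≡⟨ solve 6 (λ p d a b n h → p :* d :* (a :* b :* (con (ι 2) :* n :* h)) := con (ι 2) :* p :* a :*
          (d :* b :* (n :* h)))
                                                         refl (ι p) δ (D ^^ k) (B ^^ k) N (ι H) ⟩
    ι 2 * ι p * D ^^ k * (δ * B ^^ k * (N * ι H))   ≡⟨ cong (λ z → ι 2 * ι p * D ^^ k * (δ * B ^^ k * z)) NH≡ ⟩
    ι 2 * ι p * D ^^ k * (δ * B ^^ k * (N * (N * 1ℚ) * w))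
      ≤⟨ *-monoʳ-≤ (*-nonNeg (*-nonNeg (0≤fromℕ 2) (0≤fromℕ p)) (^^-nonNeg 0≤D k)) le ⟩
    ι 2 * ι p * D ^^ k * s                          ∎
    where
    open ℚ.≤-Reasoning
    open +-*-Solver
    0≤DB = ℚ.≤-trans (0≤fromℕ t) t≤DB
    0≤2N = ℚ.≤-trans (0≤fromℕ n) n≤2N
    NH≡ : N * ι H ≡ N * (N * 1ℚ) * w
    NH≡ = trans (cong (N *_) (trans (sym (ℚ.*-identityʳ (ι H))) (trans (cong (ι H *_) (sym wB≡1))
      (trans (solve 3 (λ h w b → h :* (w :* b) := b :* h :* w) refl (ι H) w B) (cong (_* w) BH≡N)))))
      (solve 2 (λ n w → n :* (n :* w) := n :* (n :* con 1ℚ) :* w) refl N w)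

  -- The tolerance `η` is U/(8V), so `7 U ≤ 8 V r`; this also rules out that the approximate root
  -- `r` is 0 by default. With `a² ≤ 2 a′² + 2 η²`, and likewise for `b`, squaring gives
  -- `49 U² ≤ 128 V² (a′² + b′²) + 4 U²`, and 45 is far above the 8 that suffices.
  count-bound : ∀ {U V r η a b a′ b′} → 0ℚ < U → U ≤ V * (r + η) → ι 8 * (V * η) ≡ U →
    r ≡ 0ℚ ⊎ r * r ≤ a * a + b * b → ∣ a - a′ ∣ ≤ η → ∣ b - b′ ∣ ≤ η →
    U ² ≤ ι 16 * V ² * ∥ a′ , b′ ∥²
  count-bound {U} {V} {r} {η} {a} {b} {a′} {b′} 0<U U≤ 8Vη≡U root a-close b-close = *-cancel-pos (ι 8)
      (ℚ.positive⁻¹ (ι 8)) (begin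
    ι 8 * U ²                                   ≤⟨ by-difference (ι 37 * U ²) (*-nonNeg (0≤fromℕ 37) (0≤² U))
                                                     (solve 1 (λ u → con (ι 8) :* (u :* u) :+ con (ι 37) :* (u :* u) :=
                                                         con (ι 45) :* (u :* u)) refl U) ⟩
    ι 45 * U ²                                  ≤⟨ +-cancelʳ-≤ (ι 4 * U ²) bound ⟩
    ι 128 * V ² * ∥ a′ , b′ ∥²
      ≡⟨ solve 2 (λ v z → con (ι 128) :* (v :* v) :* z := con (ι 8) :* (con (ι 16) :* (v :* v) :* z)) refl V ∥ a′ , b′
          ∥² ⟩
    ι 8 * (ι 16 * V ² * ∥ a′ , b′ ∥²)           ∎)
    where
    open ℚ.≤-Reasoning
    open +-*-Solver
    7U≤8Vr : ι 7 * U ≤ ι 8 * (V * r)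
    7U≤8Vr = +-cancelʳ-≤ U (begin
      ι 7 * U + U                   ≡⟨ solve 1 (λ u → con (ι 7) :* u :+ u := con (ι 8) :* u) refl U ⟩
      ι 8 * U                       ≤⟨ ℚ.*-monoˡ-≤-nonNeg (ι 8) U≤ ⟩
      ι 8 * (V * (r + η))
        ≡⟨ solve 3 (λ v r e → con (ι 8) :* (v :* (r :+ e)) := con (ι 8) :* (v :* r) :+ con (ι 8) :* (v :* e)) refl V r η
            ⟩
      ι 8 * (V * r) + ι 8 * (V * η) ≡⟨ cong (ι 8 * (V * r) +_) 8Vη≡U ⟩
      ι 8 * (V * r) + U             ∎)
    0<7U : 0ℚ < ι 7 * U
    0<7U = Rational.*-pos (ℚ.positive⁻¹ (ι 7)) 0<U
    r²≤ : r ≡ 0ℚ ⊎ r * r ≤ a * a + b * b → r * r ≤ a * a + b * b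
    r²≤ (inj₂ le) = le
    r²≤ (inj₁ refl) = contradiction (ℚ.<-≤-trans 0<7U (ℚ.≤-trans 7U≤8Vr (ℚ.≤-reflexive
      (solve 1 (λ v → con (ι 8) :* (v :* con 0ℚ) := con 0ℚ) refl V)))) (ℚ.<-irrefl refl)
    square : ∀ {c c′} → ∣ c - c′ ∣ ≤ η → c * c ≤ ι 2 * (c′ * c′) + ι 2 * (η * η)
    square {c} {c′} close = ℚ.≤-trans (by-difference ((c - ι 2 * c′) ²) (0≤² (c - ι 2 * c′))
        (solve 2 (λ c d → c :* c :+ (c :- con (ι 2) :* d) :* (c :- con (ι 2) :* d) := con (ι 2) :* (d :* d) :+ con (ι 2)
            :* ((c :- d) :* (c :- d))) refl c c′))
      (ℚ.+-monoʳ-≤ (ι 2 * (c′ * c′)) (ℚ.*-monoˡ-≤-nonNeg (ι 2) (subst (_≤ η * η) (∣²∣ (c - c′))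
        (*-mono-≤ (ℚ.0≤∣p∣ (c - c′)) (ℚ.≤-trans (ℚ.0≤∣p∣ (c - c′)) close) close close))))
    bound : ι 45 * U ² + ι 4 * U ² ≤ ι 128 * V ² * ∥ a′ , b′ ∥² + ι 4 * U ²
    bound = begin
      ι 45 * U ² + ι 4 * U ²
        ≡⟨ solve 1 (λ u → con (ι 45) :* (u :* u) :+ con (ι 4) :* (u :* u) := con (ι 7) :* u :* (con (ι 7) :* u)) refl U
            ⟩
      (ι 7 * U) ²
        ≤⟨ *-mono-≤ (ℚ.<⇒≤ 0<7U) (ℚ.≤-trans (ℚ.<⇒≤ 0<7U) 7U≤8Vr) 7U≤8Vr 7U≤8Vr ⟩
      (ι 8 * (V * r)) ²
        ≡⟨ solve 2 (λ v r → con (ι 8) :* (v :* r) :* (con (ι 8) :* (v :* r)) := con (ι 64) :* (v :* v) :* (r :* r)) refl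
            V r ⟩
      ι 64 * V ² * (r * r)                       ≤⟨ *-monoʳ-≤ (*-nonNeg (0≤fromℕ 64) (0≤² V))
                                                      (ℚ.≤-trans (r²≤ root) (ℚ.+-mono-≤ (square {a} a-close)
                                                          (square {b} b-close))) ⟩
      ι 64 * V ² * (ι 2 * (a′ * a′) + ι 2 * (η * η) + (ι 2 * (b′ * b′) + ι 2 * (η * η)))
        ≡⟨ solve 4 (λ v e c d → con (ι 64) :* (v :* v) :*
            (con (ι 2) :* (c :* c) :+ con (ι 2) :* (e :* e) :+ (con (ι 2) :* (d :* d) :+ con (ι 2) :* (e :* e)))
             := con (ι 128) :* (v :* v) :* (c :* c :+ d :* d) :+ con (ι 4) :*
                 ((con (ι 8) :* (v :* e)) :* (con (ι 8) :* (v :* e)))) refl V η a′ b′ ⟩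
      ι 128 * V ² * ∥ a′ , b′ ∥² + ι 4 * (ι 8 * (V * η)) ²
        ≡⟨ cong (λ z → ι 128 * V ² * ∥ a′ , b′ ∥² + ι 4 * z ²) 8Vη≡U ⟩
      ι 128 * V ² * ∥ a′ , b′ ∥² + ι 4 * U ²     ∎

  -- With `w` the inverse of `n`, the inequality `n < M G` reads `1 ≤ w M G`. Multiplied by
  -- `c x ≤ x` it gives `c x ≤ w M (x G) ≤ w M`.
  norm-bound : ∀ {c x G n M m w ε} → 0ℚ ≤ c → c ≤ 1ℚ → 0ℚ ≤ x → ι 4 * (x * ι G) ≤ 1ℚ → ι n < M * ι G → 0ℚ ≤ M →
    M ≤ m + ι n * ε → w * ι n ≡ 1ℚ → 0ℚ ≤ w → c * x ≤ m * w + ε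
  norm-bound {c} {x} {G} {n} {M} {m} {w} {ε} 0≤c c≤1 0≤x small n<MG 0≤M M≤ wn≡1 0≤w = begin
    c * x                     ≡⟨ trans (sym (ℚ.*-identityʳ (c * x))) (cong (c * x *_) (sym wn≡1)) ⟩
    c * x * (w * ι n)         ≤⟨ *-mono-≤ (*-nonNeg 0≤c 0≤x) (*-nonNeg 0≤w (*-nonNeg 0≤M (0≤fromℕ G)))
                                   (*-monoˡ-≤ 0≤x c≤1)
                                   (*-monoʳ-≤ 0≤w (ℚ.<⇒≤ n<MG)) ⟩
    1ℚ * x * (w * (M * ι G))
      ≡⟨ solve 4 (λ x w m g → con 1ℚ :* x :* (w :* (m :* g)) := m :* w :* (x :* g)) refl x w M (ι G) ⟩
    M * w * (x * ι G)         ≤⟨ *-mono-≤ (*-nonNeg 0≤M 0≤w) (ℚ.nonNegative⁻¹ 1ℚ) (*-monoˡ-≤ 0≤w M≤) xG≤1 ⟩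
    (m + ι n * ε) * w * 1ℚ
      ≡⟨ solve 4 (λ m n e w → (m :+ n :* e) :* w :* con 1ℚ := m :* w :+ w :* n :* e) refl m (ι n) ε w ⟩
    m * w + w * ι n * ε       ≡⟨ cong (m * w +_) (trans (cong (_* ε) wn≡1) (ℚ.*-identityˡ ε)) ⟩
    m * w + ε                 ∎
    where
    open ℚ.≤-Reasoning
    open +-*-Solver
    xG≤1 : x * ι G ≤ 1ℚ
    xG≤1 = ℚ.≤-trans (by-difference (ι 3 * (x * ι G)) (*-nonNeg (0≤fromℕ 3) (*-nonNeg 0≤x (0≤fromℕ G)))
      (solve 1 (λ a → a :+ con (ι 3) :* a := con (ι 4) :* a) refl (x * ι G))) small

open import Defs
open Rational using () renaming (fromℕ to ι)
open import Algebra.Bundles using (CommutativeMonoid)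
open import Data.Fin.Base as Fin using (Fin)
open import Data.Integer.Base as ℤ using (ℤ; +_; -[1+_])
import Data.Integer.Properties as ℤ
import Data.Integer.Tactic.RingSolver as ℤ-Ring
import Algebra.Properties.AbelianGroup ℤ.+-0-abelianGroup as ℤ-Group
open import Data.List.Base using (List; []; _∷_; map; upTo; downFrom; length)
open import Data.List.Membership.Propositional using (_∈_; _∉_)
open import Data.List.Membership.Propositional.Properties using
    (∈-deduplicate⁺; ∈-map⁺; ∈-map⁻; ∈-upTo⁺; ∈-upTo⁻; ∈-cartesianProductWith⁻; ∈-downFrom⁺; ∈-downFrom⁻; ∈-filter⁺;
        ∈-concatMap⁺)
open import Data.List.Membership.DecPropositional ℤ._≟_ using (_∈?_)
open import Data.List.Relation.Unary.Any using (here; there)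
open import Data.List.Relation.Unary.AllPairs using (_∷_; [])
open import Data.List.Relation.Unary.Unique.Propositional using (Unique)
open import Data.List.Relation.Unary.Unique.Propositional.Properties using
    (cartesianProductWith⁺; map⁺; upTo⁺; downFrom⁺)
open import Data.List.Relation.Unary.Unique.DecPropositional.Properties using (deduplicate-!)
open import Data.Nat.Base as ℕ using (ℕ; zero; suc; NonZero)
import Data.Nat.Properties as ℕ
open import Data.Product.Base using (Σ-syntax; ∃-syntax; _×_; _,_; proj₁; proj₂)
open import Data.Rational.Base as ℚ using (ℚ; 0ℚ; 1ℚ; ½)
import Data.Rational.Properties as ℚ
open import Data.Rational.Solver using (module +-*-Solver)
open import Data.Sum.Base using (inj₁; inj₂)
open import Data.Vec.Base using (Vec; []; _∷_; lookup)
import Data.List.Relation.Unary.All as ListAll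
import Data.Vec.Functional as Tuple
open import Data.Vec.Properties using (≡-dec; ∷-injective)
open import Data.Vec.Relation.Unary.All as VecAll using ([]; _∷_)
open import Relation.Binary.PropositionalEquality using (_≡_; refl; sym; trans; cong; cong₂; subst; subst₂)
open import Relation.Nullary using (¬_; Dec; yes; no; contradiction)
import Data.List.Relation.Unary.Any as Any
open import Data.List.Properties using (length-map; length-upTo)
open import Data.Nat.DivMod using (_/_; /-monoˡ-≤; m*n/n≡m; m/n*n≤m)
import Data.Nat.Tactic.RingSolver as ℕ-Ring
open Core using (ℚ[i]; window; interval; Small; _⊗_; _⊕_; ∑ᶜ; ∏ᶜ)

-- Real and complex numbers up to ≈

≈-pointwise : ∀ {x y} → (∀ n → seq x n ≡ seq y n) → x ≈ y
≈-pointwise {x} {y} eq = mk≈ λ ε 0<ε → 0 , λ n _ → subst (λ z → ℚ.∣ seq x n ℚ.- z ∣ ℚ.≤ ε) (eq n)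
  (subst (ℚ._≤ ε) (cong ℚ.∣_∣ (sym (ℚ.+-inverseʳ (seq x n)))) (ℚ.<⇒≤ 0<ε))

half-pos : ∀ {ε} → 0ℚ ℚ.< ε → 0ℚ ℚ.< ½ ℚ.* ε
half-pos = Rational.*-pos Rational.0<½

≈-sym : ∀ {x y} → x ≈ y → y ≈ x
≈-sym {x} {y} p = mk≈ λ ε 0<ε → weaken (λ n → subst (ℚ._≤ ε) (Rational.abs-sym (seq x n) (seq y n))) (≈-within p ε 0<ε)

≈-trans : ∀ {x y z} → x ≈ y → y ≈ z → x ≈ z
≈-trans {x} {y} {z} p q = mk≈ λ ε 0<ε → weaken
  (λ n (a , b) → subst (ℚ.∣ seq x n ℚ.- seq z n ∣ ℚ.≤_) (Rational.halves ε)
    (ℚ.≤-trans (Core.∣-∣-triangle (seq x n) (seq y n) (seq z n)) (ℚ.+-mono-≤ a b)))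
  (both (≈-within p (½ ℚ.* ε) (half-pos 0<ε)) (≈-within q (½ ℚ.* ε) (half-pos 0<ε)))

+-cong : ∀ {x x′ y y′} → x ≈ x′ → y ≈ y′ → x + y ≈ x′ + y′
+-cong {x} {x′} {y} {y′} p q = mk≈ λ ε 0<ε → weaken
  (λ n (a , b) → subst (ℚ.∣ (seq x n ℚ.+ seq y n) ℚ.- (seq x′ n ℚ.+ seq y′ n) ∣ ℚ.≤_) (Rational.halves ε)
    (Rational.+-close {seq x n} {seq x′ n} {seq y n} {seq y′ n} a b))
  (both (≈-within p (½ ℚ.* ε) (half-pos 0<ε)) (≈-within q (½ ℚ.* ε) (half-pos 0<ε)))

neg-cong : ∀ {x y} → x ≈ y → - x ≈ - y
neg-cong {x} {y} p = mk≈ λ ε 0<ε → weaken (λ n → Rational.neg-close {seq x n} {seq y n}) (≈-within p ε 0<ε)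

-null : ∀ {x y} → x ≈ y → x + - y ≈ 0ℝ
-null {x} {y} p = ≈-trans (+-cong {x} {y} { - y} { - y} p ≈-refl) (≈-pointwise (λ n → ℚ.+-inverseʳ (seq y n)))

null- : ∀ {x y} → x + - y ≈ 0ℝ → x ≈ y
null- {x} {y} p = ≈-trans (≈-pointwise {x} {(x + - y) + y}
    (λ n → solve 2 (λ a b → a := (a :+ :- b) :+ b) refl (seq x n) (seq y n)))
  (≈-trans (+-cong {x + - y} {0ℝ} {y} {y} p ≈-refl) (≈-pointwise (λ n → ℚ.+-identityˡ (seq y n))))
  where open +-*-Solver

*-cong : ∀ {x x′ y y′} → x ≈ x′ → y ≈ y′ → x * y ≈ x′ * y′
*-cong {x} {x′} {y} {y′} p q = null- {x * y} {x′ * y′} (≈-trans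
  (≈-pointwise {x * y + - (x′ * y′)} {x * (y + - y′) + (x + - x′) * y′} (λ n →
    solve 4 (λ a b c d → a :* c :+ :- (b :* d) := a :* (c :+ :- d) :+ (a :+ :- b) :* d) refl (seq x n) (seq x′ n)
        (seq y n) (seq y′ n)))
  (+-null {x * (y + - y′)} {(x + - x′) * y′} (*-nullʳ x (-null {y} {y′} q)) (*-nullˡ y′ (-null {x} {x′} p))))
  where open +-*-Solver

≈ᶜ-refl : ∀ {z} → z ≈ᶜ z
≈ᶜ-refl = ≈-refl , ≈-refl

≈ᶜ-sym : ∀ {z w} → z ≈ᶜ w → w ≈ᶜ z
≈ᶜ-sym (p , q) = ≈-sym p , ≈-sym q

≈ᶜ-trans : ∀ {z w v} → z ≈ᶜ w → w ≈ᶜ v → z ≈ᶜ v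
≈ᶜ-trans (p , q) (r , s) = ≈-trans p r , ≈-trans q s

+ᶜ-cong : ∀ {z z′ w w′} → z ≈ᶜ z′ → w ≈ᶜ w′ → z +ᶜ w ≈ᶜ z′ +ᶜ w′
+ᶜ-cong {z} {z′} {w} {w′} (p , q) (r , s) =
  +-cong {re z} {re z′} {re w} {re w′} p r , +-cong {im z} {im z′} {im w} {im w′} q s

*ᶜ-cong : ∀ {z z′ w w′} → z ≈ᶜ z′ → w ≈ᶜ w′ → z *ᶜ w ≈ᶜ z′ *ᶜ w′
*ᶜ-cong {z} {z′} {w} {w′} (p , q) (r , s) =
  +-cong {re z * re w} {re z′ * re w′} { - (im z * im w)} { - (im z′ * im w′)}
    (*-cong {re z} {re z′} {re w} {re w′} p r) (neg-cong (*-cong {im z} {im z′} {im w} {im w′} q s)) ,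
  +-cong {re z * im w} {re z′ * im w′} {im z * re w} {im z′ * re w′}
    (*-cong {re z} {re z′} {im w} {im w′} p s) (*-cong {im z} {im z′} {re w} {re w′} q r)

+ᶜ-commutativeMonoid : CommutativeMonoid _ _
+ᶜ-commutativeMonoid = record
  { Carrier = ℂ ; _≈_ = _≈ᶜ_ ; _∙_ = _+ᶜ_ ; ε = 0ᶜ
  ; isCommutativeMonoid = record
    { isMonoid = record
      { isSemigroup = record
        { isMagma = record
          { isEquivalence = record { refl = ≈ᶜ-refl ; sym = ≈ᶜ-sym ; trans = ≈ᶜ-trans }
          ; ∙-cong = +ᶜ-cong }
        ; assoc = λ z w v → ≈-pointwise (λ n → ℚ.+-assoc (seq (re z) n) (seq (re w) n) (seq (re v) n)) ,
                            ≈-pointwise (λ n → ℚ.+-assoc (seq (im z) n) (seq (im w) n) (seq (im v) n)) }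
      ; identity = (λ z → ≈-pointwise (λ n → ℚ.+-identityˡ (seq (re z) n)) , ≈-pointwise
          (λ n → ℚ.+-identityˡ (seq (im z) n))) ,
                   (λ z → ≈-pointwise (λ n → ℚ.+-identityʳ (seq (re z) n)) , ≈-pointwise
                       (λ n → ℚ.+-identityʳ (seq (im z) n))) }
    ; comm = λ z w → ≈-pointwise (λ n → ℚ.+-comm (seq (re z) n) (seq (re w) n)) ,
                     ≈-pointwise (λ n → ℚ.+-comm (seq (im z) n) (seq (im w) n)) } }

∑-congᶜ : ∀ {A : Set} (xs : List A) {g h : A → ℂ} → (∀ {a} → a ∈ xs → g a ≈ᶜ h a) → ∑ xs g ≈ᶜ ∑ xs h
∑-congᶜ [] eq = ≈ᶜ-refl
∑-congᶜ (x ∷ xs) eq = +ᶜ-cong (eq (here refl)) (∑-congᶜ xs (λ a∈ → eq (there a∈)))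

∏-congᶜ : ∀ {k} {v w : Fin k → ℂ} → (∀ i → v i ≈ᶜ w i) → ∏ v ≈ᶜ ∏ w
∏-congᶜ {zero} eq = ≈ᶜ-refl
∏-congᶜ {suc k} eq = *ᶜ-cong (eq Fin.zero) (∏-congᶜ (λ i → eq (Fin.suc i)))

-- Clipping does not change a 1-bounded function up to ≈, but bounds every approximation by 1.
clip : ℝ → ℝ
clip x = (x ⊔ - 1ℝ) ⊓ 1ℝ

∣clip∣≤1 : ∀ a → ℚ.∣ (a ℚ.⊔ (ℚ.- 1ℚ)) ℚ.⊓ 1ℚ ∣ ℚ.≤ 1ℚ
∣clip∣≤1 a = Rational.abs-≤ (ℚ.p⊓q≤q (a ℚ.⊔ (ℚ.- 1ℚ)) 1ℚ)
  (ℚ.neg-antimono-≤ {ℚ.- 1ℚ} (ℚ.⊓-glb (ℚ.p≤q⊔p a (ℚ.- 1ℚ)) (ℚ.*≤* ℤ.-≤+)))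

clip-close : ∀ {a ε} → 0ℚ ℚ.≤ ε → a ℚ.≤ 1ℚ ℚ.+ ε → ℚ.- a ℚ.≤ 1ℚ ℚ.+ ε →
  ℚ.∣ a ℚ.- (a ℚ.⊔ (ℚ.- 1ℚ)) ℚ.⊓ 1ℚ ∣ ℚ.≤ ε
clip-close {a} {ε} 0≤ε p q = Rational.close⁺ {a} {c} below above
  where
  c = (a ℚ.⊔ (ℚ.- 1ℚ)) ℚ.⊓ 1ℚ
  +ε : ∀ {b} → b ℚ.≤ b ℚ.+ ε
  +ε {b} = Core.by-difference ε 0≤ε refl
  below : a ℚ.≤ c ℚ.+ ε
  below with ℚ.⊓-sel (a ℚ.⊔ (ℚ.- 1ℚ)) 1ℚ
  ... | inj₁ eq = subst (λ z → a ℚ.≤ z ℚ.+ ε) (sym eq) (ℚ.≤-trans (ℚ.p≤p⊔q a (ℚ.- 1ℚ)) +ε)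
  ... | inj₂ eq = subst (λ z → a ℚ.≤ z ℚ.+ ε) (sym eq) p
  above : c ℚ.≤ a ℚ.+ ε
  above = ℚ.≤-trans (ℚ.p⊓q≤p (a ℚ.⊔ (ℚ.- 1ℚ)) 1ℚ) (ℚ.⊔-lub {a ℚ.+ ε} {a} {ℚ.- 1ℚ} +ε
    (subst₂ ℚ._≤_ (solve 2 (λ a ε → :- (con 1ℚ :+ ε) :+ ε := :- con 1ℚ) refl a ε)
      (solve 2 (λ a ε → :- (:- a) :+ ε := a :+ ε) refl a ε) (ℚ.+-monoˡ-≤ ε (ℚ.neg-antimono-≤ q))))
    where open +-*-Solver

-- 1/(ν+1) bounds the error of sqrtBelow ν.
component-≤ : ∀ ν {a b r s} → s ≡ a ℚ.* a ℚ.+ b ℚ.* b → Rational.sqrtBelow ν s ℚ.≤ r → ℚ.∣ a ∣ ℚ.≤ r ℚ.+ Rational.1/suc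
    ν
component-≤ ν {a} {b} {r} {s} refl √≤r = Core.²-cancel-≤ {b = r ℚ.+ h} 0≤r+h (begin
  ℚ.∣ a ∣ ℚ.* ℚ.∣ a ∣     ≡⟨ Core.∣²∣ a ⟩
  a ℚ.* a                  ≤⟨ Core.by-difference (b ℚ.* b) (Core.0≤² b) refl ⟩
  s                        <⟨ Rational.sqrtBelow-upper s ν ⟩
  (√s ℚ.+ h) ℚ.* (√s ℚ.+ h) ≤⟨ Rational.*-mono-≤ 0≤√s+h 0≤r+h (ℚ.+-monoˡ-≤ h √≤r) (ℚ.+-monoˡ-≤ h √≤r) ⟩
  (r ℚ.+ h) ℚ.* (r ℚ.+ h)   ∎)
  where
  open ℚ.≤-Reasoning
  h = Rational.1/suc ν
  √s = Rational.sqrtBelow ν s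
  0≤√s+h : 0ℚ ℚ.≤ √s ℚ.+ h
  0≤√s+h = Core.+-nonNeg (Rational.rootFrom-nonNeg s ν (suc (Rational.ceil s) ℕ.* suc ν)) (Rational.0≤1/suc ν)
  0≤r+h : 0ℚ ℚ.≤ r ℚ.+ h
  0≤r+h = ℚ.≤-trans 0≤√s+h (ℚ.+-monoˡ-≤ h √≤r)

-- Eventually the approximations of `a` have size at most 1 + ε: half of ε comes from the hypothesis
-- and half from the rounding of the root.
clip-≈ : ∀ a b → √ (a * a + b * b) ≤ 1ℝ → a ≈ clip a
clip-≈ a b le = mk≈ λ ε 0<ε → weaken
  (λ ν (p , q) →
    let bound : ℚ.∣ seq a ν ∣ ℚ.≤ 1ℚ ℚ.+ ε
        bound = ℚ.≤-trans (component-≤ ν {seq a ν} {seq b ν} refl p)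
            (ℚ.≤-trans (ℚ.≤-reflexive (ℚ.+-assoc 1ℚ (½ ℚ.* ε) _))
                  (ℚ.+-monoʳ-≤ 1ℚ (subst (½ ℚ.* ε ℚ.+ Rational.1/suc ν ℚ.≤_) (Rational.halves ε)
                      (ℚ.+-monoʳ-≤ (½ ℚ.* ε) q))))
    in clip-close (ℚ.<⇒≤ 0<ε) (ℚ.≤-trans (Rational.≤-abs (seq a ν)) bound)
         (ℚ.≤-trans (Rational.≤-abs (ℚ.- seq a ν)) (subst (ℚ._≤ 1ℚ ℚ.+ ε) (sym (ℚ.∣-p∣≡∣p∣ (seq a ν))) bound)))
  (both (≤-within le (½ ℚ.* ε) (half-pos 0<ε)) (Rational.archimedean (½ ℚ.* ε) (half-pos 0<ε)))

clipᶜ : ℂ → ℂ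
clipᶜ z = clip (re z) +i clip (im z)

clipᶜ-≈ : ∀ z → ∣ z ∣ ≤ 1ℝ → z ≈ᶜ clipᶜ z
clipᶜ-≈ z le = clip-≈ (re z) (im z) le , clip-≈ (im z) (re z) (mk≤ λ ε 0<ε → weaken
  (λ ν → subst (λ s → Rational.sqrtBelow ν s ℚ.≤ 1ℚ ℚ.+ ε) (ℚ.+-comm (seq (re z) ν ℚ.* seq (re z) ν) _))
      (≤-within le ε 0<ε))

-- Outside [n] the functions vanish only up to `≈`, but the rational argument needs approximations
-- that are exactly 0 there.
restrict : ∀ {P : Set} → Dec P → ℂ → ℂ
restrict (yes _) z = clipᶜ z
restrict (no _) z = 0ᶜ

-- The sequences of sums, products and negatives are computed termwise, so value ν commutes with these.
value : ℕ → ℂ → ℚ[i]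
value ν z = seq (re z) ν , seq (im z) ν

value-∑ : ∀ {A : Set} ν (xs : List A) (g : A → ℂ) → value ν (∑ xs g) ≡ ∑ᶜ xs (λ a → value ν (g a))
value-∑ ν [] g = refl
value-∑ ν (x ∷ xs) g = cong (value ν (g x) ⊕_) (value-∑ ν xs g)

value-∏ : ∀ {k} ν (v : Fin k → ℂ) → value ν (∏ v) ≡ ∏ᶜ (λ i → value ν (v i))
value-∏ {zero} ν v = refl
value-∏ {suc k} ν v = cong (value ν (v Fin.zero) ⊗_) (value-∏ ν (λ i → v (Fin.suc i)))

clip-small : ∀ ν z → ℚ.∣ proj₁ (value ν (clipᶜ z)) ∣ ℚ.≤ 1ℚ × ℚ.∣ proj₂ (value ν (clipᶜ z)) ∣ ℚ.≤ 1ℚ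
clip-small ν z = ∣clip∣≤1 (seq (re z) ν) , ∣clip∣≤1 (seq (im z) ν)

restrict-small : ∀ {P : Set} ν (d : Dec P) z → ℚ.∣ proj₁ (value ν (restrict d z)) ∣ ℚ.≤ 1ℚ × ℚ.∣ proj₂
    (value ν (restrict d z)) ∣ ℚ.≤ 1ℚ
restrict-small ν (yes _) z = clip-small ν z
restrict-small ν (no _) z = ℚ.nonNegative⁻¹ 1ℚ , ℚ.nonNegative⁻¹ 1ℚ

-- Reduction of the counting operator to explicit finite ranges

∑′-≈ : ∀ {A : Set} (_≟_ : ∀ (x y : A) → Dec (x ≡ y)) (g : A → ℂ) (fs : FinitelySupported g) {ys : List A} → Unique ys →
  (∀ {x} → x ∉ ys → g x ≈ᶜ 0ᶜ) → ∑′ _≟_ g fs ≈ᶜ ∑ ys g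
∑′-≈ _≟_ g fs u null = Core.Support.total-support +ᶜ-commutativeMonoid _≟_ g (deduplicate-! _≟_ (points fs)) u
  (λ _ → null) (λ {y} _ y∉ → supported fs y (λ y∈ → y∉ (∈-deduplicate⁺ _≟_ y∈)))

[1…]⇒interval : ∀ {n x} → x ∈ [1… n ] → x ∈ interval n
[1…]⇒interval {n} x∈ with j , j∈ , refl ← ∈-map⁻ (λ j → + suc j) x∈ = ∈-map⁺ (λ j → + suc j) (∈-downFrom⁺ (∈-upTo⁻ j∈))

interval⇒[1…] : ∀ {n x} → x ∈ interval n → x ∈ [1… n ]
interval⇒[1…] {n} x∈ with j , j<n , refl ← Core.interval⁻ x∈ = ∈-map⁺ (λ j → + suc j) (∈-upTo⁺ j<n)

[1…]-unique : ∀ n → Unique [1… n ]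
[1…]-unique n = map⁺ (λ eq → ℕ.suc-injective (ℤ.+-injective eq)) (upTo⁺ n)

tuples-unique : ∀ {A : Set} {xs : List A} → Unique xs → ∀ k → Unique (tuples xs k)
tuples-unique u zero = ListAll.[] ∷ []
tuples-unique u (suc k) = cartesianProductWith⁺ _∷_ ∷-injective u (tuples-unique u k)

∈-tuples⁻ : ∀ {A : Set} {xs : List A} {k} {v : Vec A k} → v ∈ tuples xs k → ∀ i → lookup v i ∈ xs
∈-tuples⁻ {xs = xs} {suc k} v∈ i with x , w , x∈ , w∈ , refl ← ∈-cartesianProductWith⁻ _∷_ xs (tuples xs k) v∈ = cases i
  where
  cases : ∀ i → lookup (x ∷ w) i ∈ xs
  cases Fin.zero = x∈
  cases (Fin.suc i) = ∈-tuples⁻ w∈ i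

restrict-≈ : ∀ {P : Set} (d : Dec P) z → ∣ z ∣ ≤ 1ℝ → (¬ P → z ≈ᶜ 0ᶜ) → z ≈ᶜ restrict d z
restrict-≈ (yes _) z le _ = clipᶜ-≈ z le
restrict-≈ (no ¬p) z _ null = null ¬p

module Truncation {k n t H T : ℕ} (T-large : n ℕ.+ t ℕ.* H ℕ.≤ T)
    (λ′ : Vec ℤ (suc k) → ℂ) (λ-bounded : OneBounded λ′) (λ-fs : FinitelySupported λ′)
    (λ-null : ∀ {v} → v ∉ tuples (window t) (suc k) → λ′ v ≈ᶜ 0ᶜ)
    (f : Fin (suc k) → ℤ → ℂ) (f-bounded : ∀ i → OneBounded (f i)) (fs : ∀ i → FinitelySupported (f i))
    (f-null : ∀ i {x} → x ∉ interval n → f i x ≈ᶜ 0ᶜ) where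

  f̃ : Fin (suc k) → ℤ → ℂ
  f̃ i x = restrict (x ∈? interval n) (f i x)

  f≈f̃ : ∀ i x → f i x ≈ᶜ f̃ i x
  f≈f̃ i x = restrict-≈ (x ∈? interval n) (f i x) (f-bounded i x) (f-null i)

  -- The ranges no longer depend on witnesses of finite support and all functions are clipped, so
  -- each approximation is a rational count of the form treated in `Core`.
  R̃ : ℂ
  R̃ = ∑ (tuples (window t) (suc k)) λ v → clipᶜ (λ′ v) *ᶜ
        ∑ (window T) λ x → ∑ (interval H) λ m → ∏ λ i → f̃ i (x ℤ.+ lookup v i ℤ.* m)

  -- One factor suffices to confine `x`: if it does not vanish, then `x` is a point of [n] minus
  -- `b m`, and `b m` has size at most `t H`.
  configuration-null : ∀ {v} → v ∈ tuples (window t) (suc k) → ∀ {x} → x ∉ window T → configurations H f v x ≈ᶜ 0ᶜ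
  configuration-null {v} v∈ {x} x∉ = ∑-null [1… H ] (λ m → ∏ λ i → f i (x ℤ.+ lookup v i ℤ.* m)) λ {m} m∈ →
    ∏-null (λ i → f i (x ℤ.+ lookup v i ℤ.* m)) Fin.zero (f-null Fin.zero λ y∈ → x∉ (Core.∈-window x
      (ℕ.≤-trans (ℕ.≤-reflexive (cong ℤ.∣_∣ (sym (ℤ-Group.//-rightDividesʳ (b ℤ.* m) x))))
        (ℕ.≤-trans (ℤ.∣i-j∣≤∣i∣+∣j∣ (x ℤ.+ b ℤ.* m) (b ℤ.* m))
          (ℕ.≤-trans (ℕ.+-mono-≤ (Core.interval-size y∈)
            (ℕ.≤-trans (ℕ.≤-reflexive (ℤ.∣i*j∣≡∣i∣*∣j∣ b m))
              (ℕ.*-mono-≤ (Core.window-size (∈-tuples⁻ v∈ Fin.zero)) (Core.interval-size ([1…]⇒interval m∈)))))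
            T-large)))))
    where b = lookup v Fin.zero

  R≈R̃ : R H λ′ λ-fs f fs ≈ᶜ R̃
  R≈R̃ = ≈ᶜ-trans
    (∑′-≈ (≡-dec ℤ._≟_) (λ v → λ′ v *ᶜ inner v)
      (record { points = points λ-fs ; supported = λ v v∉ → *ᶜ-nullˡ (inner v) (supported λ-fs v v∉) }) (tuples-unique (Core.window-unique t) (suc k)) (λ {v} v∉ → *ᶜ-nullˡ (inner v) (λ-null v∉)))
    (∑-congᶜ (tuples (window t) (suc k)) λ {v} v∈ → *ᶜ-cong (clipᶜ-≈ (λ′ v) (λ-bounded v)) (≈ᶜ-trans
      (∑′-≈ ℤ._≟_ (configurations H f v) (configurations-support H f fs v) (Core.window-unique T)
          (configuration-null v∈))
      (∑-congᶜ (window T) λ {x} _ → ≈ᶜ-trans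
        (Core.Support.total-support +ᶜ-commutativeMonoid ℤ._≟_ (λ m → ∏ λ i → f i (x ℤ.+ lookup v i ℤ.* m))
          ([1…]-unique H) (Core.interval-unique H)
          (λ m∈ m∉ → contradiction ([1…]⇒interval m∈) m∉) (λ m∈ m∉ → contradiction (interval⇒[1…] m∈) m∉))
        (∑-congᶜ (interval H) λ {m} _ → ∏-congᶜ λ i → f≈f̃ i (x ℤ.+ lookup v i ℤ.* m)))))

    where
    inner : Vec ℤ (suc k) → ℂ
    inner v = ∑′ ℤ._≟_ (configurations H f v) (configurations-support H f fs v)

  value-R̃ : ∀ ν → value ν R̃ ≡ ∑ᶜ (tuples (window t) (suc k)) (λ v → value ν (clipᶜ (λ′ v)) ⊗
    ∑ᶜ (window T) λ x → ∑ᶜ (interval H) λ m → ∏ᶜ λ i → value ν (f̃ i (x ℤ.+ lookup v i ℤ.* m)))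
  value-R̃ ν = trans (value-∑ ν (tuples (window t) (suc k)) _) (Core.∑ᶜ-cong (tuples (window t) (suc k)) λ v →
    cong (value ν (clipᶜ (λ′ v)) ⊗_) (trans (value-∑ ν (window T) _) (Core.∑ᶜ-cong (window T) λ x →
      trans (value-∑ ν (interval H) _)
          (Core.∑ᶜ-cong (interval H) λ m → value-∏ ν (λ i → f̃ i (x ℤ.+ lookup v i ℤ.* m))))))

-- Progressions

∑-upTo : ∀ n (g : ℕ → ℚ) → Core.∑ (upTo n) g ≡ Core.∑< n g
∑-upTo n g = Core.∑-support ℕ._≟_ g (upTo⁺ n) (downFrom⁺ n)
  (λ x∈ x∉ → contradiction (∈-downFrom⁺ (∈-upTo⁻ x∈)) x∉) (λ x∈ x∉ → contradiction (∈-upTo⁺ (∈-downFrom⁻ x∈)) x∉)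

∈-progression⁻ : ∀ a d {l x} → x ∈ progression a d l → ∃[ j ] j ℕ.< l × x ≡ a ℤ.+ + j ℤ.* d
∈-progression⁻ a d x∈ with j , j∈ , refl ← ∈-map⁻ (λ j → a ℤ.+ + j ℤ.* d) x∈ = j , ∈-upTo⁻ j∈ , refl

∈-progressions : ∀ {n a d l} → a ∈ interval n → d ∈ interval n → l ℕ.< n →
  (∀ {x} → x ∈ progression a d (suc l) → x ∈ interval n) → progression a d (suc l) ∈ progressions n
∈-progressions {n} {a} {d} {l} a∈ d∈ l<n within = ∈-filter⁺ (ListAll.all? (_∈? [1… n ]))
  (∈-concatMap⁺ _ (Any.map (λ { refl → ∈-concatMap⁺ _ (Any.map (λ { refl →
      ∈-map⁺ (λ j → progression a d (suc j)) (∈-upTo⁺ l<n) }) (interval⇒[1…] d∈)) }) (interval⇒[1…] a∈)))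
  (ListAll.tabulate λ x∈ → interval⇒[1…] (within x∈))

-- Only the part of a progression lying in [n] contributes.
trim : ∀ {n M} (φ : ℤ → ℚ) → (∀ {x} → x ∉ interval n → φ x ≡ 0ℚ) → 0ℚ ℚ.≤ M →
  (∀ {a d l} → a ∈ interval n → d ∈ interval n → l ℕ.< n → (∀ {x} → x ∈ progression a d (suc l) → x ∈ interval n) →
    ℚ.∣ Core.∑< (suc l) (λ j → φ (a ℤ.+ + j ℤ.* d)) ∣ ℚ.≤ M) →
  ∀ y g ℓ → 0 ℕ.< g → ℚ.∣ Core.∑< ℓ (λ j → φ (y ℤ.+ + j ℤ.* + g)) ∣ ℚ.≤ M
trim φ supp 0≤M h y g zero 0<g = 0≤M
trim {n} {M} φ supp 0≤M h y g (suc l) 0<g = cases (y ∈? interval n) (y ℤ.+ + l ℤ.* + g ∈? interval n)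
  where
  term : ℕ → ℚ
  term j = φ (y ℤ.+ + j ℤ.* + g)
  next : ∀ y j g → y ℤ.+ (ℤ.1ℤ ℤ.+ j) ℤ.* g ≡ y ℤ.+ g ℤ.+ j ℤ.* g
  next = ℤ-Ring.solve-∀
  both-ends : ∀ {j j′} → j′ ℕ.< n → suc j ℕ.+ l ℕ.* g ≡ suc j′ → y ≡ + suc j → ℚ.∣ Core.∑< (suc l) term ∣ ℚ.≤ M
  both-ends {j} {j′} j′<n eq refl = main l refl
    where
    inside : ∀ {i} → i ℕ.≤ l → + suc j ℤ.+ + i ℤ.* + g ∈ interval n
    inside {i} i≤l = subst (_∈ interval n) (cong (λ z → + suc j ℤ.+ z) (ℤ.pos-* i g))
      (∈-map⁺ (λ i → + suc i) (∈-downFrom⁺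
          (ℕ.≤-trans (ℕ.s≤s (ℕ.+-monoʳ-≤ j (ℕ.*-monoˡ-≤ g i≤l))) (ℕ.≤-trans (ℕ.≤-reflexive eq) j′<n))))
    start : + suc j ∈ interval n
    start = subst (_∈ interval n) (ℤ.+-identityʳ (+ suc j)) (inside ℕ.z≤n)
    lg≤j′ : l ℕ.* g ℕ.≤ j′
    lg≤j′ = ℕ.≤-trans (ℕ.m≤n+m (l ℕ.* g) j) (ℕ.≤-reflexive (ℕ.suc-injective eq))
    instance
      g≢0 : NonZero g
      g≢0 = ℕ.>-nonZero 0<g
    -- With at least two terms inside [n], the common difference is itself below `n`.
    difference : ∀ {l′} → l ≡ suc l′ → + g ∈ interval n
    difference refl = subst (λ z → + z ∈ interval n) (ℕ.suc-pred g)
      (∈-map⁺ (λ i → + suc i) (∈-downFrom⁺ (ℕ.≤-trans (ℕ.≤-reflexive (ℕ.suc-pred g))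
        (ℕ.≤-trans (ℕ.m≤n*m g l) (ℕ.≤-trans lg≤j′ (ℕ.<⇒≤ j′<n))))))
    main : ∀ l′ → l ≡ l′ → ℚ.∣ Core.∑< (suc l) term ∣ ℚ.≤ M
    -- A single term says nothing about the size of `g`, which may exceed `n`; the common difference
    -- is therefore taken to be 1, which `progressions` admits.
    main zero refl = h {d = + 1} start (∈-map⁺ (λ i → + suc i) (∈-downFrom⁺ 0<n)) 0<n
        (λ x∈ → singleton (∈-progression⁻ (+ suc j) (+ 1) x∈))
      where
      0<n : 0 ℕ.< n
      0<n = ℕ.≤-<-trans ℕ.z≤n j′<n
      singleton : ∀ {x} → ∃[ i ] i ℕ.< 1 × x ≡ + suc j ℤ.+ + i ℤ.* + 1 → x ∈ interval n
      singleton (zero , _ , refl) = inside ℕ.z≤n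
      singleton (suc i , ℕ.s≤s () , _)
    main (suc l′) eq′ = h start (difference eq′)
      (ℕ.≤-trans (ℕ.s≤s (ℕ.≤-trans (ℕ.m≤m*n l g) lg≤j′)) j′<n)
      (λ x∈ → subst (_∈ interval n) (sym (proj₂ (proj₂ (∈-progression⁻ (+ suc j) (+ g) x∈))))
          (inside (ℕ.≤-pred (proj₁ (proj₂ (∈-progression⁻ (+ suc j) (+ g) x∈))))))
  cases : Dec (y ∈ interval n) → Dec (y ℤ.+ + l ℤ.* + g ∈ interval n) → ℚ.∣ Core.∑< (suc l) term ∣ ℚ.≤ M
  cases (no y∉) _ = subst (λ s → ℚ.∣ s ∣ ℚ.≤ M) (sym (trans (Core.∑<-first l term) (trans
      (cong₂ ℚ._+_ (trans (cong φ (ℤ.+-identityʳ y)) (supp y∉))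
          (Core.∑-cong (downFrom l) λ j → cong φ (next y (+ j) (+ g))))
      (ℚ.+-identityˡ _))))
    (trim φ supp 0≤M h (y ℤ.+ + g) g l 0<g)
  cases (yes _) (no last∉) = subst (λ s → ℚ.∣ s ∣ ℚ.≤ M)
    (sym (trans (cong (ℚ._+ Core.∑< l term) (supp last∉)) (ℚ.+-identityˡ _))) (trim φ supp 0≤M h y g l 0<g)
  cases (yes y∈) (yes last∈) with j , j<n , refl ← Core.interval⁻ y∈ | j′ , j′<n , eq ← Core.interval⁻ last∈ =
    both-ends j′<n (ℤ.+-injective (trans (cong (λ z → + suc j ℤ.+ z) (ℤ.pos-* l g)) eq)) refl

-- The norm controls sums of the raw approximations `g`, whereas the rational argument uses the
-- clipped `φ`. A progression inside [n] has at most `n` terms, so passing from one to the other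
-- costs at most `n η`.
uniform : ∀ {n B η} (g φ : ℤ → ℚ) → (∀ {x} → x ∉ interval n → φ x ≡ 0ℚ) → 0ℚ ℚ.≤ B → 0ℚ ℚ.≤ η →
  (∀ {x} → x ∈ interval n → ℚ.∣ φ x ℚ.- g x ∣ ℚ.≤ η) → (∀ {P} → P ∈ progressions n → ℚ.∣ Core.∑ P g ∣ ℚ.≤ B) →
  ∀ y d ℓ → 0 ℕ.< d → ℚ.∣ Core.∑< ℓ (λ j → φ (y ℤ.+ + j ℤ.* + d)) ∣ ℚ.≤ B ℚ.+ ι n ℚ.* η
uniform {n} {B} {η} g φ supp 0≤B 0≤η close bound = trim φ supp
    (Core.+-nonNeg 0≤B (Rational.*-nonNeg (Rational.0≤fromℕ n) 0≤η)) on-progression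
  where
  on-progression : ∀ {a d l} → a ∈ interval n → d ∈ interval n → l ℕ.< n →
      (∀ {x} → x ∈ progression a d (suc l) → x ∈ interval n) →
    ℚ.∣ Core.∑< (suc l) (λ j → φ (a ℤ.+ + j ℤ.* d)) ∣ ℚ.≤ B ℚ.+ ι n ℚ.* η
  on-progression {a} {d} {l} a∈ d∈ l<n within = begin
    ℚ.∣ Core.∑< (suc l) (λ j → φ (a ℤ.+ + j ℤ.* d)) ∣
      ≡⟨ cong ℚ.∣_∣ (sym (trans (Core.∑-map _ (upTo (suc l)) φ) (∑-upTo (suc l) (λ j → φ (a ℤ.+ + j ℤ.* d))))) ⟩
    ℚ.∣ Core.∑ P φ ∣
      ≡⟨ cong ℚ.∣_∣ (solve 2 (λ s t → s := t :+ (s :- t)) refl (Core.∑ P φ) (Core.∑ P g)) ⟩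
    ℚ.∣ Core.∑ P g ℚ.+ (Core.∑ P φ ℚ.- Core.∑ P g) ∣        ≤⟨ ℚ.∣p+q∣≤∣p∣+∣q∣ (Core.∑ P g) _ ⟩
    ℚ.∣ Core.∑ P g ∣ ℚ.+ ℚ.∣ Core.∑ P φ ℚ.- Core.∑ P g ∣    ≤⟨ ℚ.+-mono-≤ (bound (∈-progressions a∈ d∈ l<n within))
        (ℚ.≤-trans (Core.∣∑-∑∣ P φ g) (Core.∑-bound P η (λ x∈ → close (within x∈)))) ⟩
    B ℚ.+ ι (length P) ℚ.* η                   ≤⟨ ℚ.+-monoʳ-≤ B (ℚ.*-monoʳ-≤-nonNeg η {{ℚ.nonNegative 0≤η}}
        (Core.ι-mono (ℕ.≤-trans (ℕ.≤-reflexive (trans (length-map _ (upTo (suc l))) (length-upTo (suc l)))) l<n))) ⟩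
    B ℚ.+ ι n ℚ.* η                            ∎
    where
    open ℚ.≤-Reasoning
    open +-*-Solver
    P = progression a d (suc l)

≤-max : ∀ ν {x xs} → x ∈ xs → seq x ν ℚ.≤ seq (max xs) ν
≤-max ν {x} {_ ∷ xs} (here refl) = ℚ.p≤p⊔q (seq x ν) (seq (max xs) ν)
≤-max ν {x} {y ∷ xs} (there x∈) = ℚ.≤-trans (≤-max ν x∈) (ℚ.p≤q⊔p (seq y ν) (seq (max xs) ν))

0≤max : ∀ ν xs → 0ℚ ℚ.≤ seq (max xs) ν
0≤max ν [] = ℚ.≤-refl
0≤max ν (y ∷ xs) = ℚ.≤-trans (0≤max ν xs) (ℚ.p≤q⊔p (seq y ν) (seq (max xs) ν))

largestSum : (ℤ → ℂ) → ℕ → ℝ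
largestSum f n = max (map (λ P → ∣ ∑ P f ∣) (progressions n))

progression-sum : ∀ ν n (f : ℤ → ℂ) {P} → P ∈ progressions n →
  let m = seq (largestSum f n) ν ℚ.+ Rational.1/suc ν in
  ℚ.∣ Core.∑ P (λ x → proj₁ (value ν (f x))) ∣ ℚ.≤ m × ℚ.∣ Core.∑ P (λ x → proj₂ (value ν (f x))) ∣ ℚ.≤ m
progression-sum ν n f {P} P∈ =
  subst (λ z → ℚ.∣ proj₁ z ∣ ℚ.≤ m) (value-∑ ν P f) (component-≤ ν {a} {b} refl le) ,
  subst (λ z → ℚ.∣ proj₂ z ∣ ℚ.≤ m) (value-∑ ν P f) (component-≤ ν {b} {a} (ℚ.+-comm (a ℚ.* a) (b ℚ.* b)) le)
  where
  m = seq (largestSum f n) ν ℚ.+ Rational.1/suc ν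
  a = seq (re (∑ P f)) ν
  b = seq (im (∑ P f)) ν
  le : Rational.sqrtBelow ν (a ℚ.* a ℚ.+ b ℚ.* b) ℚ.≤ seq (largestSum f n) ν
  le = ≤-max ν (∈-map⁺ (λ P → ∣ ∑ P f ∣) P∈)

-- Properties of all sufficiently late approximations

eventually-∈ : ∀ {A : Set} {Q : A → ℕ → Set} (xs : List A) → (∀ a → Eventually (Q a)) →
  Eventually (λ ν → ∀ {a} → a ∈ xs → Q a ν)
eventually-∈ [] ev = 0 , λ _ _ ()
eventually-∈ (x ∷ xs) ev = weaken (λ { ν (p , q) (here refl) → p ; ν (p , q) (there a∈) → q a∈ })
  (both (ev x) (eventually-∈ xs ev))

seq-^ : ∀ x k ν → seq (x ^ k) ν ≡ seq x ν Core.^^ k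
seq-^ x zero ν = refl
seq-^ x (suc k) ν = cong (λ z → seq x ν ℚ.* z) (seq-^ x k ν)

gap-≤ : ∀ {x} (0<x : 0ℝ < x) → Eventually λ ν → gap 0<x ℚ.≤ seq x ν
gap-≤ {x} 0<x = weaken (λ ν → subst (ℚ._≤ seq x ν) (ℚ.+-identityˡ (gap 0<x))) (gap-bound 0<x)

-- The equality is exact: the truncation in `recip` is inactive once the terms of `x` have reached
-- `κ`.
recip-inverse : ∀ {x} (0<x : 0ℝ < x) → Eventually λ ν → seq (recip x 0<x) ν ℚ.* seq x ν ≡ 1ℚ
recip-inverse {x} 0<x@(mk< κ 0<κ _) = weaken
  (λ ν κ≤x → trans (ℚ.*-comm (seq (recip x 0<x) ν) (seq x ν)) (trans
    (cong (ℚ._* seq (recip x 0<x) ν) (sym (ℚ.p≥q⇒p⊔q≡p κ≤x)))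
    (Rational.*-inv (seq x ν ℚ.⊔ κ) (<-⊔ (seq x ν) 0<κ)))) (gap-≤ 0<x)

recip-nonNeg : ∀ {x} (0<x : 0ℝ < x) ν → 0ℚ ℚ.≤ seq (recip x 0<x) ν
recip-nonNeg {x} (mk< κ 0<κ _) ν = ℚ.<⇒≤ (Rational.inv-pos (seq x ν ℚ.⊔ κ) (<-⊔ (seq x ν) 0<κ))

≤-min : ∀ {k} .{{_ : NonZero k}} {x} (v : Fin k → ℝ) → (∀ i → x ≤ v i) → x ≤ min v
≤-min {suc k} {x} v le = fold (v Fin.zero) (λ i → v (Fin.suc i)) (le Fin.zero) (λ i → le (Fin.suc i))
  where
  fold : ∀ {k} y (v : Fin k → ℝ) → x ≤ y → (∀ i → x ≤ v i) → x ≤ Tuple.foldr _⊓_ y v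
  fold {zero} y v x≤y le = x≤y
  fold {suc k} y v x≤y le = mk≤ λ ε 0<ε → weaken
    (λ ν (p , q) → glb (seq (v Fin.zero) ν) (seq (Tuple.foldr _⊓_ y (λ i → v (Fin.suc i))) ν) p q)
    (both (≤-within (le Fin.zero) ε 0<ε) (≤-within (fold y (λ i → v (Fin.suc i)) x≤y (λ i → le (Fin.suc i))) ε 0<ε))
    where
    glb : ∀ a b {c ε} → c ℚ.≤ a ℚ.+ ε → c ℚ.≤ b ℚ.+ ε → c ℚ.≤ (a ℚ.⊓ b) ℚ.+ ε
    glb a b {c} {ε} p q with ℚ.⊓-sel a b
    ... | inj₁ eq = subst (λ z → c ℚ.≤ z ℚ.+ ε) (sym eq) p
    ... | inj₂ eq = subst (λ z → c ℚ.≤ z ℚ.+ ε) (sym eq) q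

restrict-null : ∀ {P : Set} (d : Dec P) z → ¬ P → restrict d z ≡ 0ᶜ
restrict-null (yes p) z ¬p = contradiction p ¬p
restrict-null (no _) z _ = refl

-- One late term `a` determines `p`, with `2 ≤ p a ≤ 3`. Later terms differ from `a` by at most κ/4,
-- where `κ ≤ a`, and multiplied by `p` this is at most 3/4; so the bounds 1 and 4 hold for all of
-- them.
reciprocal-scale : ∀ {x} (0<x : 0ℝ < x) → Eventually (λ ν → seq x ν ℚ.≤ 1ℚ) →
  ∃[ p ] 0 ℕ.< p × Eventually λ ν → 1ℚ ℚ.≤ ι p ℚ.* seq x ν × ι p ℚ.* seq x ν ℚ.≤ ι 4
reciprocal-scale {x} 0<x@(mk< κ 0<κ _) ≤1 = p , 0<p , weaken
    (λ ν (le , _) → lower ν le , upper ν le)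
    (both close (gap-≤ 0<x))
  where
  open ℚ.≤-Reasoning
  open +-*-Solver
  e = both (gap-≤ 0<x) ≤1
  h = ½ ℚ.* (½ ℚ.* κ)
  cauchy-h = cauchy x h (half-pos (half-pos 0<κ))
  m = proj₁ e ℕ.⊔ proj₁ cauchy-h
  a = seq x m
  κ≤a : κ ℚ.≤ a
  κ≤a = proj₁ (proj₂ e m (ℕ.m≤m⊔n (proj₁ e) (proj₁ cauchy-h)))
  between = Core.multiple-between (ℚ.<-≤-trans 0<κ κ≤a) (proj₂ (proj₂ e m (ℕ.m≤m⊔n (proj₁ e) (proj₁ cauchy-h))))
  p = proj₁ between
  ιp = ι p
  2≤pa = proj₁ (proj₂ between)
  pa≤3 = proj₂ (proj₂ between)
  0<p : 0 ℕ.< p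
  0<p = ℕ.n≢0⇒n>0 λ p≡0 → ℚ.<-irrefl refl (ℚ.<-≤-trans (ℚ.positive⁻¹ (ι 2))
    (subst (ι 2 ℚ.≤_) (trans (cong (λ z → ι z ℚ.* a) p≡0) (ℚ.*-zeroˡ a)) 2≤pa))
  close : Eventually λ ν → ℚ.∣ seq x ν ℚ.- a ∣ ℚ.≤ h
  close = proj₁ cauchy-h , λ ν le → proj₂ cauchy-h ν m le (ℕ.m≤n⊔m (proj₁ e) (proj₁ cauchy-h))
  ph≤ : ιp ℚ.* h ℚ.≤ 1ℚ
  ph≤ = begin
    ιp ℚ.* h
      ≡⟨ solve 2 (λ p k → p :* (con ½ :* (con ½ :* k)) := con (½ ℚ.* ½) :* (p :* k)) refl ιp κ ⟩
    (½ ℚ.* ½) ℚ.* (ιp ℚ.* κ)            ≤⟨ ℚ.*-monoˡ-≤-nonNeg (½ ℚ.* ½) (ℚ.≤-trans (ℚ.*-monoˡ-≤-nonNeg ιp κ≤a) pa≤3) ⟩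
    (½ ℚ.* ½) ℚ.* ι 3      ≤⟨ ℚ.*≤* (ℤ.+≤+ (ℕ.s≤s (ℕ.s≤s (ℕ.s≤s ℕ.z≤n)))) ⟩
    1ℚ                                  ∎
  lower : ∀ ν → ℚ.∣ seq x ν ℚ.- a ∣ ℚ.≤ h → 1ℚ ℚ.≤ ιp ℚ.* seq x ν
  lower ν le = Core.+-cancelʳ-≤ 1ℚ (begin
    1ℚ ℚ.+ 1ℚ                        ≤⟨ 2≤pa ⟩
    ιp ℚ.* a
      ≤⟨ ℚ.*-monoˡ-≤-nonNeg ιp (Rational.close⁻ {a} (subst (ℚ._≤ h) (Rational.abs-sym (seq x ν) a) le)) ⟩
    ιp ℚ.* (seq x ν ℚ.+ h)           ≡⟨ ℚ.*-distribˡ-+ ιp (seq x ν) h ⟩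
    ιp ℚ.* seq x ν ℚ.+ ιp ℚ.* h      ≤⟨ ℚ.+-monoʳ-≤ (ιp ℚ.* seq x ν) ph≤ ⟩
    ιp ℚ.* seq x ν ℚ.+ 1ℚ            ∎)
  upper : ∀ ν → ℚ.∣ seq x ν ℚ.- a ∣ ℚ.≤ h → ιp ℚ.* seq x ν ℚ.≤ ι 4
  upper ν le = begin
    ιp ℚ.* seq x ν                   ≤⟨ ℚ.*-monoˡ-≤-nonNeg ιp (Rational.close⁻ {seq x ν} le) ⟩
    ιp ℚ.* (a ℚ.+ h)                 ≡⟨ ℚ.*-distribˡ-+ ιp a h ⟩
    ιp ℚ.* a ℚ.+ ιp ℚ.* h            ≤⟨ ℚ.+-mono-≤ pa≤3 ph≤ ⟩
    ι 3 ℚ.+ 1ℚ          ∎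

-- e is the degree of scale p in p ≈ 1/δ; as δ < c, one further power of δ absorbs all constants.
module Uniformity (k c₀ e : ℕ) (0<c₀ : 0 ℕ.< c₀) (C₀ : ℝ) (C₀≤c₀ : Eventually λ ν → seq C₀ ν ℚ.≤ ι c₀) where

  open Core.Constants k c₀ hiding (t)

  loss : ℚ
  loss = ι 4 ℚ.* (ι 4 Core.^^ e ℚ.* ι (scale 1))

  0≤loss : 0ℚ ℚ.≤ loss
  0≤loss = Rational.*-nonNeg (Rational.0≤fromℕ 4)
      (Rational.*-nonNeg (Core.^^-nonNeg (Rational.0≤fromℕ 4) e) (Rational.0≤fromℕ (scale 1)))

  0<1+loss : 0ℚ ℚ.< 1ℚ ℚ.+ loss
  0<1+loss = Rational.+-pos Rational.0<1 0≤loss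

  -- Adding 1 to `loss` yields `c ≤ 1` together with `c * loss ≤ 1`. The latter, with δ below `c`,
  -- is the smallness condition of `scale-small`.
  c : ℚ
  c = Rational.inv (1ℚ ℚ.+ loss) 0<1+loss

  0<c : 0ℚ ℚ.< c
  0<c = Rational.inv-pos (1ℚ ℚ.+ loss) 0<1+loss

  c*≤1 : ∀ {x} → x ℚ.≤ 1ℚ ℚ.+ loss → c ℚ.* x ℚ.≤ 1ℚ
  c*≤1 {x} le = ℚ.≤-trans (ℚ.*-monoˡ-≤-nonNeg c {{ℚ.nonNegative (ℚ.<⇒≤ 0<c)}} le)
    (ℚ.≤-reflexive (trans (ℚ.*-comm c _) (Rational.*-inv (1ℚ ℚ.+ loss) 0<1+loss)))

  1≤1+loss : 1ℚ ℚ.≤ 1ℚ ℚ.+ loss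
  1≤1+loss = Core.by-difference loss 0≤loss refl

  c≤1 : c ℚ.≤ 1ℚ
  c≤1 = ℚ.≤-trans (ℚ.≤-reflexive (sym (ℚ.*-identityʳ c))) (c*≤1 1≤1+loss)

  module Bound (scale-power : ∀ p → ι (scale p) ≡ ι (scale 1) ℚ.* ι p Core.^^ e)
      (N : ℝ) (1≤N : 1ℝ ≤ N) (n : ℕ) (isFloor : IsFloor N n) (δ : ℝ) (0<δ : 0ℝ < δ) (δ<c : δ < fromℚ c)
      (H : ℕ) (0<H : 0ℝ < fromℕ H) .{{_ : NonZero H}} (0<B : 0ℝ < N / fromℕ H [ 0<H ])
      (B-large : recip δ 0<δ ^ suc e ≤ N / fromℕ H [ 0<H ]) (B-small : N / fromℕ H [ 0<H ] ≤ N * δ ^ suc e) where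

    B : ℝ
    B = N / fromℕ H [ 0<H ]

    δ≤c : Eventually λ ν → seq δ ν ℚ.≤ c
    δ≤c = weaken (λ ν → ℚ.≤-trans (Core.by-difference (gap δ<c) (ℚ.<⇒≤ (0<gap δ<c)) refl)) (gap-bound δ<c)

    opaque

      scaled : ∃[ p ] 0 ℕ.< p × Eventually λ ν → 1ℚ ℚ.≤ ι p ℚ.* seq δ ν × ι p ℚ.* seq δ ν ℚ.≤ ι 4
      scaled = reciprocal-scale 0<δ (weaken (λ ν le → ℚ.≤-trans le c≤1) δ≤c)

    p : ℕ
    p = proj₁ scaled

    0<p : 0 ℕ.< p
    0<p = proj₁ (proj₂ scaled)

    0<n : 0 ℕ.< n
    0<n = ℕ.n≢0⇒n>0 λ { refl → <⇒≱ (proj₂ isFloor) 1≤N }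

    -- What the hypotheses say about the rational numbers at a single index. Divisions are exact
    -- from some index on, and since `n ≥ 1`, the tolerance 1/2 in `n ≤ N + 1/2` is absorbed by the
    -- factor 2.
    record Approximate (ν : ℕ) : Set where
      field
        0≤δ    : 0ℚ ℚ.≤ seq δ ν
        δ-inv  : seq δ ν ℚ.* seq (recip δ 0<δ) ν ≡ 1ℚ
        1≤pδ   : 1ℚ ℚ.≤ ι p ℚ.* seq δ ν
        small  : ι 4 ℚ.* (seq δ ν Core.^^ suc e ℚ.* ι (scale p)) ℚ.≤ 1ℚ
        BH≡N   : seq B ν ℚ.* ι H ≡ seq N ν
        B-inv  : seq (recip B 0<B) ν ℚ.* seq B ν ≡ 1ℚ
        n≤2N   : ι n ℚ.≤ ι 2 ℚ.* seq N ν
        N≤     : seq N ν ℚ.≤ ι (suc n)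

    approximate : Eventually Approximate
    approximate = weaken
      (λ ν ((δ≤c , (1≤pδ , pδ≤4)) , (κ≤δ , δ-inv) , (H-inv , B-inv) , (n≤N+½ , N<)) → record
        { 0≤δ = nonNeg ν κ≤δ
        ; δ-inv = trans (ℚ.*-comm (seq δ ν) _) δ-inv
        ; 1≤pδ = 1≤pδ
        ; small = Core.scale-small e (nonNeg ν κ≤δ) (Rational.0≤fromℕ p) (Rational.0≤fromℕ (scale 1)) (scale-power p)
            pδ≤4
            (ℚ.≤-trans (ℚ.*-monoʳ-≤-nonNeg loss {{ℚ.nonNegative 0≤loss}} δ≤c)
              (c*≤1 (Core.by-difference 1ℚ (ℚ.nonNegative⁻¹ 1ℚ) (ℚ.+-comm loss 1ℚ))))
        ; BH≡N = trans (ℚ.*-assoc (seq N ν) _ (ι H))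
            (trans (cong (λ z → seq N ν ℚ.* z) H-inv) (ℚ.*-identityʳ (seq N ν)))
        ; B-inv = B-inv
        ; n≤2N = double (seq N ν) n≤N+½
        ; N≤ = ℚ.≤-trans (Core.by-difference (gap (proj₂ isFloor)) (ℚ.<⇒≤ (0<gap (proj₂ isFloor))) refl) N<
        })
      (both (both δ≤c (proj₂ (proj₂ scaled))) (both (both (gap-≤ 0<δ) (recip-inverse 0<δ))
        (both (both (recip-inverse 0<H) (recip-inverse 0<B))
            (both (≤-within (proj₁ isFloor) ½ Rational.0<½) (gap-bound (proj₂ isFloor))))))
      where
      nonNeg : ∀ ν → gap 0<δ ℚ.≤ seq δ ν → 0ℚ ℚ.≤ seq δ ν
      nonNeg ν = ℚ.≤-trans (ℚ.<⇒≤ (0<gap 0<δ))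
      double : ∀ N → ι n ℚ.≤ N ℚ.+ ½ → ι n ℚ.≤ ι 2 ℚ.* N
      double N le = Core.+-cancelʳ-≤ 1ℚ (begin
        ι n ℚ.+ 1ℚ              ≤⟨ ℚ.+-monoʳ-≤ (ι n) (Core.ι-mono 0<n) ⟩
        ι n ℚ.+ ι n             ≤⟨ ℚ.+-mono-≤ le le ⟩
        N ℚ.+ ½ ℚ.+ (N ℚ.+ ½)   ≡⟨ solve 1 (λ N → N :+ con ½ :+ (N :+ con ½) := con (ι 2) :* N :+ con 1ℚ) refl N ⟩
        ι 2 ℚ.* N ℚ.+ 1ℚ        ∎)
        where
        open ℚ.≤-Reasoning
        open +-*-Solver

    open Approximate

    1≤2N : ∀ {ν} → Approximate ν → 1ℚ ℚ.≤ ι 2 ℚ.* seq N ν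
    1≤2N a = ℚ.≤-trans (Core.ι-mono 0<n) (n≤2N a)

    n-large : H ℕ.* scale p ℕ.≤ n
    -- The conclusion does not involve the index, so a single index past the threshold proves it.
    n-large = proj₂ ev (proj₁ ev) ℕ.≤-refl
      where
      ev : Eventually λ _ → H ℕ.* scale p ℕ.≤ n
      ev = weaken (λ ν (a , le) → Core.n-is-large {seq δ ν Core.^^ suc e} {seq (recip δ 0<δ) ν Core.^^ suc e} {seq B ν}
          {seq N ν} {H = H} (0<scale 0<p) 0<n (Core.^^-nonNeg (recip-nonNeg 0<δ ν) (suc e))
             (trans (sym (Core.*-^^ (seq δ ν) (seq (recip δ 0<δ) ν) (suc e)))
                 (trans (cong (Core._^^ suc e) (δ-inv a)) (Core.1^^ (suc e))))
             (small a) (subst (ℚ._≤ seq B ν ℚ.+ 1ℚ) (seq-^ (recip δ 0<δ) (suc e) ν) le) (BH≡N a) (N≤ a))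
           (both approximate (≤-within B-large 1ℚ Rational.0<1))

    H-large : scale p ℕ.≤ H
    H-large = proj₂ ev (proj₁ ev) ℕ.≤-refl
      where
      -- With tolerance 1/(4H) the error, multiplied by `4 G H`, is just `G`, which is at most
      -- `2 N G`.
      4H = ι 4 ℚ.* ι H
      0<ιH : 0ℚ ℚ.< ι H
      0<ιH = Core.0<ι (ℕ.>-nonZero⁻¹ H)
      0<4H : 0ℚ ℚ.< 4H
      0<4H = Rational.*-pos (ℚ.positive⁻¹ (ι 4)) 0<ιH
      ε = Rational.inv 4H 0<4H
      ev : Eventually λ _ → scale p ℕ.≤ H
      ev = weaken (λ ν (a , le) → Core.H-is-large {seq δ ν Core.^^ suc e} {seq B ν} {seq N ν} {ε} {scale p} {H}
          (small a)
             (subst (λ z → seq B ν ℚ.≤ seq N ν ℚ.* z ℚ.+ ε) (seq-^ δ (suc e) ν) le)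
             (trans (solve 2 (λ e h → con (ι 4) :* (e :* h) := con (ι 4) :* h :* e) refl ε (ι H))
                 (Rational.*-inv 4H 0<4H))
             (BH≡N a) (1≤2N a))
           (both approximate (≤-within B-small ε (Rational.inv-pos 4H 0<4H)))
        where open +-*-Solver

    t : ℕ
    t = (C₁ ℕ.* n) / H

    cube-bound : ∀ m → fromℕ m ≤ C₀ * B → m ℕ.≤ t
    cube-bound m le = subst (ℕ._≤ t) (m*n/n≡m m H) (/-monoˡ-≤ H (proj₂ ev (proj₁ ev) ℕ.≤-refl))
      where
      0<ιH : 0ℚ ℚ.< ι H
      0<ιH = Core.0<ι (ℕ.>-nonZero⁻¹ H)
      -- After multiplication by `H` this tolerance becomes 1.
      ε = Rational.inv (ι H) 0<ιH
      collect : ∀ c n → c ℕ.* (n ℕ.+ n) ℕ.+ c ℕ.* n ≡ 3 ℕ.* c ℕ.* n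
      collect = ℕ-Ring.solve-∀
      open ℚ.≤-Reasoning
      open +-*-Solver
      at : ∀ {ν} → Approximate ν → seq C₀ ν ℚ.≤ ι c₀ → ι m ℚ.≤ seq C₀ ν ℚ.* seq B ν ℚ.+ ε → m ℕ.* H ℕ.≤ C₁ ℕ.* n
      at {ν} a C≤ le = ℕ.≤-trans (Core.ι-cancel (begin
        ι (m ℕ.* H)                                     ≡⟨ Core.ι-* m H ⟩
        ι m ℚ.* ι H                                     ≤⟨ ℚ.*-monoʳ-≤-nonNeg (ι H) le ⟩
        (seq C₀ ν ℚ.* seq B ν ℚ.+ ε) ℚ.* ι H
          ≡⟨ solve 4 (λ c b e h → (c :* b :+ e) :* h := c :* (b :* h) :+ h :* e) refl (seq C₀ ν) (seq B ν) ε (ι H) ⟩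
        seq C₀ ν ℚ.* (seq B ν ℚ.* ι H) ℚ.+ ι H ℚ.* ε
          ≡⟨ cong₂ (λ x y → seq C₀ ν ℚ.* x ℚ.+ y) (BH≡N a) (Rational.*-inv (ι H) 0<ιH) ⟩
        seq C₀ ν ℚ.* seq N ν ℚ.+ 1ℚ
          ≤⟨ ℚ.+-monoˡ-≤ 1ℚ (ℚ.≤-trans (ℚ.*-monoʳ-≤-nonNeg (seq N ν) {{ℚ.nonNegative 0≤N}} C≤)
                                                            (ℚ.*-monoˡ-≤-nonNeg (ι c₀) (N≤ a))) ⟩
        ι c₀ ℚ.* ι (suc n) ℚ.+ 1ℚ
          ≡⟨ sym (trans (Core.ι-+ (c₀ ℕ.* suc n) 1) (cong (ℚ._+ 1ℚ) (Core.ι-* c₀ (suc n)))) ⟩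
        ι (c₀ ℕ.* suc n ℕ.+ 1)                          ∎))
        (ℕ.≤-trans (ℕ.+-mono-≤ (ℕ.*-monoʳ-≤ c₀ (ℕ.+-monoˡ-≤ n 0<n)) (ℕ.*-mono-≤ 0<c₀ 0<n))
            (ℕ.≤-reflexive (collect c₀ n)))
        where
        0≤N : 0ℚ ℚ.≤ seq N ν
        0≤N = ℚ.<⇒≤ (ℚ.*-cancelˡ-<-nonNeg (ι 2) (ℚ.<-≤-trans (ℚ.positive⁻¹ 1ℚ) (1≤2N a)))
      ev : Eventually λ _ → m ℕ.* H ℕ.≤ C₁ ℕ.* n
      ev = weaken (λ ν (a , C≤ , le) → at a C≤ le)
          (both approximate (both C₀≤c₀ (≤-within le ε (Rational.inv-pos (ι H) 0<ιH))))

    module Counting (λ′ : Vec ℤ (suc k) → ℂ) (λ-bounded : OneBounded λ′) (λ-support : SupportedOn (Cube (C₀ * B)) λ′)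
        (f : Fin (suc k) → ℤ → ℂ) (f-bounded : ∀ i → OneBounded (f i)) (f-support : ∀ i → SupportedOn[1… n ] (f i)) where

      coordinate-bound : ∀ b → - (C₀ * B) ≤ fromℤ b → fromℤ b ≤ C₀ * B → ℤ.∣ b ∣ ℕ.≤ t
      coordinate-bound (+ m) _ u = cube-bound m u
      coordinate-bound -[1+ m ] l _ = cube-bound (suc m) (neg-swap -[1+ m ] l)

      λ-null : ∀ {v} → v ∉ tuples (window t) (suc k) → λ′ v ≈ᶜ 0ᶜ
      λ-null {v} v∉ = λ-support v λ inCube →
        v∉ (∈-tuples (VecAll.map (λ {b} (l , u) → Core.∈-window b (coordinate-bound b l u)) inCube))

      f-null : ∀ i {x} → x ∉ interval n → f i x ≈ᶜ 0ᶜ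
      f-null i {x} x∉ = f-support i x λ x∈ → x∉ ([1…]⇒interval x∈)

      open Truncation {k} {n} {t} {H} {n ℕ.+ 7 ℕ.* t ℕ.* H} (ℕ.+-monoʳ-≤ n (ℕ.*-monoˡ-≤ H (ℕ.m≤n*m t 7)))
        λ′ λ-bounded (cube-support (C₀ * B) λ-support) λ-null
        f f-bounded (λ i → interval-support (f-support i)) f-null

      count : ℂ
      count = R H λ′ (cube-support (C₀ * B) λ-support) f (λ i → interval-support (f-support i))

      -- Up to the tolerance `η`, the hypothesis on the count says that `U` is at most `V` times its
      -- modulus. Taking `η` to be U/(8V) keeps the total error, including the passage from `count`
      -- to `R̃`, a small fraction of the main term.
      U V η : ℚ
      U = volume 0<p 0<c₀ H-large n-large
      V = ι (2 ℕ.* p ℕ.* E)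

      0<U : 0ℚ ℚ.< U
      0<U = 0<volume 0<p 0<c₀ H-large n-large

      0<V : 0ℚ ℚ.< V
      0<V = subst (0ℚ ℚ.<_) (sym (ι-loss p)) (Rational.*-pos (Rational.*-pos (ℚ.positive⁻¹ (ι 2)) (Core.0<ι 0<p))
        (Core.^^-pos (Core.0<ι (ℕ.*-mono-< {0} {2} ℕ.z<s (ℕ.*-mono-< {0} {3} ℕ.z<s 0<c₀))) (suc k)))

      0<8V : 0ℚ ℚ.< ι 8 ℚ.* V
      0<8V = Rational.*-pos (ℚ.positive⁻¹ (ι 8)) 0<V

      η = U ℚ.* Rational.inv (ι 8 ℚ.* V) 0<8V

      0<η : 0ℚ ℚ.< η
      0<η = Rational.*-pos 0<U (Rational.inv-pos (ι 8 ℚ.* V) 0<8V)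

      8Vη≡U : ι 8 ℚ.* (V ℚ.* η) ≡ U
      8Vη≡U = trans (solve 3 (λ v u w → con (ι 8) :* (v :* (u :* w)) := u :* (con (ι 8) :* v :* w)) refl V U _)
        (trans (cong (λ z → U ℚ.* z) (Rational.*-inv (ι 8 ℚ.* V) 0<8V)) (ℚ.*-identityʳ U))
        where open +-*-Solver

      t≤2C₁B : ∀ {ν} → Approximate ν → ι t ℚ.≤ ι (2 ℕ.* C₁) ℚ.* seq B ν
      t≤2C₁B {ν} a = Core.*-cancel-pos (ι H) (Core.0<ι (ℕ.>-nonZero⁻¹ H)) (begin
        ι H ℚ.* ι t                            ≡⟨ trans (ℚ.*-comm (ι H) (ι t)) (sym (Core.ι-* t H)) ⟩
        ι (t ℕ.* H)                            ≤⟨ Core.ι-mono (m/n*n≤m (C₁ ℕ.* n) H) ⟩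
        ι (C₁ ℕ.* n)                           ≡⟨ Core.ι-* C₁ n ⟩
        ι C₁ ℚ.* ι n                           ≤⟨ ℚ.*-monoˡ-≤-nonNeg (ι C₁) (n≤2N a) ⟩
        ι C₁ ℚ.* (ι 2 ℚ.* seq N ν)             ≡⟨ cong (λ z → ι C₁ ℚ.* (ι 2 ℚ.* z)) (sym (BH≡N a)) ⟩
        ι C₁ ℚ.* (ι 2 ℚ.* (seq B ν ℚ.* ι H))
          ≡⟨ solve 4 (λ c d b h → c :* (d :* (b :* h)) := h :* (d :* c :* b)) refl (ι C₁) (ι 2) (seq B ν) (ι H) ⟩
        ι H ℚ.* (ι 2 ℚ.* ι C₁ ℚ.* seq B ν)     ≡⟨ cong (λ z → ι H ℚ.* (z ℚ.* seq B ν)) (sym (Core.ι-* 2 C₁)) ⟩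
        ι H ℚ.* (ι (2 ℕ.* C₁) ℚ.* seq B ν)     ∎)
        where
        open ℚ.≤-Reasoning
        open +-*-Solver

      module _ (lower : δ * B ^ suc k * (N ^ 2 / B [ 0<B ]) ≤ ∣ count ∣) where

        value-large : Eventually λ ν → U Core.² ℚ.≤ ι 16 ℚ.* V Core.² ℚ.* Core.∥ value ν R̃ ∥²
        value-large = weaken (λ ν (a , le , re-close , im-close) →
            Core.count-bound {U} {V} {seq ∣ count ∣ ν} {η} {seq (re count) ν} {seq (im count) ν} {seq (re R̃) ν}
                {seq (im R̃) ν} 0<U
              (subst (λ v → U ℚ.≤ v ℚ.* (seq ∣ count ∣ ν ℚ.+ η)) (sym (ι-loss p))
                (Core.volume-bound {seq δ ν} {seq B ν} {seq N ν} {seq (recip B 0<B) ν} {p = p} {n} {t} {H}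
                    {ι (2 ℕ.* C₁)} (suc k) (1≤pδ a) (t≤2C₁B a) (n≤2N a)
                  (B-inv a) (BH≡N a)
                  (subst (λ z → seq δ ν ℚ.* z ℚ.* (seq N ν ℚ.* (seq N ν ℚ.* 1ℚ) ℚ.* seq (recip B 0<B) ν) ℚ.≤ seq ∣ count
                      ∣ ν ℚ.+ η) (seq-^ B (suc k) ν) le)
                  (Rational.0≤fromℕ (2 ℕ.* C₁))))
              8Vη≡U (Rational.rootFrom-lower (s ν) ν (suc (Rational.ceil (s ν)) ℕ.* suc ν)) re-close im-close)
          (both approximate (both (≤-within lower η 0<η)
              (both (≈-within (re≈ R≈R̃) η 0<η) (≈-within (im≈ R≈R̃) η 0<η))))
          where
          s : ℕ → ℚ
          s ν = seq (re count) ν ℚ.* seq (re count) ν ℚ.+ seq (im count) ν ℚ.* seq (im count) ν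

        -- For each ε a single late index is examined, at which all points of [n] are approximated
        -- simultaneously. Half of ε covers clipping, which costs `n` times that half in a
        -- progression sum; the other half covers the rounding of the modulus.
        norm-large : ∀ i (0<n′ : 0ℝ < fromℕ n) → fromℚ c * δ ^ suc e ≤ ‖ f i ‖U¹⁺[ n , 0<n′ ]
        norm-large i 0<n′ = mk≤ λ ε 0<ε → let 0<½ε = half-pos 0<ε in weaken
          (λ ν (a , large , re-close , im-close , n-inv , tiny) → conclude 0<ε a large re-close im-close n-inv tiny)
          (both approximate (both value-large (both
            (eventually-∈ (interval n) (λ x → ≈-within (re≈ (≈ᶜ-sym (f≈f̃ i x))) _ 0<½ε))
            (both (eventually-∈ (interval n) (λ x → ≈-within (im≈ (≈ᶜ-sym (f≈f̃ i x))) _ 0<½ε))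
              (both (recip-inverse 0<n′) (Rational.archimedean _ 0<½ε))))))
          where
          F : ℕ → Fin (suc k) → ℤ → ℚ[i]
          F ν j x = value ν (f̃ j x)
          F-null : ∀ ν {x} → x ∉ interval n → F ν i x ≡ (0ℚ , 0ℚ)
          F-null ν {x} x∉ = cong (value ν) (restrict-null (x ∈? interval n) (f i x) x∉)
          conclude : ∀ {ν ε} → 0ℚ ℚ.< ε → Approximate ν → U Core.² ℚ.≤ ι 16 ℚ.* V Core.² ℚ.* Core.∥ value ν R̃ ∥² →
            (∀ {x} → x ∈ interval n → ℚ.∣ proj₁ (F ν i x) ℚ.- proj₁ (value ν (f i x)) ∣ ℚ.≤ ½ ℚ.* ε) →
            (∀ {x} → x ∈ interval n → ℚ.∣ proj₂ (F ν i x) ℚ.- proj₂ (value ν (f i x)) ∣ ℚ.≤ ½ ℚ.* ε) →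
            seq (recip (fromℕ n) 0<n′) ν ℚ.* ι n ≡ 1ℚ → Rational.1/suc ν ℚ.≤ ½ ℚ.* ε →
            seq (fromℚ c * δ ^ suc e) ν ℚ.≤ seq (largestSum (f i) n) ν ℚ.* seq (recip (fromℕ n) 0<n′) ν ℚ.+ ε
          conclude {ν} {ε} 0<ε a large re-close im-close n-inv tiny =
            subst (λ z → c ℚ.* z ℚ.≤ m ℚ.* w ℚ.+ ε) (sym (seq-^ δ (suc e) ν))
              (Core.norm-bound {c} {seq δ ν Core.^^ suc e} {scale p} {n} {M} {m} {w} {ε} (ℚ.<⇒≤ 0<c) c≤1
                  (Core.^^-nonNeg (0≤δ a) (suc e)) (small a) n<MG 0≤M M≤ n-inv (recip-nonNeg 0<n′ ν))
            where
            m = seq (largestSum (f i) n) ν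
            w = seq (recip (fromℕ n) 0<n′) ν
            h = Rational.1/suc ν
            0≤½ε : 0ℚ ℚ.≤ ½ ℚ.* ε
            0≤½ε = ℚ.<⇒≤ (half-pos 0<ε)
            M = m ℚ.+ h ℚ.+ ι n ℚ.* (½ ℚ.* ε)
            0≤m+h : 0ℚ ℚ.≤ m ℚ.+ h
            0≤m+h = Core.+-nonNeg (0≤max ν (map (λ P → ∣ ∑ P (f i) ∣) (progressions n))) (Rational.0≤1/suc ν)
            0≤M : 0ℚ ℚ.≤ M
            0≤M = Core.+-nonNeg 0≤m+h (Rational.*-nonNeg (Rational.0≤fromℕ n) 0≤½ε)
            n<MG : ι n ℚ.< M ℚ.* ι (scale p)
            n<MG = large-progression-sum 0<p 0<c₀ H-large n-large (F ν)
                (λ j x → restrict-small ν (x ∈? interval n) (f j x))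
              (λ v → value ν (clipᶜ (λ′ v))) (λ v → clip-small ν (λ′ v))
              (subst (λ z → U Core.² ℚ.≤ ι 16 ℚ.* V Core.² ℚ.* Core.∥ z ∥²) (value-R̃ ν) large)
              i (F-null ν) M
              (uniform (λ x → proj₁ (value ν (f i x))) (λ x → proj₁ (F ν i x)) (λ x∉ → cong proj₁ (F-null ν x∉)) 0≤m+h
                  0≤½ε re-close
                (λ P∈ → proj₁ (progression-sum ν n (f i) P∈)))
              (uniform (λ x → proj₂ (value ν (f i x))) (λ x → proj₂ (F ν i x)) (λ x∉ → cong proj₂ (F-null ν x∉)) 0≤m+h
                  0≤½ε im-close
                (λ P∈ → proj₂ (progression-sum ν n (f i) P∈)))
            M≤ : M ℚ.≤ m ℚ.+ ι n ℚ.* ε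
            M≤ = begin
              m ℚ.+ h ℚ.+ ι n ℚ.* (½ ℚ.* ε)
                ≤⟨ ℚ.+-monoˡ-≤ (ι n ℚ.* (½ ℚ.* ε)) (ℚ.+-monoʳ-≤ m (ℚ.≤-trans tiny
                  (ℚ.≤-trans (ℚ.≤-reflexive (sym (ℚ.*-identityˡ (½ ℚ.* ε))))
                      (ℚ.*-monoʳ-≤-nonNeg (½ ℚ.* ε) {{ℚ.nonNegative 0≤½ε}} (Core.ι-mono 0<n))))) ⟩
              m ℚ.+ ι n ℚ.* (½ ℚ.* ε) ℚ.+ ι n ℚ.* (½ ℚ.* ε)
                ≡⟨ solve 3 (λ m n e → m :+ n :* e :+ n :* e := m :+ n :* (e :+ e)) refl m (ι n) (½ ℚ.* ε) ⟩
              m ℚ.+ ι n ℚ.* (½ ℚ.* ε ℚ.+ ½ ℚ.* ε)                 ≡⟨ cong (λ z → m ℚ.+ ι n ℚ.* z) (Rational.halves ε) ⟩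
              m ℚ.+ ι n ℚ.* ε                                     ∎
              where
              open ℚ.≤-Reasoning
              open +-*-Solver

theorem1p3 : (k : ℕ) (2≤k : 2 ℕ.≤ k) →
  let instance
        k≢0 : NonZero k
        k≢0 = 2≤⇒nonZero 2≤k
  in
  Σ[ C ∈ ℕ ] 1 ℕ.≤ C ×
  ((C₀ : ℝ) → 1ℝ ≤ C₀ →
   Σ[ c ∈ ℝ ] 0ℝ < c ×
   ((N : ℝ) (1≤N : 1ℝ ≤ N) (⌊N⌋ : ℕ) (isFloor : IsFloor N ⌊N⌋)
    (δ : ℝ) (0<δ : 0ℝ < δ) → δ < c →
    (H : ℕ) .{{H≢0 : NonZero H}} →
    let 0<H : 0ℝ < fromℕ H
        0<H = fromℕ-pos H
        B : ℝ
        B = N / fromℕ H [ 0<H ]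
        0<B : 0ℝ < B
        0<B = /-pos (1≤⇒pos 1≤N) 0<H
    in
    recip δ 0<δ ^ C ≤ B → B ≤ N * δ ^ C →
    (λ′ : Vec ℤ k → ℂ) → OneBounded λ′ →
    (λ-support : SupportedOn (Cube (C₀ * B)) λ′) →
    (f : Fin k → ℤ → ℂ) → ((i : Fin k) → OneBounded (f i)) →
    (f-support : (i : Fin k) → SupportedOn[1… ⌊N⌋ ] (f i)) →
    δ * B ^ k * (N ^ 2 / B [ 0<B ]) ≤
      ∣ R H λ′ (cube-support (C₀ * B) λ-support) f (λ i → interval-support (f-support i)) ∣ →
    c * δ ^ C ≤ min (λ i → ‖ f i ‖U¹⁺[ ⌊N⌋ , floor-pos 1≤N isFloor ])))
theorem1p3 zero ()
theorem1p3 (suc k) 2≤k = 57 , ℕ.s≤s ℕ.z≤n , λ C₀ 1≤C₀ →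
  -- An integer bound for C₀, with a successor so that it is positive.
  let c₀ = suc (Rational.ceil (proj₁ (bounded C₀)))
      C₀≤c₀ = weaken (λ ν le → ℚ.≤-trans (Rational.≤-abs (seq C₀ ν)) (ℚ.≤-trans le
        (ℚ.≤-trans (Rational.≤-ceil _) (Core.ι-mono (ℕ.n≤1+n _))))) (proj₂ (proj₂ (bounded C₀)))
      module U = Uniformity k c₀ 56 ℕ.z<s C₀ C₀≤c₀
  in fromℚ U.c ,
     mk< U.c U.0<c (0 , λ _ _ → ℚ.≤-reflexive (ℚ.+-identityˡ U.c)) ,
     λ N 1≤N n isFloor δ 0<δ δ<c H B-large B-small λ′ λ-bounded λ-support f f-bounded f-support lower →
       ≤-min _ λ i → U.Bound.Counting.norm-large (Core.Constants.scale-power k c₀) N 1≤N n isFloor δ 0<δ δ<c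
         H (fromℕ-pos H) (/-pos (1≤⇒pos 1≤N) (fromℕ-pos H)) B-large B-small
         λ′ λ-bounded λ-support f f-bounded f-support lower i (floor-pos 1≤N isFloor)
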